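{- There is a deterministic algorithm in the synchronous multi-port message-passing model with crash failures such that, for all sufficiently large $n$ and every $t$ with $0\le t<n$, writing $\alpha=\frac tn$, it solves binary consensus with at most $t$ crashes in at most $n+3(1+\lg n)$ rounds, with nodes sending at most $\bigl(\frac{5}{1-\alpha}\bigr)^{8} n\lg n$ messages in total, each message carrying one bit.
   Context: Model: $n$ nodes with distinct names in $\{1,\dots,n\}$; $n$ and $t$ are known to all nodes. Computation proceeds in synchronous rounds starting simultaneously; in a round any node may send messages to any set of other nodes (multi-port), and all messages sent in a round are delivered in that round. An adversary may crash up to $t$ nodes at times of its choosing; a crashed node performs no further activity. Binary consensus: each node has an input bit and must irrevocably decide so that each decided value is the input of some node, no two nodes decide differently, and every non-crashed node eventually decides and halts. Running time is the number of rounds until all non-faulty nodes have halted. $\lg$ is the base-2 logarithm. -}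

module Defs where

open import Data.Nat using (ℕ; zero; suc; _+_; _*_; _∸_; _^_; _≤_; _<_; _<ᵇ_; _≡ᵇ_)
open import Data.Bool using (Bool; true; false; if_then_else_; _∨_; _∧_)
open import Data.Maybe using (Maybe; just; nothing; is-just)
open import Data.Fin using (Fin; _≟_)
open import Data.List using (List; map; allFin)
open import Data.Nat.ListAction using (sum)
open import Data.Product using (Σ; ∃; _×_; _,_)
open import Relation.Nullary using (¬_; does)
open import Relation.Binary.PropositionalEquality using (_≡_)

-- Deterministic algorithms in the synchronous multi-port model.
-- A node knows its name (Fin n) and input bit; n and t are parameters of
-- the algorithm (see 'ConsensusAlgorithm' below).  In every round a node
-- may send to each other node either no message ('nothing') or a single
-- bit ('just b').  After receiving the round's messages it updates its
-- state deterministically.  (The round number, if needed, can be kept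
-- in the local state.)

record Algorithm (n : ℕ) : Set₁ where
  field
    State    : Set
    init     : Fin n → Bool → State
    send     : State → Fin n → Maybe Bool
    step     : State → (Fin n → Maybe Bool) → State   -- inbox indexed by sender
    decision : State → Maybe Bool
    halted   : State → Bool

-- Crash adversary.  crash i = nothing : node i never crashes;
-- crash i = just c : node i crashes during round c (rounds numbered
-- 0,1,2,…); in round c it only sends the messages to those j with
-- partial i j = true, and from round c on it does nothing further.

record Adversary (n : ℕ) : Set where
  field
    crash   : Fin n → Maybe ℕ
    partial : Fin n → Fin n → Bool

open Adversary public

bit : Bool → ℕ
bit true  = 1
bit false = 0

countFin : {n : ℕ} → (Fin n → Bool) → ℕ
countFin {n} p = sum (map (λ i → bit (p i)) (allFin n))

faulty : {n : ℕ} → Adversary n → ℕ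
faulty adv = countFin (λ i → is-just (crash adv i))

crashedBy : {n : ℕ} → Adversary n → Fin n → ℕ → Bool
crashedBy adv i r with crash adv i
... | nothing = false
... | just c  = (c <ᵇ r) ∨ (c ≡ᵇ r)

module Execution {n : ℕ} (A : Algorithm n) (input : Fin n → Bool)
                 (adv : Adversary n) where
  open Algorithm A

  sentIn : (Fin n → State) → ℕ → Fin n → Fin n → Maybe Bool
  sentIn conf r i j with does (i ≟ j) | halted (conf i) | crash adv i
  ... | true  | _     | _       = nothing
  ... | false | true  | _       = nothing
  ... | false | false | nothing = send (conf i) j
  ... | false | false | just c  =
        if c ≡ᵇ r then (if partial adv i j then send (conf i) j else nothing)
        else if r <ᵇ c then send (conf i) j else nothing

  config : ℕ → Fin n → State
  config zero i    = init i (input i)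
  config (suc r) i =
    if halted (config r i) ∨ crashedBy adv i r
    then config r i
    else step (config r i) (λ j → sentIn (config r) r j i)

  sent : ℕ → Fin n → Fin n → Maybe Bool
  sent r = sentIn (config r) r

  messagesIn : ℕ → ℕ
  messagesIn r = sum (map (λ i → countFin (λ j → is-just (sent r i j))) (allFin n))

  messagesUpTo : ℕ → ℕ
  messagesUpTo zero    = 0
  messagesUpTo (suc K) = messagesUpTo K + messagesIn K

-- Bounds, encoded exactly in ℕ.
-- R ≤ n + 3(1 + lg n)  ⇔  R ∸ (n+3) ≤ 3 lg n  ⇔  2^(R ∸ (n+3)) ≤ n^3   (n ≥ 1)
RoundBound : ℕ → ℕ → Set
RoundBound n R = 2 ^ (R ∸ (n + 3)) ≤ n ^ 3

-- M ≤ (5/(1-α))^8 n lg n with α = t/n, i.e. M ≤ 5^8 n^9 lg n / (n-t)^8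
--   ⇔ M (n-t)^8 ≤ 5^8 n^9 lg n  ⇔  2^(M (n-t)^8) ≤ n^(5^8 n^9)   (n ≥ 1, t < n)
MessageBound : ℕ → ℕ → ℕ → Set
MessageBound n t M = 2 ^ (M * (n ∸ t) ^ 8) ≤ n ^ (5 ^ 8 * n ^ 9)

SolvesConsensusWithin : (n t : ℕ) → Algorithm n → Set
SolvesConsensusWithin n t A =
  (input : Fin n → Bool) (adv : Adversary n) → faulty adv ≤ t →
  let open Algorithm A
      open Execution A input adv in
  (∀ r i b → decision (config r i) ≡ just b → ∃ λ j → input j ≡ b)
  -- agreement (any two decisions, including of nodes that later crash)
  × (∀ r r′ i j b b′ → decision (config r i) ≡ just b →
        decision (config r′ j) ≡ just b′ → b ≡ b′)
  × (∀ r i b → decision (config r i) ≡ just b → decision (config (suc r) i) ≡ just b)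
  × (Σ ℕ λ R → RoundBound n R ×
        (∀ i → (∀ c → crash adv i ≡ just c → R ≤ c) →
           halted (config R i) ≡ true × ¬ (decision (config R i) ≡ nothing)))
  -- message complexity (messages are one bit each by construction)
  × (∀ K → MessageBound n t (messagesUpTo K))

{-# OPTIONS --safe #-}
module Submission where

-- Ones are flooded for n rounds over a sparse graph, each node forwarding once. While some node is
-- fresh, the set of knowers grows, so after n rounds the flood is quiescent; as any two sets of w
-- nodes are joined by an edge, at most one of the two opinions is then held by w or more live nodes.
-- For 1 + ⌊lg n⌋ rounds a node now keeps its opinion only if each of its 6 blocks of slots
-- contains a node with the same opinion. Small sets contract by half under this rule, so the minority
-- opinion dies out, while a core of the survivors supports itself and keeps the majority opinion.
-- In phase k of 1 + ⌊lg n⌋ two-round phases the undecided nodes query O(2^k) nodes each; a set of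
-- n / 2^(k+1) nodes necessarily queries the core, so fewer than that stay undecided.
--
-- Each graph exists by a union bound, phrased as a volume argument: a wiring is bad if it lies in one
-- of finitely many boxes whose total volume is less than that of the space of all wirings.
-- With r ≈ n / (n − t) the degrees are O(r^8), O(r²) and O(r 2^k). If n = O(r^4), the sparse graphs
-- need not exist, but complete graphs are within the budget.

open import Defs
open import Data.Bool using (T; Bool; true; false; if_then_else_; _∨_; _∧_; not)
open import Data.Bool.Properties using (∨-zeroʳ; ¬-not) renaming (_≟_ to _≟ᵇ_)
open import Data.Empty using (⊥; ⊥-elim)
open import Data.Fin using (Fin; zero; suc) renaming (_≟_ to _≟ᶠ_)
open import Data.Fin.Properties using (any?)
open import Data.List using (List; []; _∷_; _++_; map; length; allFin; concatMap; filterᵇ)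
open import Data.List.Membership.Propositional using (_∈_)
open import Data.List.Membership.Propositional.Properties using (∈-allFin; ∈-++⁺ˡ; ∈-++⁺ʳ; ∈-map⁺)
open import Data.List.Properties using (map-tabulate; length-tabulate; length-++; length-map)
open import Data.List.Relation.Unary.Any using (here; there)
open import Data.Maybe using (Maybe; just; nothing; is-just; is-nothing)
open import Data.Maybe.Properties using (just-injective)
open import Data.Nat
open import Data.Nat.DivMod using (_/_; _%_; m≡m%n+[m/n]*n; m%n<n; m/n*n≤m; m/n≤m)
open import Data.Nat.ListAction using (sum)
open import Data.Nat.Properties
open import Data.Nat.Tactic.RingSolver using (solve-∀)
open import Data.Product using (Σ; ∃; _×_; _,_; proj₁; proj₂)
open import Data.Sum using (_⊎_; inj₁; inj₂)
open import Data.Vec using (Vec; []; _∷_; lookup) renaming (tabulate to tabulateᵛ)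
open import Data.Vec.Properties using (lookup∘tabulate)
open import Function using (_∘_; id)
open import Relation.Binary.PropositionalEquality
open import Relation.Nullary using (¬_; yes; no; does; contradiction; Dec)

-- The exponent 8 is decided by the contraction. With blocks of length g, of order r², the event
-- that x nodes are all supported by a set of at most 2x nodes has probability about (gx/n)^6x, up
-- to constants, and there are about (n/x)^3x such pairs of sets. Six blocks let the first factor
-- win up to x of order n/g², that is n/r^4, and joining any two sets of that size takes a flooding
-- degree of order r^8. Blocks replace a count of supporters because "every block contains one" is a
-- product event, whose volume is an exact power. The flooding degree carries a huge constant, but
-- each node pays it once and not once per round, so its term lacks the factor lg n and is absorbed
-- by taking n large. Only the probing and query terms, of weight 320 · 2^8, compete with 5^8.

private
  variable
    A B     : Set
    n g θ k : ℕ

-- Sums, cardinalities and the volume argument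

∑ : List A → (A → ℕ) → ℕ
∑ xs f = sum (map f xs)

∑-mono-∈ : (xs : List A) {f g : A → ℕ} → (∀ x → x ∈ xs → f x ≤ g x) → ∑ xs f ≤ ∑ xs g
∑-mono-∈ []       h = z≤n
∑-mono-∈ (x ∷ xs) h = +-mono-≤ (h x (here refl)) (∑-mono-∈ xs (λ y y∈ → h y (there y∈)))

∑-mono : (xs : List A) {f g : A → ℕ} → (∀ x → f x ≤ g x) → ∑ xs f ≤ ∑ xs g
∑-mono xs h = ∑-mono-∈ xs (λ x _ → h x)

∑-cong : (xs : List A) {f g : A → ℕ} → (∀ x → f x ≡ g x) → ∑ xs f ≡ ∑ xs g
∑-cong []       h = refl
∑-cong (x ∷ xs) h = cong₂ _+_ (h x) (∑-cong xs h)

∑-+ : (xs : List A) (f g : A → ℕ) → ∑ xs (λ x → f x + g x) ≡ ∑ xs f + ∑ xs g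
∑-+ []       f g = refl
∑-+ (x ∷ xs) f g rewrite ∑-+ xs f g = interchange (f x) (g x) (∑ xs f) (∑ xs g)
  where
  interchange : ∀ a b c d → a + b + (c + d) ≡ a + c + (b + d)
  interchange = solve-∀

∑-*ˡ : (xs : List A) (c : ℕ) (f : A → ℕ) → ∑ xs (λ x → c * f x) ≡ c * ∑ xs f
∑-*ˡ []       c f = sym (*-zeroʳ c)
∑-*ˡ (x ∷ xs) c f rewrite ∑-*ˡ xs c f = sym (*-distribˡ-+ c (f x) (∑ xs f))

∑-*ʳ : (xs : List A) (f : A → ℕ) (c : ℕ) → ∑ xs (λ x → f x * c) ≡ ∑ xs f * c
∑-*ʳ xs f c = trans (∑-cong xs (λ x → *-comm (f x) c)) (trans (∑-*ˡ xs c f) (*-comm c (∑ xs f)))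

∑-const : (xs : List A) (c : ℕ) → ∑ xs (λ _ → c) ≡ length xs * c
∑-const []       c = refl
∑-const (x ∷ xs) c = cong (c +_) (∑-const xs c)

∑-++ : (xs ys : List A) (f : A → ℕ) → ∑ (xs ++ ys) f ≡ ∑ xs f + ∑ ys f
∑-++ []       ys f = refl
∑-++ (x ∷ xs) ys f rewrite ∑-++ xs ys f = sym (+-assoc (f x) (∑ xs f) (∑ ys f))

∑-map : (xs : List A) (g : A → B) (f : B → ℕ) → ∑ (map g xs) f ≡ ∑ xs (f ∘ g)
∑-map []       g f = refl
∑-map (x ∷ xs) g f = cong (f (g x) +_) (∑-map xs g f)

∑-concatMap : (xs : List A) (g : A → List B) (f : B → ℕ) →
  ∑ (concatMap g xs) f ≡ ∑ xs (λ x → ∑ (g x) f)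
∑-concatMap []       g f = refl
∑-concatMap (x ∷ xs) g f =
  trans (∑-++ (g x) (concatMap g xs) f) (cong (∑ (g x) f +_) (∑-concatMap xs g f))

∑-swap : (xs : List A) (ys : List B) (f : A → B → ℕ) →
  ∑ xs (λ x → ∑ ys (f x)) ≡ ∑ ys (λ y → ∑ xs (λ x → f x y))
∑-swap []       ys f = sym (trans (∑-const ys 0) (*-zeroʳ (length ys)))
∑-swap (x ∷ xs) ys f =
  trans (cong (∑ ys (f x) +_) (∑-swap xs ys f)) (sym (∑-+ ys (f x) (λ y → ∑ xs (λ z → f z y))))

∑-filterᵇ : (p : A → Bool) (xs : List A) (f : A → ℕ) →
  ∑ (filterᵇ p xs) f ≡ ∑ xs (λ x → bit (p x) * f x)
∑-filterᵇ p []       f = refl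
∑-filterᵇ p (x ∷ xs) f with p x
... | true  = cong₂ _+_ (sym (+-identityʳ (f x))) (∑-filterᵇ p xs f)
... | false = ∑-filterᵇ p xs f

∑-≤-length* : (xs : List A) (f : A → ℕ) (c : ℕ) → (∀ x → x ∈ xs → f x ≤ c) → ∑ xs f ≤ length xs * c
∑-≤-length* xs f c h = ≤-trans (∑-mono-∈ xs h) (≤-reflexive (∑-const xs c))

∑-average : (xs : List A) (f : A → ℕ) (c : ℕ) → ∑ xs f < length xs * c → ∃ λ x → f x < c
∑-average (x ∷ xs) f c h with f x <? c
... | yes fx<c = x , fx<c
... | no  fx≮c = ∑-average xs f c
  (+-cancelˡ-< c _ _ (≤-<-trans (+-monoˡ-≤ (∑ xs f) (≮⇒≥ fx≮c)) h))

∈-filterᵇ : (p : A → Bool) {xs : List A} {x : A} → x ∈ xs → p x ≡ true → x ∈ filterᵇ p xs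
∈-filterᵇ p {y ∷ ys} (here refl) px rewrite px = here refl
∈-filterᵇ p {y ∷ ys} (there x∈)  px with p y
... | true  = there (∈-filterᵇ p x∈ px)
... | false = ∈-filterᵇ p x∈ px

∈-filterᵇ⁻ : (p : A → Bool) (xs : List A) {x : A} → x ∈ filterᵇ p xs → x ∈ xs × p x ≡ true
∈-filterᵇ⁻ p (y ∷ ys) x∈ with p y in py
∈-filterᵇ⁻ p (y ∷ ys) (here refl) | true  = here refl , py
∈-filterᵇ⁻ p (y ∷ ys) (there x∈)  | true  = let m , q = ∈-filterᵇ⁻ p ys x∈ in there m , q
... | false = let m , q = ∈-filterᵇ⁻ p ys x∈ in there m , q

count : (A → Bool) → List A → ℕ
count p xs = ∑ xs (λ x → bit (p x))

length-filterᵇ-≤ : (p : A → Bool) (xs : List A) → length (filterᵇ p xs) ≤ length xs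
length-filterᵇ-≤ p []       = z≤n
length-filterᵇ-≤ p (x ∷ xs) with p x
... | true  = s≤s (length-filterᵇ-≤ p xs)
... | false = m≤n⇒m≤1+n (length-filterᵇ-≤ p xs)

bit-mono : {a b : Bool} → (a ≡ true → b ≡ true) → bit a ≤ bit b
bit-mono {false} h = z≤n
bit-mono {true}  h rewrite h refl = ≤-refl

bit-∨ : {a b c : Bool} → (a ≡ true → b ≡ true ⊎ c ≡ true) → bit a ≤ bit b + bit c
bit-∨ {false} h = z≤n
bit-∨ {true} {b} h with h refl
... | inj₁ refl = s≤s z≤n
... | inj₂ refl = m≤n+m 1 (bit b)

bit-split : (a b : Bool) → bit a ≡ bit (a ∧ b) + bit (a ∧ not b)
bit-split false b     = refl
bit-split true  false = refl
bit-split true  true  = refl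

bit≤1 : (a : Bool) → bit a ≤ 1
bit≤1 true  = ≤-refl
bit≤1 false = z≤n

∑Fin-suc : (f : Fin (suc n) → ℕ) → ∑ (allFin (suc n)) f ≡ f zero + ∑ (allFin n) (f ∘ suc)
∑Fin-suc {n} f = cong (λ ys → f zero + sum ys)
  (trans (map-tabulate suc f) (sym (map-tabulate id (f ∘ suc))))

length-allFin : (n : ℕ) → length (allFin n) ≡ n
length-allFin n = length-tabulate id

∑Fin-const : (n c : ℕ) → ∑ (allFin n) (λ _ → c) ≡ n * c
∑Fin-const n c = trans (∑-const (allFin n) c) (cong (_* c) (length-allFin n))

-- Cardinalities of sets of nodes

_⊆_ : {A : Set} → (A → Bool) → (A → Bool) → Set
p ⊆ q = ∀ x → p x ≡ true → q x ≡ true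

card : (Fin n → Bool) → ℕ
card = countFin

card-mono : {p q : Fin n → Bool} → p ⊆ q → card p ≤ card q
card-mono {n} h = ∑-mono (allFin n) (λ i → bit-mono (h i))

card-∪ : {p q r : Fin n → Bool} → (∀ i → p i ≡ true → q i ≡ true ⊎ r i ≡ true) →
  card p ≤ card q + card r
card-∪ {n} {p} {q} {r} h = ≤-trans (∑-mono (allFin n) (λ i → bit-∨ (h i)))
  (≤-reflexive (∑-+ (allFin n) (bit ∘ q) (bit ∘ r)))

card-split : (p q : Fin n → Bool) →
  card p ≡ card (λ i → p i ∧ q i) + card (λ i → p i ∧ not (q i))
card-split {n} p q = trans (∑-cong (allFin n) (λ i → bit-split (p i) (q i)))
  (∑-+ (allFin n) (λ i → bit (p i ∧ q i)) (λ i → bit (p i ∧ not (q i))))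

card-≤ : (p : Fin n → Bool) → card p ≤ n
card-≤ {n} p = ≤-trans (∑-mono (allFin n) (λ i → bit≤1 (p i)))
  (≤-reflexive (trans (∑Fin-const n 1) (*-identityʳ n)))

card-full : (p : Fin n → Bool) → (∀ i → p i ≡ true) → card p ≡ n
card-full {n} p h = trans (∑-cong (allFin n) (λ i → cong bit (h i)))
  (trans (∑Fin-const n 1) (*-identityʳ n))

card-suc : (p : Fin (suc n) → Bool) → card p ≡ bit (p zero) + card (p ∘ suc)
card-suc p = ∑Fin-suc (bit ∘ p)

card-pos : (p : Fin n → Bool) (i : Fin n) → p i ≡ true → 1 ≤ card p
card-pos {suc n} p zero    h rewrite card-suc p | h = s≤s z≤n
card-pos {suc n} p (suc i) h rewrite card-suc p =
  ≤-trans (card-pos (p ∘ suc) i h) (m≤n+m _ (bit (p zero)))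

card-inhabited : (p : Fin n → Bool) → 1 ≤ card p → ∃ λ i → p i ≡ true
card-inhabited {zero} p ()
card-inhabited {suc n} p h = search (p zero) refl (subst (1 ≤_) (card-suc p) h)
  where
  search : ∀ b → p zero ≡ b → 1 ≤ bit (p zero) + card (p ∘ suc) → ∃ λ i → p i ≡ true
  search true  p0 _  = zero , p0
  search false p0 h′ rewrite p0 = let i , pi = card-inhabited (p ∘ suc) h′ in suc i , pi

card-strict : {p q : Fin n → Bool} → p ⊆ q → ∀ i → q i ≡ true → p i ≡ false → card p < card q
card-strict {n} {p} {q} p⊆q i qi pi = begin-strict
  card p                                                        ≡⟨ +-identityʳ (card p) ⟨
  card p + 0                                                    <⟨ +-monoʳ-< (card p) (card-pos _ i extra) ⟩
  card p + card (λ j → q j ∧ not (p j))                         ≤⟨ +-monoˡ-≤ _ (card-mono p⊆q∧p) ⟩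
  card (λ j → q j ∧ p j) + card (λ j → q j ∧ not (p j))         ≡⟨ card-split q p ⟨
  card q                                                        ∎
  where
  open ≤-Reasoning
  extra : q i ∧ not (p i) ≡ true
  extra rewrite qi | pi = refl
  p⊆q∧p : p ⊆ (λ j → q j ∧ p j)
  p⊆q∧p j pj rewrite p⊆q j pj = pj

∏ : (n : ℕ) → (Fin n → ℕ) → ℕ
∏ zero    f = 1
∏ (suc n) f = f zero * ∏ n (f ∘ suc)

-- The boxes ∏ᵢ (bad i) have total volume below that of the cube vals^n, so they do not cover it.
avoid-boxes : (vals : List A) (n : ℕ) (boxes : List (Fin n → A → Bool)) →
  ∑ boxes (λ bad → ∏ n (λ i → count (bad i) vals)) < length vals ^ n →
  Σ (Fin n → A) λ h → ∀ bad → bad ∈ boxes → ∃ λ i → bad i (h i) ≡ false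
avoid-boxes vals zero [] _ = (λ ()) , λ _ ()
avoid-boxes vals zero (_ ∷ boxes) (s≤s ())
avoid-boxes {A} vals (suc n) boxes small = h , avoids
  where
  tailVolume : (Fin (suc n) → A → Bool) → ℕ
  tailVolume bad = ∏ n (λ i → count (bad (suc i)) vals)
  volumes : ∑ boxes (λ bad → ∏ (suc n) (λ i → count (bad i) vals)) ≡
            ∑ vals (λ v → ∑ boxes (λ bad → bit (bad zero v) * tailVolume bad))
  volumes = trans
    (∑-cong boxes (λ bad → sym (∑-*ʳ vals (λ v → bit (bad zero v)) (tailVolume bad))))
    (∑-swap boxes vals _)
  -- Conditional expectations: averaging over the first coordinate yields a value `v` for which the
  -- boxes still in play have total tail volume below that of the remaining cube.
  best : ∃ λ v → ∑ boxes (λ bad → bit (bad zero v) * tailVolume bad) < length vals ^ n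
  best = ∑-average vals _ _ (subst (_< length vals ^ suc n) volumes small)
  v = proj₁ best
  tails : List (Fin n → A → Bool)
  tails = map (λ bad i → bad (suc i)) (filterᵇ (λ bad → bad zero v) boxes)
  rest = avoid-boxes vals n tails
    (subst (_< length vals ^ n)
      (sym (trans (∑-map (filterᵇ (λ bad → bad zero v) boxes) _ _)
                  (∑-filterᵇ (λ bad → bad zero v) boxes tailVolume)))
      (proj₂ best))
  h : Fin (suc n) → A
  h zero    = v
  h (suc i) = proj₁ rest i
  ∈-map : {X Y : Set} (f : X → Y) {x : X} {xs : List X} → x ∈ xs → f x ∈ map f xs
  ∈-map f (here refl) = here refl
  ∈-map f (there x∈)  = there (∈-map f x∈)
  avoids : ∀ bad → bad ∈ boxes → ∃ λ i → bad i (h i) ≡ false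
  avoids bad bad∈ with bad zero v in eq
  ... | false = zero , eq
  ... | true  with proj₂ rest _ (∈-map (λ b i → b (suc i)) (∈-filterᵇ (λ b → b zero v) bad∈ eq))
  ...   | i , avoided = suc i , avoided

-- Wirings and the probability that a random one fails

^-distribʳ-* : ∀ m n k → (m * n) ^ k ≡ m ^ k * n ^ k
^-distribʳ-* m n zero    = refl
^-distribʳ-* m n (suc k) rewrite ^-distribʳ-* m n k = interchange m n (m ^ k) (n ^ k)
  where
  interchange : ∀ a b c d → a * b * (c * d) ≡ a * c * (b * d)
  interchange = solve-∀

-- Bernoulli's (1 + b/c)^q ≥ 1 + qb/c with the denominators cleared, so that it stays in ℕ.
bernoulli : ∀ b c q → c ^ q * (c + q * b) ≤ (c + b) ^ q * c
bernoulli b c zero    = ≤-reflexive (base c)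
  where
  base : ∀ c → 1 * (c + 0) ≡ 1 * c
  base = solve-∀
bernoulli b c (suc q) = begin
  c * c ^ q * (c + (b + q * b))                       ≤⟨ m≤m+n _ (c ^ q * (b * (q * b))) ⟩
  c * c ^ q * (c + (b + q * b)) + c ^ q * (b * (q * b)) ≡⟨ expand b c (c ^ q) (q * b) ⟩
  (c + b) * (c ^ q * (c + q * b))                     ≤⟨ *-monoʳ-≤ (c + b) (bernoulli b c q) ⟩
  (c + b) * ((c + b) ^ q * c)                         ≡⟨ *-assoc (c + b) _ c ⟨
  (c + b) * (c + b) ^ q * c                           ∎
  where
  open ≤-Reasoning
  expand : ∀ b c p z → c * p * (c + (b + z)) + p * (b * z) ≡ (c + b) * (p * (c + z))
  expand = solve-∀

-- Bernoulli's factor 1 + qb/c is at least 2 when qb ≥ c. The case c = 0 is separate because the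
-- proof cancels c; there `1 ≤ q` makes 0^q vanish.
halving : ∀ b c q → 1 ≤ q → c + b ≤ q * b → 2 * c ^ q ≤ (c + b) ^ q
halving b zero    (suc q) _ _ = z≤n
halving b c@(suc _) q _ h = *-cancelʳ-≤ _ _ c (begin
  2 * c ^ q * c         ≡⟨ rearrange (c ^ q) c ⟩
  c ^ q * (c + c)       ≤⟨ *-monoʳ-≤ (c ^ q) (+-monoʳ-≤ c (≤-trans (m≤m+n c b) h)) ⟩
  c ^ q * (c + q * b)   ≤⟨ bernoulli b c q ⟩
  (c + b) ^ q * c       ∎)
  where
  open ≤-Reasoning
  rearrange : ∀ p c → 2 * p * c ≡ p * (c + c)
  rearrange = solve-∀

-- Half of the bound (1 + 1/k)^k ≤ 4: for u at most (k + 1)/2 the quantity 1 - u/(k + 1) is at least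
-- 1/2.
[1+k]^u≤2k^u : ∀ k u → 2 * u ≤ suc k → suc k ^ u ≤ 2 * k ^ u
[1+k]^u≤2k^u k u 2u≤1+k = *-cancelʳ-≤ _ _ (suc k) (+-cancelʳ-≤ (suc k * suc k ^ u) _ _ (begin
  suc k ^ u * suc k + suc k * suc k ^ u   ≡⟨ double (suc k) (suc k ^ u) ⟩
  2 * (suc k * suc k ^ u)                 ≤⟨ *-monoʳ-≤ 2 (reversed u) ⟩
  2 * (k ^ u * suc k + u * suc k ^ u)     ≡⟨ spread (k ^ u) (suc k) u (suc k ^ u) ⟩
  2 * k ^ u * suc k + 2 * u * suc k ^ u   ≤⟨ +-monoʳ-≤ (2 * k ^ u * suc k) (*-monoˡ-≤ (suc k ^ u) 2u≤1+k) ⟩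
  2 * k ^ u * suc k + suc k * suc k ^ u   ∎))
  where
  open ≤-Reasoning
  double : ∀ a p → p * a + a * p ≡ 2 * (a * p)
  double = solve-∀
  spread : ∀ p a u r → 2 * (p * a + u * r) ≡ 2 * p * a + 2 * u * r
  spread = solve-∀
  -- (1 − 1/(k+1))^u ≥ 1 − u/(k+1)
  reversed : ∀ u → suc k * suc k ^ u ≤ k ^ u * suc k + u * suc k ^ u
  reversed zero    = ≤-reflexive (base k)
    where
    base : ∀ k → suc k * 1 ≡ 1 * suc k + 0
    base = solve-∀
  reversed (suc u) = begin
    suc k * (suc k * p)                                ≡⟨ peel k p ⟩
    k * (suc k * p) + suc k * p                        ≤⟨ +-monoˡ-≤ _ (*-monoʳ-≤ k (reversed u)) ⟩
    k * (k ^ u * suc k + u * p) + suc k * p            ≤⟨ m≤m+n _ (u * p) ⟩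
    k * (k ^ u * suc k + u * p) + suc k * p + u * p    ≡⟨ collect k (k ^ u) u p ⟩
    k * k ^ u * suc k + suc u * (suc k * p)            ∎
    where
    p = suc k ^ u
    peel : ∀ k p → suc k * (suc k * p) ≡ k * (suc k * p) + suc k * p
    peel = solve-∀
    collect : ∀ k z u p → k * (z * suc k + u * p) + suc k * p + u * p ≡ k * z * suc k + suc u * (suc k * p)
    collect = solve-∀

-- An elementary stand-in for (1 + 1/k)^k < e: each half of the exponent contributes a factor 2. The
-- 4 becomes the constant of `length-subsets≤`.
[1+k]^k≤4k^k : ∀ k → suc k ^ k ≤ 4 * k ^ k
[1+k]^k≤4k^k k = begin
  suc k ^ k                      ≡⟨ cong (suc k ^_) k≡ ⟨
  suc k ^ (u + v)                ≡⟨ ^-distribˡ-+-* (suc k) u v ⟩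
  suc k ^ u * suc k ^ v          ≤⟨ *-mono-≤ ([1+k]^u≤2k^u k u 2u≤) ([1+k]^u≤2k^u k v 2v≤) ⟩
  2 * k ^ u * (2 * k ^ v)        ≡⟨ four (k ^ u) (k ^ v) ⟩
  4 * (k ^ u * k ^ v)            ≡⟨ cong (4 *_) (^-distribˡ-+-* k u v) ⟨
  4 * k ^ (u + v)                ≡⟨ cong (λ x → 4 * k ^ x) k≡ ⟩
  4 * k ^ k                      ∎
  where
  open ≤-Reasoning
  u = ⌊ k /2⌋
  v = ⌈ k /2⌉
  k≡ : u + v ≡ k
  k≡ = ⌊n/2⌋+⌈n/2⌉≡n k
  four : ∀ a b → 2 * a * (2 * b) ≡ 4 * (a * b)
  four = solve-∀
  2u≤ : 2 * u ≤ suc k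
  2u≤ = begin
    2 * u     ≡⟨ cong (u +_) (+-identityʳ u) ⟩
    u + u     ≤⟨ +-monoʳ-≤ u (⌊n/2⌋-mono (n≤1+n k)) ⟩
    u + v     ≡⟨ k≡ ⟩
    k         ≤⟨ n≤1+n k ⟩
    suc k     ∎
  2v≤ : 2 * v ≤ suc k
  2v≤ = begin
    2 * v                           ≡⟨ cong (v +_) (+-identityʳ v) ⟩
    v + v                           ≤⟨ +-monoʳ-≤ v (⌊n/2⌋-mono (n≤1+n (suc k))) ⟩
    ⌊ suc k /2⌋ + ⌈ suc k /2⌉       ≡⟨ ⌊n/2⌋+⌈n/2⌉≡n (suc k) ⟩
    suc k                           ∎

-- Counting blocks and slots

tuples : List A → (k : ℕ) → List (Vec A k)
tuples xs zero    = [] ∷ []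
tuples xs (suc k) = concatMap (λ x → map (x ∷_) (tuples xs k)) xs

∑-tuples : (xs : List A) (k : ℕ) (f : Vec A (suc k) → ℕ) →
  ∑ (tuples xs (suc k)) f ≡ ∑ xs (λ x → ∑ (tuples xs k) (λ v → f (x ∷ v)))
∑-tuples xs k f = trans (∑-concatMap xs _ f) (∑-cong xs (λ x → ∑-map (tuples xs k) (x ∷_) f))

length-∑ : (xs : List A) → length xs ≡ ∑ xs (λ _ → 1)
length-∑ xs = sym (trans (∑-const xs 1) (*-identityʳ (length xs)))

length-tuples : (xs : List A) (k : ℕ) → length (tuples xs k) ≡ length xs ^ k
length-tuples xs zero    = refl
length-tuples xs (suc k) = begin
  length (tuples xs (suc k))               ≡⟨ length-∑ (tuples xs (suc k)) ⟩
  ∑ (tuples xs (suc k)) (λ _ → 1)          ≡⟨ ∑-tuples xs k (λ _ → 1) ⟩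
  ∑ xs (λ _ → ∑ (tuples xs k) (λ _ → 1))   ≡⟨ ∑-const xs _ ⟩
  length xs * ∑ (tuples xs k) (λ _ → 1)    ≡⟨ cong (length xs *_) (length-∑ (tuples xs k)) ⟨
  length xs * length (tuples xs k)         ≡⟨ cong (length xs *_) (length-tuples xs k) ⟩
  length xs ^ suc k                        ∎
  where open ≡-Reasoning

∈-concatMap : {A B : Set} (f : A → List B) {x : A} {y : B} {xs : List A} →
  x ∈ xs → y ∈ f x → y ∈ concatMap f xs
∈-concatMap f (here refl)           y∈ = ∈-++⁺ˡ y∈
∈-concatMap f {xs = z ∷ _} (there x∈) y∈ = ∈-++⁺ʳ (f z) (∈-concatMap f x∈ y∈)

∈-tuples : (xs : List A) → (∀ x → x ∈ xs) → (v : Vec A k) → v ∈ tuples xs k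
∈-tuples xs all∈ []      = here refl
∈-tuples xs all∈ (x ∷ v) = ∈-concatMap _ (all∈ x) (∈-map⁺ (x ∷_) (∈-tuples xs all∈ v))

hits : (Fin n → Bool) → Vec (Fin n) g → Bool
hits p []      = false
hits p (x ∷ b) = p x ∨ hits p b

-- One hit per block instead of a threshold on the number of hits: blocks are independent, so the
-- slots that pass are counted by an exact power, `count-enough`, and those that fail by a union
-- bound, `count-lacking`.
enough : (Fin n → Bool) → Vec (Vec (Fin n) g) θ → Bool
enough p []      = true
enough p (b ∷ v) = hits p b ∧ enough p v

hits-cong : {p q : Fin n → Bool} → (∀ i → p i ≡ q i) → (b : Vec (Fin n) g) → hits p b ≡ hits q b
hits-cong h []      = refl
hits-cong h (x ∷ b) = cong₂ _∨_ (h x) (hits-cong h b)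

enough-cong : {p q : Fin n → Bool} → (∀ i → p i ≡ q i) →
  (v : Vec (Vec (Fin n) g) θ) → enough p v ≡ enough q v
enough-cong h []      = refl
enough-cong h (b ∷ v) = cong₂ _∧_ (hits-cong h b) (enough-cong h v)

Wiring : ℕ → ℕ → ℕ → Set
Wiring n g θ = Fin n → Vec (Vec (Fin n) g) θ

blocks : (n g : ℕ) → List (Vec (Fin n) g)
blocks n g = tuples (allFin n) g

slots : (n g θ : ℕ) → List (Vec (Vec (Fin n) g) θ)
slots n g θ = tuples (blocks n g) θ

length-blocks : ∀ n g → length (blocks n g) ≡ n ^ g
length-blocks n g = trans (length-tuples (allFin n) g) (cong (_^ g) (length-allFin n))

length-slots : ∀ n g θ → length (slots n g θ) ≡ (n ^ g) ^ θ
length-slots n g θ = trans (length-tuples (blocks n g) θ) (cong (_^ θ) (length-blocks n g))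

count≤length : (p : A → Bool) (xs : List A) → count p xs ≤ length xs
count≤length p xs = ≤-trans (∑-mono xs (λ x → bit≤1 (p x))) (≤-reflexive (sym (length-∑ xs)))

bit-∧ : ∀ a b → bit (a ∧ b) ≡ bit a * bit b
bit-∧ false b = refl
bit-∧ true  b = sym (+-identityʳ (bit b))

count-product : {A B : Set} (p : A → Bool) (q : B → Bool) (xs : List A) (ys : List B) →
  ∑ xs (λ x → ∑ ys (λ y → bit (p x ∧ q y))) ≡ count p xs * count q ys
count-product p q xs ys = trans
  (∑-cong xs (λ x → trans (∑-cong ys (λ y → bit-∧ (p x) (q y))) (∑-*ˡ ys (bit (p x)) (bit ∘ q))))
  (∑-*ʳ xs (bit ∘ p) (count q ys))

∑-union : {A B : Set} (p : A → Bool) (q : B → Bool) (r : A → B → Bool) (xs : List A) (ys : List B) →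
  (∀ x y → r x y ≡ true → p x ≡ true ⊎ q y ≡ true) →
  ∑ xs (λ x → ∑ ys (λ y → bit (r x y))) ≤ count p xs * length ys + length xs * count q ys
∑-union p q r xs ys h = begin
  ∑ xs (λ x → ∑ ys (λ y → bit (r x y)))
    ≤⟨ ∑-mono xs (λ x → ∑-mono ys (λ y → bit-∨ (h x y))) ⟩
  ∑ xs (λ x → ∑ ys (λ y → bit (p x) + bit (q y)))
    ≡⟨ ∑-cong xs (λ x → trans (∑-+ ys (λ _ → bit (p x)) (bit ∘ q))
         (cong (_+ count q ys) (trans (∑-const ys (bit (p x))) (*-comm (length ys) (bit (p x)))))) ⟩
  ∑ xs (λ x → bit (p x) * length ys + count q ys)
    ≡⟨ ∑-+ xs _ (λ _ → count q ys) ⟩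
  ∑ xs (λ x → bit (p x) * length ys) + ∑ xs (λ _ → count q ys)
    ≡⟨ cong₂ _+_ (∑-*ʳ xs (bit ∘ p) (length ys)) (∑-const xs (count q ys)) ⟩
  count p xs * length ys + length xs * count q ys ∎
  where open ≤-Reasoning

not-∨ : ∀ a b → not (a ∨ b) ≡ not a ∧ not b
not-∨ true  b = refl
not-∨ false b = refl

∨-true : ∀ {a b} → a ∨ b ≡ true → a ≡ true ⊎ b ≡ true
∨-true {true}  h = inj₁ refl
∨-true {false} h = inj₂ h

not-∧-true : ∀ {a b} → not (a ∧ b) ≡ true → not a ≡ true ⊎ not b ≡ true
not-∧-true {true}  h = inj₂ h
not-∧-true {false} h = inj₁ refl

count-misses : (B : Fin n → Bool) (g : ℕ) →
  count (λ b → not (hits B b)) (blocks n g) ≡ card (λ i → not (B i)) ^ g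
count-misses B zero    = refl
count-misses {n} B (suc g) = begin
  count (λ b → not (hits B b)) (blocks n (suc g))
    ≡⟨ ∑-tuples (allFin n) g _ ⟩
  ∑ (allFin n) (λ x → ∑ (blocks n g) (λ b → bit (not (B x ∨ hits B b))))
    ≡⟨ ∑-cong (allFin n) (λ x → ∑-cong (blocks n g) (λ b → cong bit (not-∨ (B x) (hits B b)))) ⟩
  ∑ (allFin n) (λ x → ∑ (blocks n g) (λ b → bit (not (B x) ∧ not (hits B b))))
    ≡⟨ count-product (λ x → not (B x)) (λ b → not (hits B b)) (allFin n) (blocks n g) ⟩
  card (λ i → not (B i)) * count (λ b → not (hits B b)) (blocks n g)
    ≡⟨ cong (card (λ i → not (B i)) *_) (count-misses B g) ⟩
  card (λ i → not (B i)) ^ suc g ∎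
  where open ≡-Reasoning

-- Union bound over the `g` entries: a random block meets `Y` with probability at most g · |Y| / n,
-- written without division.
count-hits : (Y : Fin n → Bool) (g : ℕ) → n * count (hits Y) (blocks n g) ≤ g * card Y * n ^ g
count-hits {n} Y zero    = ≤-reflexive (*-zeroʳ n)
count-hits {n} Y (suc g) = begin
  n * count (hits Y) (blocks n (suc g))
    ≡⟨ cong (n *_) (∑-tuples (allFin n) g _) ⟩
  n * ∑ (allFin n) (λ x → ∑ (blocks n g) (λ b → bit (Y x ∨ hits Y b)))
    ≤⟨ *-monoʳ-≤ n (∑-union Y (hits Y) _ (allFin n) (blocks n g) (λ x b → ∨-true)) ⟩
  n * (card Y * length (blocks n g) + length (allFin n) * h)
    ≡⟨ cong₂ (λ a c → n * (card Y * a + c * h)) (length-blocks n g) (length-allFin n) ⟩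
  n * (card Y * n ^ g + n * h)
    ≤⟨ *-monoʳ-≤ n (+-monoʳ-≤ (card Y * n ^ g) (count-hits Y g)) ⟩
  n * (card Y * n ^ g + g * card Y * n ^ g)
    ≡⟨ collect n (card Y) (n ^ g) g ⟩
  suc g * card Y * n ^ suc g ∎
  where
  open ≤-Reasoning
  h = count (hits Y) (blocks n g)
  collect : ∀ n y p g → n * (y * p + g * y * p) ≡ suc g * y * (n * p)
  collect = solve-∀

count-enough : (Y : Fin n → Bool) (g θ : ℕ) →
  count (enough Y) (slots n g θ) ≡ count (hits Y) (blocks n g) ^ θ
count-enough Y g zero    = refl
count-enough {n} Y g (suc θ) = trans (∑-tuples (blocks n g) θ _)
  (trans (count-product (hits Y) (enough Y) (blocks n g) (slots n g θ))
    (cong (count (hits Y) (blocks n g) *_) (count-enough Y g θ)))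

count-enough-≤ : (Y : Fin n → Bool) (g θ : ℕ) →
  n ^ θ * count (enough Y) (slots n g θ) ≤ (g * card Y) ^ θ * (n ^ g) ^ θ
count-enough-≤ {n} Y g θ = begin
  n ^ θ * count (enough Y) (slots n g θ)         ≡⟨ cong (n ^ θ *_) (count-enough Y g θ) ⟩
  n ^ θ * count (hits Y) (blocks n g) ^ θ        ≡⟨ ^-distribʳ-* n _ θ ⟨
  (n * count (hits Y) (blocks n g)) ^ θ          ≤⟨ ^-monoˡ-≤ θ (count-hits Y g) ⟩
  (g * card Y * n ^ g) ^ θ                       ≡⟨ ^-distribʳ-* (g * card Y) (n ^ g) θ ⟩
  (g * card Y) ^ θ * (n ^ g) ^ θ                 ∎
  where open ≤-Reasoning

-- Union bound over the blocks: a miss probability of at most 1/K for one block becomes at most θ/K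
-- for `θ` of them.
count-lacking : (B : Fin n → Bool) (g θ K : ℕ) →
  K * count (λ b → not (hits B b)) (blocks n g) ≤ n ^ g →
  K * count (λ v → not (enough B v)) (slots n g θ) ≤ θ * (n ^ g) ^ θ
count-lacking B g zero    K h = ≤-reflexive (*-zeroʳ K)
count-lacking {n} B g (suc θ) K h = begin
  K * count (λ v → not (enough B v)) (slots n g (suc θ))
    ≡⟨ cong (K *_) (∑-tuples (blocks n g) θ _) ⟩
  K * ∑ (blocks n g) (λ b → ∑ (slots n g θ) (λ v → bit (not (hits B b ∧ enough B v))))
    ≤⟨ *-monoʳ-≤ K (∑-union (λ b → not (hits B b)) (λ v → not (enough B v)) _
         (blocks n g) (slots n g θ) (λ b v → not-∧-true)) ⟩
  K * (u * length (slots n g θ) + length (blocks n g) * f)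
    ≡⟨ cong₂ (λ a c → K * (u * a + c * f)) (length-slots n g θ) (length-blocks n g) ⟩
  K * (u * N ^ θ + N * f)
    ≡⟨ distribute K u (N ^ θ) N f ⟩
  K * u * N ^ θ + N * (K * f)
    ≤⟨ +-mono-≤ (*-monoˡ-≤ (N ^ θ) h) (*-monoʳ-≤ N (count-lacking B g θ K h)) ⟩
  N * N ^ θ + N * (θ * N ^ θ)
    ≡⟨ collect N (N ^ θ) θ ⟩
  suc θ * N ^ suc θ ∎
  where
  open ≤-Reasoning
  N = n ^ g
  u = count (λ b → not (hits B b)) (blocks n g)
  f = count (λ v → not (enough B v)) (slots n g θ)
  distribute : ∀ K u p N f → K * (u * p + N * f) ≡ K * u * p + N * (K * f)
  distribute = solve-∀
  collect : ∀ N p θ → N * p + N * (θ * p) ≡ suc θ * (N * p)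
  collect = solve-∀

card-complement : (B : Fin n → Bool) → card (λ i → not (B i)) + card B ≡ n
card-complement {n} B = trans (sym (∑-+ (allFin n) (λ i → bit (not (B i))) (bit ∘ B)))
  (trans (∑-cong (allFin n) (λ i → one (B i))) (trans (∑Fin-const n 1) (*-identityʳ n)))
  where
  one : ∀ a → bit (not a) + bit a ≡ 1
  one true  = refl
  one false = refl

-- `B` has density at least 1/q, so each batch of `q` entries misses it with probability at most
-- 1/2, and there are `e` batches.
misses-decay : (B : Fin n → Bool) (q e : ℕ) → 1 ≤ q → n ≤ q * card B →
  2 ^ e * count (λ b → not (hits B b)) (blocks n (q * e)) ≤ n ^ (q * e)
misses-decay {n} B q e 1≤q h = begin
  2 ^ e * count (λ b → not (hits B b)) (blocks n (q * e))  ≡⟨ cong (2 ^ e *_) (count-misses B (q * e)) ⟩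
  2 ^ e * c ^ (q * e)       ≡⟨ cong (2 ^ e *_) (^-*-assoc c q e) ⟨
  2 ^ e * (c ^ q) ^ e       ≡⟨ ^-distribʳ-* 2 (c ^ q) e ⟨
  (2 * c ^ q) ^ e           ≤⟨ ^-monoˡ-≤ e (halving (card B) c q 1≤q
                                 (≤-trans (≤-reflexive (card-complement B)) h)) ⟩
  ((c + card B) ^ q) ^ e    ≡⟨ cong (λ m → (m ^ q) ^ e) (card-complement B) ⟩
  (n ^ q) ^ e               ≡⟨ ^-*-assoc n q e ⟩
  n ^ (q * e)               ∎
  where
  open ≤-Reasoning
  c = card (λ i → not (B i))

-- Volume of a box that is restricted on `X`: each coordinate in `X` has relative size at most
-- K₂/K₁, every other at most 1. Keeping the ratio as two numbers serves both families of boxes,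
-- with (2^e, 1) and (n^6, (2gx)^6).
∏-bound : ∀ n (X : Fin n → Bool) (f : Fin n → ℕ) (K₁ K₂ M : ℕ) →
  (∀ i → X i ≡ true → K₁ * f i ≤ K₂ * M) → (∀ i → X i ≡ false → f i ≤ M) →
  K₁ ^ card X * ∏ n f ≤ K₂ ^ card X * M ^ n
∏-bound zero    X f K₁ K₂ M inside outside = ≤-refl
∏-bound (suc n) X f K₁ K₂ M inside outside = begin
  K₁ ^ card X * (f zero * P)                     ≡⟨ cong (λ c → K₁ ^ c * (f zero * P)) (card-suc X) ⟩
  K₁ ^ (bit (X zero) + C) * (f zero * P)         ≡⟨ split K₁ (f zero) P ⟩
  K₁ ^ bit (X zero) * f zero * (K₁ ^ C * P)      ≤⟨ *-mono-≤ (head (X zero) refl)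
                                                      (∏-bound n (X ∘ suc) (f ∘ suc) K₁ K₂ M (inside ∘ suc) (outside ∘ suc)) ⟩
  K₂ ^ bit (X zero) * M * (K₂ ^ C * M ^ n)       ≡⟨ split K₂ M (M ^ n) ⟨
  K₂ ^ (bit (X zero) + C) * M ^ suc n            ≡⟨ cong (λ c → K₂ ^ c * M ^ suc n) (card-suc X) ⟨
  K₂ ^ card X * M ^ suc n                        ∎
  where
  open ≤-Reasoning
  P = ∏ n (f ∘ suc)
  C = card (X ∘ suc)
  interchange : ∀ a b c d → a * b * (c * d) ≡ a * c * (b * d)
  interchange = solve-∀
  split : ∀ K a p → K ^ (bit (X zero) + C) * (a * p) ≡ K ^ bit (X zero) * a * (K ^ C * p)
  split K a p = trans (cong (_* (a * p)) (^-distribˡ-+-* K (bit (X zero)) C))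
    (interchange (K ^ bit (X zero)) (K ^ C) a p)
  head : ∀ b → X zero ≡ b → K₁ ^ bit (X zero) * f zero ≤ K₂ ^ bit (X zero) * M
  head true  h rewrite h | *-identityʳ K₁ | *-identityʳ K₂ = inside zero h
  head false h rewrite h | +-identityʳ (f zero) | +-identityʳ M = outside zero h

-- Existence of spreading and contracting wirings

≤ᵇ-true : ∀ {m n} → m ≤ n → (m ≤ᵇ n) ≡ true
≤ᵇ-true {m} {n} h with m ≤ᵇ n | ≤⇒≤ᵇ h
... | true | _ = refl

≤ᵇ-true⁻ : ∀ {m n} → (m ≤ᵇ n) ≡ true → m ≤ n
≤ᵇ-true⁻ {m} {n} h = ≤ᵇ⇒≤ m n (subst T (sym h) _)

card-cong : {p q : Fin n → Bool} → (∀ i → p i ≡ q i) → card p ≡ card q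
card-cong {n} h = ∑-cong (allFin n) (λ i → cong bit (h i))

-- Subsets are enumerated as vectors, since predicates on `Fin n` that agree pointwise need not be
-- equal and membership of a given predicate in a list could not be shown. The `-cong` lemmas carry
-- the results back to predicates.
subsets : (n : ℕ) → List (Vec Bool n)
subsets n = tuples (true ∷ false ∷ []) n

∈-subsets : (v : Vec Bool n) → v ∈ subsets n
∈-subsets = ∈-tuples _ λ { true → here refl ; false → there (here refl) }

subsets≤ : (n k : ℕ) → List (Vec Bool n)
subsets≤ zero    k       = [] ∷ []
subsets≤ (suc n) zero    = map (false ∷_) (subsets≤ n zero)
subsets≤ (suc n) (suc k) = map (true ∷_) (subsets≤ n k) ++ map (false ∷_) (subsets≤ n (suc k))

∈-subsets≤ : (v : Vec Bool n) → card (lookup v) ≤ k → v ∈ subsets≤ n k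
∈-subsets≤ [] h = here refl
∈-subsets≤ {k = zero} (true ∷ v) h with subst (_≤ 0) (card-suc (lookup (true ∷ v))) h
... | ()
∈-subsets≤ {k = suc k} (true ∷ v) h =
  ∈-++⁺ˡ (∈-map⁺ (true ∷_) (∈-subsets≤ v (s≤s⁻¹ (subst (_≤ suc k) (card-suc (lookup (true ∷ v))) h))))
∈-subsets≤ {k = zero} (false ∷ v) h =
  ∈-map⁺ (false ∷_) (∈-subsets≤ v (subst (_≤ 0) (card-suc (lookup (false ∷ v))) h))
∈-subsets≤ {suc n} {suc k} (false ∷ v) h =
  ∈-++⁺ʳ (map (true ∷_) (subsets≤ n k))
    (∈-map⁺ (false ∷_) (∈-subsets≤ v (subst (_≤ suc k) (card-suc (lookup (false ∷ v))) h)))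

length-subsets≤-suc : ∀ n k →
  length (subsets≤ (suc n) (suc k)) ≡ length (subsets≤ n k) + length (subsets≤ n (suc k))
length-subsets≤-suc n k = trans (length-++ (map (true ∷_) (subsets≤ n k)))
  (cong₂ _+_ (length-map (true ∷_) (subsets≤ n k)) (length-map (false ∷_) (subsets≤ n (suc k))))

length-subsets≤-0 : ∀ n → length (subsets≤ n 0) ≡ 1
length-subsets≤-0 zero    = refl
length-subsets≤-0 (suc n) = trans (length-map (false ∷_) (subsets≤ n 0)) (length-subsets≤-0 n)

length-subsets≤-2^n : ∀ n k → length (subsets≤ n k) ≤ 2 ^ n
length-subsets≤-2^n zero    k       = ≤-refl
length-subsets≤-2^n (suc n) zero    rewrite length-subsets≤-0 (suc n) = m^n>0 2 (suc n)
length-subsets≤-2^n (suc n) (suc k) rewrite length-subsets≤-suc n k | +-identityʳ (2 ^ n) =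
  +-mono-≤ (length-subsets≤-2^n n k) (length-subsets≤-2^n n (suc k))

-- The first two terms of the binomial expansion, in the form that Pascal's rule consumes in
-- `length-subsets≤`.
power-step : ∀ n k → n ^ suc k + suc k * n ^ k ≤ suc n ^ suc k
power-step n zero    = ≤-reflexive (base n)
  where
  base : ∀ n → n * 1 + 1 * 1 ≡ suc n * 1
  base = solve-∀
power-step n (suc k) = begin
  n * (n * p) + suc (suc k) * (n * p)            ≤⟨ m≤m+n _ (suc k * p) ⟩
  n * (n * p) + suc (suc k) * (n * p) + suc k * p ≡⟨ factor n k p ⟩
  suc n * (n * p + suc k * p)                    ≤⟨ *-monoʳ-≤ (suc n) (power-step n k) ⟩
  suc n * suc n ^ suc k                          ∎
  where
  open ≤-Reasoning
  p = n ^ k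
  factor : ∀ n k p → n * (n * p) + suc (suc k) * (n * p) + suc k * p ≡ suc n * (n * p + suc k * p)
  factor = solve-∀

-- Pascal's rule, with (k + 1)^k ≤ 4 k^k to change the denominator of the smaller term and
-- `power-step` to recombine. On the diagonal k = n the larger term would leave the range of the
-- induction, and the crude 2^n is enough.
length-subsets≤ : ∀ n k → k ≤ n → length (subsets≤ n k) * k ^ k ≤ (4 * n) ^ k
length-subsets≤ n zero k≤n rewrite length-subsets≤-0 n = ≤-refl
length-subsets≤ (suc n) (suc k) (s≤s k≤n) with m≤n⇒m<n∨m≡n k≤n
... | inj₂ refl = begin
  length (subsets≤ (suc k) (suc k)) * suc k ^ suc k ≤⟨ *-monoˡ-≤ (suc k ^ suc k) (length-subsets≤-2^n (suc k) (suc k)) ⟩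
  2 ^ suc k * suc k ^ suc k                         ≤⟨ *-monoˡ-≤ (suc k ^ suc k) (^-monoˡ-≤ (suc k) {2} {4} (s≤s (s≤s z≤n))) ⟩
  4 ^ suc k * suc k ^ suc k                         ≡⟨ ^-distribʳ-* 4 (suc k) (suc k) ⟨
  (4 * suc k) ^ suc k                               ∎
  where open ≤-Reasoning
... | inj₁ k<n = begin
  length (subsets≤ (suc n) (suc k)) * suc k ^ suc k
    ≡⟨ cong (_* suc k ^ suc k) (length-subsets≤-suc n k) ⟩
  (a + b) * suc k ^ suc k
    ≡⟨ split a b (suc k) (suc k ^ k) ⟩
  b * suc k ^ suc k + suc k * (a * suc k ^ k)
    ≤⟨ +-mono-≤ (length-subsets≤ n (suc k) k<n)
         (*-monoʳ-≤ (suc k) (*-monoʳ-≤ a ([1+k]^k≤4k^k k))) ⟩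
  (4 * n) ^ suc k + suc k * (a * (4 * k ^ k))
    ≡⟨ cong ((4 * n) ^ suc k +_) (regroup (suc k) a (k ^ k)) ⟩
  (4 * n) ^ suc k + suc k * (4 * (a * k ^ k))
    ≤⟨ +-monoʳ-≤ ((4 * n) ^ suc k) (*-monoʳ-≤ (suc k) (*-monoʳ-≤ 4 (length-subsets≤ n k k≤n))) ⟩
  (4 * n) ^ suc k + suc k * (4 * (4 * n) ^ k)
    ≡⟨ cong₂ (λ x y → x + suc k * (4 * y)) (^-distribʳ-* 4 n (suc k)) (^-distribʳ-* 4 n k) ⟩
  4 ^ suc k * n ^ suc k + suc k * (4 * (4 ^ k * n ^ k))
    ≡⟨ factor (4 ^ k) (n ^ suc k) (suc k) (n ^ k) ⟩
  4 ^ suc k * (n ^ suc k + suc k * n ^ k)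
    ≤⟨ *-monoʳ-≤ (4 ^ suc k) (power-step n k) ⟩
  4 ^ suc k * suc n ^ suc k
    ≡⟨ ^-distribʳ-* 4 (suc n) (suc k) ⟨
  (4 * suc n) ^ suc k ∎
  where
  open ≤-Reasoning
  a = length (subsets≤ n k)
  b = length (subsets≤ n (suc k))
  split : ∀ a b s p → (a + b) * (s * p) ≡ b * (s * p) + s * (a * p)
  split = solve-∀
  regroup : ∀ s a p → s * (a * (4 * p)) ≡ s * (4 * (a * p))
  regroup = solve-∀
  factor : ∀ f x s y → 4 * f * x + s * (4 * (f * y)) ≡ 4 * f * (x + s * y)
  factor = solve-∀

-- At depth 1 this gives an edge between any two large sets, as flooding and queries require; at
-- depth 6 it keeps the peeling in `Core` from removing `s` nodes.
Spreads : ℕ → ℕ → Wiring n g θ → Set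
Spreads {n} a b G = (X B : Fin n → Bool) → a ≤ card X → b ≤ card B →
  ∃ λ i → X i ≡ true × enough B (G i) ≡ true

Contracts : ℕ → Wiring n g θ → Set
Contracts {n} w G = (X Y : Fin n → Bool) → X ⊆ Y → card Y < w →
  (∀ i → X i ≡ true → enough Y (G i) ≡ true) → 2 * card X ≤ card Y

Box : ℕ → ℕ → ℕ → Set
Box n g θ = Fin n → Vec (Vec (Fin n) g) θ → Bool

volume : ∀ {n g θ} → Box n g θ → ℕ
volume {n} {g} {θ} bad = ∏ n (λ i → count (bad i) (slots n g θ))

-- For a fixed pair of sets the failure is a product of conditions on single nodes, with none on the
-- nodes outside `X`; this is what makes it a box. The same holds for `densityBox`.
lackingBox : ∀ {n g θ} → Vec Bool n → Vec Bool n → Box n g θ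
lackingBox X B i v = if lookup X i then not (enough (lookup B) v) else true

densityBox : ∀ {n g θ} → Vec Bool n → Vec Bool n → Box n g θ
densityBox X Y i v = if lookup X i then enough (lookup Y) v else true

pairBoxes : (Vec Bool n → Vec Bool n → Box n g θ) → List (Vec Bool n) → List (Vec Bool n) → List (Box n g θ)
pairBoxes box Xs Ys = concatMap (λ X → map (box X) Ys) Xs

*-∑-≤ : (K C : ℕ) (xs : List A) (f : A → ℕ) → (∀ x → x ∈ xs → K * f x ≤ C) → K * ∑ xs f ≤ length xs * C
*-∑-≤ K C xs f h = ≤-trans (≤-reflexive (sym (∑-*ˡ xs K f))) (∑-≤-length* xs (λ x → K * f x) C h)

volume-pairBoxes : (box : Vec Bool n → Vec Bool n → Box n g θ) (Xs Ys : List (Vec Bool n)) (K C : ℕ) →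
  (∀ X Y → X ∈ Xs → Y ∈ Ys → K * volume (box X Y) ≤ C) →
  K * ∑ (pairBoxes box Xs Ys) volume ≤ length Xs * (length Ys * C)
volume-pairBoxes box Xs Ys K C h = begin
  K * ∑ (pairBoxes box Xs Ys) volume
    ≡⟨ cong (K *_) (∑-concatMap Xs _ volume) ⟩
  K * ∑ Xs (λ X → ∑ (map (box X) Ys) volume)
    ≤⟨ *-∑-≤ K _ Xs _ (λ X X∈ → ≤-trans (≤-reflexive (cong (K *_) (∑-map Ys (box X) volume)))
         (*-∑-≤ K C Ys _ (λ Y Y∈ → h X Y X∈ Y∈))) ⟩
  length Xs * (length Ys * C) ∎
  where open ≤-Reasoning

large : (n a : ℕ) → List (Vec Bool n)
large n a = filterᵇ (λ X → a ≤ᵇ card (lookup X)) (subsets n)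

∈-large : ∀ {a} (X : Vec Bool n) → a ≤ card (lookup X) → X ∈ large n a
∈-large X h = ∈-filterᵇ _ (∈-subsets X) (≤ᵇ-true h)

∈-large⁻ : ∀ {a} (X : Vec Bool n) → X ∈ large n a → a ≤ card (lookup X)
∈-large⁻ {a = a} X X∈ = ≤ᵇ-true⁻ (proj₂ (∈-filterᵇ⁻ (λ X → a ≤ᵇ card (lookup X)) (subsets _) X∈))

length-large : ∀ n a → length (large n a) ≤ 2 ^ n
length-large n a = ≤-trans (length-filterᵇ-≤ _ (subsets n)) (≤-reflexive (length-tuples _ n))

tabulate-lookup : (p : Fin n → Bool) → ∀ i → lookup (tabulateᵛ p) i ≡ p i
tabulate-lookup p i = lookup∘tabulate p i

-- `q` bounds the inverse density of `B`, `e` is the number of bits by which each node of `X` makes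
-- the failure less likely, and `τ` pays for the union over `θ` blocks. The demand on `e * a` covers
-- the at most 4^n pairs of sets and leaves a factor 4 to spare.
module _ (n q e τ θ a b : ℕ) (1≤q : 1 ≤ q) (θ≤2^τ : θ ≤ 2 ^ τ)
         (qb≥n : n ≤ q * b) (ea≥2n+2 : 2 * n + 2 ≤ e * a) where

  private
    size = q * (e + τ)
    M = (n ^ size) ^ θ

  lackingBoxes : List (Box n size θ)
  lackingBoxes = pairBoxes lackingBox (large n a) (large n b)

  volume-lackingBox : ∀ X B → a ≤ card (lookup X) → b ≤ card (lookup B) →
    2 ^ (2 * n + 2) * volume (lackingBox {n} {size} {θ} X B) ≤ M ^ n
  volume-lackingBox X B a≤ b≤ = begin
    2 ^ (2 * n + 2) * V             ≤⟨ *-monoˡ-≤ V (^-monoʳ-≤ 2 (≤-trans ea≥2n+2 (*-monoʳ-≤ e a≤))) ⟩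
    2 ^ (e * card (lookup X)) * V   ≡⟨ cong (_* V) (^-*-assoc 2 e (card (lookup X))) ⟨
    (2 ^ e) ^ card (lookup X) * V   ≤⟨ ∏-bound n (lookup X) _ (2 ^ e) 1 M inside outside ⟩
    1 ^ card (lookup X) * M ^ n     ≡⟨ cong (_* M ^ n) (^-zeroˡ (card (lookup X))) ⟩
    1 * M ^ n                       ≡⟨ *-identityˡ (M ^ n) ⟩
    M ^ n                           ∎
    where
    open ≤-Reasoning
    V = volume (lackingBox {n} {size} {θ} X B)
    fail = count (λ v → not (enough (lookup B) v)) (slots n size θ)
    fail-small : 2 ^ e * fail ≤ 1 * M
    fail-small = *-cancelˡ-≤ (2 ^ τ) {{m^n≢0 2 τ}} (begin
      2 ^ τ * (2 ^ e * fail)    ≡⟨ *-assoc (2 ^ τ) (2 ^ e) fail ⟨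
      2 ^ τ * 2 ^ e * fail      ≡⟨ cong (_* fail) (trans (*-comm (2 ^ τ) (2 ^ e)) (sym (^-distribˡ-+-* 2 e τ))) ⟩
      2 ^ (e + τ) * fail        ≤⟨ count-lacking (lookup B) size θ (2 ^ (e + τ))
                                     (misses-decay (lookup B) q (e + τ) 1≤q (≤-trans qb≥n (*-monoʳ-≤ q b≤))) ⟩
      θ * M                     ≤⟨ *-monoˡ-≤ M θ≤2^τ ⟩
      2 ^ τ * M                 ≡⟨ cong (2 ^ τ *_) (*-identityˡ M) ⟨
      2 ^ τ * (1 * M)           ∎)
    inside : ∀ i → lookup X i ≡ true → 2 ^ e * count (lackingBox X B i) (slots n size θ) ≤ 1 * M
    inside i Xi rewrite Xi = fail-small
    outside : ∀ i → lookup X i ≡ false → count (lackingBox X B i) (slots n size θ) ≤ M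
    outside i Xi = ≤-trans (count≤length (lackingBox X B i) (slots n size θ))
      (≤-reflexive (length-slots n size θ))

  volume-lackingBoxes : 4 * ∑ lackingBoxes volume ≤ M ^ n
  volume-lackingBoxes = *-cancelˡ-≤ (2 ^ n * 2 ^ n) {{m*n≢0 (2 ^ n) (2 ^ n) {{m^n≢0 2 n}} {{m^n≢0 2 n}}}} (begin
    2 ^ n * 2 ^ n * (4 * S)               ≡⟨ *-assoc (2 ^ n * 2 ^ n) 4 S ⟨
    2 ^ n * 2 ^ n * 4 * S                 ≡⟨ cong (_* S) powers ⟨
    2 ^ (2 * n + 2) * S                   ≤⟨ volume-pairBoxes lackingBox (large n a) (large n b) (2 ^ (2 * n + 2)) (M ^ n)
                                               (λ X B X∈ B∈ → volume-lackingBox X B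
                                                 (∈-large⁻ X X∈) (∈-large⁻ B B∈)) ⟩
    length (large n a) * (length (large n b) * M ^ n)
                                          ≤⟨ *-mono-≤ (length-large n a) (*-monoˡ-≤ (M ^ n) (length-large n b)) ⟩
    2 ^ n * (2 ^ n * M ^ n)               ≡⟨ *-assoc (2 ^ n) (2 ^ n) (M ^ n) ⟨
    2 ^ n * 2 ^ n * M ^ n                 ∎)
    where
    open ≤-Reasoning
    S = ∑ lackingBoxes volume
    powers : 2 ^ (2 * n + 2) ≡ 2 ^ n * 2 ^ n * 4
    powers = trans (^-distribˡ-+-* 2 (2 * n) 2)
      (cong (_* 4) (trans (cong (λ m → 2 ^ (n + m)) (+-identityʳ n)) (^-distribˡ-+-* 2 n n)))

  avoids⇒spreads : (G : Wiring n size θ) →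
    (∀ bad → bad ∈ lackingBoxes → ∃ λ i → bad i (G i) ≡ false) → Spreads a b G
  avoids⇒spreads G avoids X B a≤ b≤ = conclude (avoids _ box∈)
    where
    Xᵛ = tabulateᵛ X
    Bᵛ = tabulateᵛ B
    box∈ : lackingBox Xᵛ Bᵛ ∈ lackingBoxes
    box∈ = ∈-concatMap _
      (∈-large Xᵛ (≤-trans a≤ (≤-reflexive (sym (card-cong (tabulate-lookup X))))))
      (∈-map⁺ (lackingBox Xᵛ) (∈-large Bᵛ (≤-trans b≤ (≤-reflexive (sym (card-cong (tabulate-lookup B)))))))
    conclude : (∃ λ i → lackingBox Xᵛ Bᵛ i (G i) ≡ false) → ∃ λ i → X i ≡ true × enough B (G i) ≡ true
    conclude (i , avoided) rewrite tabulate-lookup X i with X i in Xi | enough (lookup Bᵛ) (G i) in en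
    conclude (i , avoided) | true  | true  = i , Xi , trans (sym (enough-cong (tabulate-lookup B) (G i))) en
    conclude (i , ())      | true  | false
    conclude (i , ())      | false | _

0<M^n : ∀ n size θ → 1 ≤ n → 0 < ((n ^ size) ^ θ) ^ n
0<M^n n size θ 1≤n = m^n>0 _ {{m^n≢0 _ θ {{m^n≢0 n size {{>-nonZero 1≤n}}}}}} n

spreading : ∀ n q e a b → 1 ≤ n → 1 ≤ q → n ≤ q * b → 2 * n + 2 ≤ e * a →
  Σ (Wiring n (q * e) 1) (Spreads a b)
-- A single block calls for no union bound, so `τ` is 0; the `subst` removes the resulting `e + 0`.
spreading n q e a b 1≤n 1≤q qb ea = subst (λ e′ → Σ (Wiring n (q * e′) 1) (Spreads a b)) (+-identityʳ e)
  (let G , avoids = avoid-boxes (slots n size 1) n (lackingBoxes n q e 0 1 a b 1≤q ≤-refl qb ea) small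
   in G , avoids⇒spreads n q e 0 1 a b 1≤q ≤-refl qb ea G avoids)
  where
  size = q * (e + 0)
  S = ∑ (lackingBoxes n q e 0 1 a b 1≤q ≤-refl qb ea) volume
  below : ∀ {C} S → 0 < C → 4 * S ≤ C → S < C
  below zero    0<C _ = 0<C
  below (suc S) _   h = <-≤-trans (m<m+n (suc S) (s≤s z≤n)) h
  small : S < length (slots n size 1) ^ n
  small = subst (λ m → S < m ^ n) (sym (length-slots n size 1))
    (below S (0<M^n n size 1 1≤n) (volume-lackingBoxes n q e 0 1 a b 1≤q ≤-refl qb ea))

exactly : (n x : ℕ) → List (Vec Bool n)
exactly n x = filterᵇ (λ X → card (lookup X) ≡ᵇ x) (subsets≤ n x)

∈-exactly : ∀ {x} (X : Vec Bool n) → card (lookup X) ≡ x → X ∈ exactly n x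
∈-exactly X refl = ∈-filterᵇ _ (∈-subsets≤ X ≤-refl) (≡ᵇ-true (card (lookup X)))
  where
  ≡ᵇ-true : ∀ a → (a ≡ᵇ a) ≡ true
  ≡ᵇ-true zero    = refl
  ≡ᵇ-true (suc a) = ≡ᵇ-true a

∈-exactly⁻ : ∀ {x} (X : Vec Bool n) → X ∈ exactly n x → card (lookup X) ≡ x
∈-exactly⁻ {x = x} X X∈ =
  ≡ᵇ⇒≡ _ x (subst T (sym (proj₂ (∈-filterᵇ⁻ (λ X → card (lookup X) ≡ᵇ x) (subsets≤ _ x) X∈))) _)

atMost : (n y : ℕ) → List (Vec Bool n)
atMost n y = filterᵇ (λ Y → card (lookup Y) ≤ᵇ y) (subsets≤ n y)

∈-atMost : ∀ {y} (Y : Vec Bool n) → card (lookup Y) ≤ y → Y ∈ atMost n y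
∈-atMost Y h = ∈-filterᵇ _ (∈-subsets≤ Y h) (≤ᵇ-true h)

∈-atMost⁻ : ∀ {y} (Y : Vec Bool n) → Y ∈ atMost n y → card (lookup Y) ≤ y
∈-atMost⁻ {y = y} Y Y∈ = ≤ᵇ-true⁻ (proj₂ (∈-filterᵇ⁻ (λ Y → card (lookup Y) ≤ᵇ y) (subsets≤ _ y) Y∈))

module _ (n g : ℕ) (1≤n : 1 ≤ n) (1≤g : 1 ≤ g) where

  private
    M = (n ^ g) ^ 6

  denseLayer : ℕ → List (Box n g 6)
  denseLayer x = pairBoxes densityBox (exactly n x) (atMost n (2 * x))

  -- Each node of `X` passes all six blocks with probability at most (2gx/n)^6, independently of the
  -- other nodes.
  volume-densityBox : ∀ X Y x → card (lookup X) ≡ x → card (lookup Y) ≤ 2 * x →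
    (n ^ 6) ^ x * volume (densityBox {n} {g} {6} X Y) ≤ ((g * (2 * x)) ^ 6) ^ x * M ^ n
  volume-densityBox X Y x refl Y≤ = ∏-bound n (lookup X) _ (n ^ 6) ((g * (2 * x)) ^ 6) M inside outside
    where
    open ≤-Reasoning
    inside : ∀ i → lookup X i ≡ true →
      n ^ 6 * count (densityBox X Y i) (slots n g 6) ≤ (g * (2 * x)) ^ 6 * M
    inside i Xi rewrite Xi = begin
      n ^ 6 * count (enough (lookup Y)) (slots n g 6)   ≤⟨ count-enough-≤ (lookup Y) g 6 ⟩
      (g * card (lookup Y)) ^ 6 * M                     ≤⟨ *-monoˡ-≤ M (^-monoˡ-≤ 6 (*-monoʳ-≤ g Y≤)) ⟩
      (g * (2 * x)) ^ 6 * M                             ∎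
    outside : ∀ i → lookup X i ≡ false → count (densityBox X Y i) (slots n g 6) ≤ M
    outside i Xi = ≤-trans (count≤length (densityBox X Y i) (slots n g 6))
      (≤-reflexive (length-slots n g 6))

  -- C(n,x) ≤ (4n/x)^x and C(n,2x) ≤ (2n/x)^2x against the relative volume (2gx/n)^6x of a box:
  -- the product is (4096 g^6 x^3 / n^3)^x / 4^x.
  volume-denseLayer : ∀ x → 1 ≤ x → x * (16 * (g * g)) ≤ n →
    4 ^ x * ∑ (denseLayer x) volume ≤ M ^ n
  -- Cancelling `Z ^ x` clears all denominators at once: 4Z = n^6 · x · (2x)^2 gathers, per node of
  -- `X`, n^6 from the box and x and (2x)^2 from the two subset counts.
  volume-denseLayer x 1≤x xΓ≤n = *-cancelˡ-≤ (Z ^ x) {{m^n≢0 Z x {{Z≢0}}}} (begin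
    Z ^ x * (4 ^ x * S)
      ≡⟨ *-assoc (Z ^ x) (4 ^ x) S ⟨
    Z ^ x * 4 ^ x * S
      ≡⟨ cong (_* S) (^-distribʳ-* Z 4 x) ⟨
    (Z * 4) ^ x * S
      ≡⟨ cong (λ m → m ^ x * S) (left-factor n x) ⟩
    (n ^ 6 * (x * (2 * x) ^ 2)) ^ x * S
      ≡⟨ cong (_* S) (trans (^-distribʳ-* (n ^ 6) (x * (2 * x) ^ 2) x) (cong ((n ^ 6) ^ x *_) (^-distribʳ-* x ((2 * x) ^ 2) x))) ⟩
    (n ^ 6) ^ x * (x ^ x * ((2 * x) ^ 2) ^ x) * S
      ≡⟨ rotate ((n ^ 6) ^ x) (x ^ x * ((2 * x) ^ 2) ^ x) S ⟩
    x ^ x * ((2 * x) ^ 2) ^ x * ((n ^ 6) ^ x * S)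
      ≤⟨ *-monoʳ-≤ (x ^ x * ((2 * x) ^ 2) ^ x) layer ⟩
    x ^ x * ((2 * x) ^ 2) ^ x * (lX * (lY * (P ^ x * C)))
      ≡⟨ regroup (x ^ x) (((2 * x) ^ 2) ^ x) lX lY (P ^ x * C) ⟩
    lX * x ^ x * (lY * ((2 * x) ^ 2) ^ x) * (P ^ x * C)
      ≤⟨ *-monoˡ-≤ (P ^ x * C) (*-mono-≤ few-X few-Y) ⟩
    (4 * n) ^ x * ((4 * n) ^ 2) ^ x * (P ^ x * C)
      ≡⟨ *-assoc ((4 * n) ^ x * ((4 * n) ^ 2) ^ x) (P ^ x) C ⟨
    (4 * n) ^ x * ((4 * n) ^ 2) ^ x * P ^ x * C
      ≡⟨ cong (_* C) (trans (^-distribʳ-* (4 * n * (4 * n) ^ 2) P x) (cong (_* P ^ x) (^-distribʳ-* (4 * n) ((4 * n) ^ 2) x))) ⟨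
    (4 * n * (4 * n) ^ 2 * P) ^ x * C
      ≤⟨ *-monoˡ-≤ C (^-monoˡ-≤ x right-factor) ⟩
    Z ^ x * C ∎)
    where
    open ≤-Reasoning
    S = ∑ (denseLayer x) volume
    C = M ^ n
    P = (g * (2 * x)) ^ 6
    Z = n ^ 6 * x ^ 3
    lX = length (exactly n x)
    lY = length (atMost n (2 * x))
    Z≢0 : NonZero Z
    Z≢0 = m*n≢0 (n ^ 6) (x ^ 3) {{m^n≢0 n 6 {{>-nonZero 1≤n}}}} {{m^n≢0 x 3 {{>-nonZero 1≤x}}}}
    left-factor : ∀ n x → (n * (n * (n * (n * (n * (n * 1)))))) * (x * (x * (x * 1))) * 4 ≡
      (n * (n * (n * (n * (n * (n * 1)))))) * (x * ((2 * x) * ((2 * x) * 1)))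
    left-factor = solve-∀
    rotate : ∀ a b s → a * b * s ≡ b * (a * s)
    rotate = solve-∀
    regroup : ∀ a b l m c → a * b * (l * (m * c)) ≡ l * a * (m * b) * c
    regroup = solve-∀
    16x≤n : 16 * x ≤ n
    16x≤n = begin
      16 * x                  ≡⟨ *-comm 16 x ⟩
      x * 16                  ≡⟨ cong (x *_) (*-identityʳ 16) ⟨
      x * (16 * 1)            ≤⟨ *-monoʳ-≤ x (*-monoʳ-≤ 16 (*-mono-≤ 1≤g 1≤g)) ⟩
      x * (16 * (g * g))      ≤⟨ xΓ≤n ⟩
      n                       ∎
    2x≤n : 2 * x ≤ n
    2x≤n = ≤-trans (*-monoˡ-≤ x {2} {16} (s≤s (s≤s z≤n))) 16x≤n
    few-X : lX * x ^ x ≤ (4 * n) ^ x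
    few-X = ≤-trans (*-monoˡ-≤ (x ^ x) (length-filterᵇ-≤ _ (subsets≤ n x)))
      (length-subsets≤ n x (≤-trans (m≤n*m x 2) 2x≤n))
    few-Y : lY * ((2 * x) ^ 2) ^ x ≤ ((4 * n) ^ 2) ^ x
    few-Y = begin
      lY * ((2 * x) ^ 2) ^ x                            ≡⟨ cong (lY *_) (^-*-assoc (2 * x) 2 x) ⟩
      lY * (2 * x) ^ (2 * x)                            ≤⟨ *-monoˡ-≤ _ (length-filterᵇ-≤ _ (subsets≤ n (2 * x))) ⟩
      length (subsets≤ n (2 * x)) * (2 * x) ^ (2 * x)   ≤⟨ length-subsets≤ n (2 * x) 2x≤n ⟩
      (4 * n) ^ (2 * x)                                 ≡⟨ ^-*-assoc (4 * n) 2 x ⟨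
      ((4 * n) ^ 2) ^ x                                 ∎
    layer : (n ^ 6) ^ x * S ≤ lX * (lY * (P ^ x * C))
    layer = volume-pairBoxes densityBox (exactly n x) (atMost n (2 * x)) ((n ^ 6) ^ x) (P ^ x * C)
      (λ X Y X∈ Y∈ → volume-densityBox X Y x (∈-exactly⁻ X X∈) (∈-atMost⁻ Y Y∈))
    -- Source of the condition 16g²x ≤ n: since (4n)^3 (2gx)^6 = (16g²x)^3 x^3 n^3, six blocks
    -- against three factors 4n leave exactly a cube to compare with n^3.
    right-factor : 4 * n * (4 * n) ^ 2 * P ≤ Z
    right-factor = begin
      4 * n * (4 * n) ^ 2 * (g * (2 * x)) ^ 6      ≡⟨ expand n g x ⟩
      (x * (16 * (g * g))) ^ 3 * (x ^ 3 * n ^ 3)   ≤⟨ *-monoˡ-≤ (x ^ 3 * n ^ 3) (^-monoˡ-≤ 3 xΓ≤n) ⟩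
      n ^ 3 * (x ^ 3 * n ^ 3)                      ≡⟨ gather n x ⟩
      n ^ 6 * x ^ 3                                ∎
      where
      expand : ∀ n g x → 4 * n * ((4 * n) * ((4 * n) * 1)) * ((g * (2 * x)) * ((g * (2 * x)) * ((g * (2 * x)) * ((g * (2 * x)) * ((g * (2 * x)) * ((g * (2 * x)) * 1)))))) ≡
        ((x * (16 * (g * g))) * ((x * (16 * (g * g))) * ((x * (16 * (g * g))) * 1))) * ((x * (x * (x * 1))) * (n * (n * (n * 1))))
      expand = solve-∀
      gather : ∀ n x → (n * (n * (n * 1))) * ((x * (x * (x * 1))) * (n * (n * (n * 1)))) ≡ (n * (n * (n * (n * (n * (n * 1)))))) * (x * (x * (x * 1)))
      gather = solve-∀

  denseBoxes : ℕ → List (Box n g 6)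
  denseBoxes zero    = []
  denseBoxes (suc x) = denseLayer (suc x) ++ denseBoxes x

  -- A geometric series: layer x has relative volume at most 4^-x, and the layers up to w sum to (1
  -- - 4^-w)/3. The summand `M ^ n` on the left keeps this exact partial sum, so that the induction
  -- closes.
  volume-denseBoxes : ∀ w → w * (16 * (g * g)) ≤ n →
    3 * 4 ^ w * ∑ (denseBoxes w) volume + M ^ n ≤ 4 ^ w * M ^ n
  volume-denseBoxes zero    h = ≤-reflexive (sym (+-identityʳ (M ^ n)))
  volume-denseBoxes (suc w) h = +-cancelʳ-≤ (3 * C) _ _ (begin
    3 * 4 ^ suc w * ∑ (denseBoxes (suc w)) volume + C + 3 * C
      ≡⟨ cong (λ s → 3 * 4 ^ suc w * s + C + 3 * C) (∑-++ (denseLayer (suc w)) (denseBoxes w) volume) ⟩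
    3 * (4 * 4 ^ w) * (l + s) + C + 3 * C
      ≡⟨ split (4 ^ w) l s C ⟩
    3 * (4 ^ suc w * l) + 4 * (3 * 4 ^ w * s + C)
      ≤⟨ +-mono-≤ (*-monoʳ-≤ 3 (volume-denseLayer (suc w) (s≤s z≤n) h))
           (*-monoʳ-≤ 4 (volume-denseBoxes w (≤-trans (*-monoˡ-≤ (16 * (g * g)) (n≤1+n w)) h))) ⟩
    3 * C + 4 * (4 ^ w * C)
      ≡⟨ merge (4 ^ w) C ⟩
    4 ^ suc w * C + 3 * C ∎)
    where
    open ≤-Reasoning
    C = M ^ n
    l = ∑ (denseLayer (suc w)) volume
    s = ∑ (denseBoxes w) volume
    split : ∀ p l s c → 3 * (4 * p) * (l + s) + c + 3 * c ≡ 3 * (4 * p * l) + 4 * (3 * p * s + c)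
    split = solve-∀
    merge : ∀ p c → 3 * c + 4 * (p * c) ≡ 4 * p * c + 3 * c
    merge = solve-∀

  denseBoxes-∈ : ∀ w x {bad} → 1 ≤ x → x ≤ w → bad ∈ denseLayer x → bad ∈ denseBoxes w
  denseBoxes-∈ zero    zero    () _ _
  denseBoxes-∈ (suc w) x 1≤x x≤ bad∈ with m≤n⇒m<n∨m≡n x≤
  ... | inj₂ refl      = ∈-++⁺ˡ bad∈
  ... | inj₁ (s≤s x≤w) = ∈-++⁺ʳ (denseLayer (suc w)) (denseBoxes-∈ w x 1≤x x≤w bad∈)

  -- A violation has |Y| < 2|X| and therefore lies in the layer x = |X|; `X ⊆ Y` is what bounds this
  -- x by `w`.
  avoids⇒contracts : ∀ w (G : Wiring n g 6) →
    (∀ bad → bad ∈ denseBoxes w → ∃ λ i → bad i (G i) ≡ false) → Contracts w G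
  avoids⇒contracts w G avoids X Y X⊆Y Y<w dense with 2 * card X ≤? card Y
  ... | yes h = h
  ... | no ¬h = conclude (avoids _ box∈)
    where
    Xᵛ = tabulateᵛ X
    Yᵛ = tabulateᵛ Y
    x = card X
    Y<2x : card Y < 2 * x
    Y<2x = ≰⇒> ¬h
    1≤x : ∀ x → card Y < 2 * x → 1 ≤ x
    1≤x (suc x) _ = s≤s z≤n
    box∈ : densityBox Xᵛ Yᵛ ∈ denseBoxes w
    box∈ = denseBoxes-∈ w x (1≤x x Y<2x) (≤-trans (card-mono X⊆Y) (<⇒≤ Y<w))
      (∈-concatMap _ (∈-exactly Xᵛ (card-cong (tabulate-lookup X)))
        (∈-map⁺ (densityBox Xᵛ) (∈-atMost Yᵛ
          (≤-trans (≤-reflexive (card-cong (tabulate-lookup Y))) (<⇒≤ Y<2x)))))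
    conclude : (∃ λ i → densityBox Xᵛ Yᵛ i (G i) ≡ false) → 2 * card X ≤ card Y
    conclude (i , avoided) with lookup Xᵛ i in Xi
    ... | true with trans (sym avoided) (trans (enough-cong (tabulate-lookup Y) (G i))
                      (dense i (trans (sym (tabulate-lookup X i)) Xi)))
    ...   | ()

-- One wiring must serve both purposes, so both lists of boxes are avoided together: their shares
-- 1/4 and 1/3 of the volume add up to less than 1. The 3 in `size` is `τ`, as 6 ≤ 2^3.
expanding : ∀ n q e s w → 1 ≤ n → 1 ≤ q → n ≤ q * s → 2 * n + 2 ≤ e * s →
  let size = q * (e + 3) in w * (16 * (size * size)) ≤ n →
  Σ (Wiring n size 6) λ G → Spreads s s G × Contracts w G
expanding n q e s w 1≤n 1≤q qs es wΓ =
  let G , avoids = avoid-boxes (slots n size 6) n (L₁ ++ L₂) small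
  in G , avoids⇒spreads n q e 3 6 s s 1≤q 6≤8 qs es G (λ bad bad∈ → avoids bad (∈-++⁺ˡ bad∈))
       , avoids⇒contracts n size 1≤n 1≤size w G (λ bad bad∈ → avoids bad (∈-++⁺ʳ L₁ bad∈))
  where
  size = q * (e + 3)
  6≤8 : 6 ≤ 2 ^ 3
  6≤8 = s≤s (s≤s (s≤s (s≤s (s≤s (s≤s z≤n)))))
  1≤size : 1 ≤ size
  1≤size = *-mono-≤ 1≤q (≤-trans (s≤s z≤n) (m≤n+m 3 e))
  L₁ = lackingBoxes n q e 3 6 s s 1≤q 6≤8 qs es
  L₂ = denseBoxes n size 1≤n 1≤size w
  C = ((n ^ size) ^ 6) ^ n
  S₁ = ∑ L₁ volume
  S₂ = ∑ L₂ volume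
  S₂-bound : 3 * S₂ ≤ C
  S₂-bound = *-cancelˡ-≤ (4 ^ w) {{m^n≢0 4 w}} (≤-trans (≤-reflexive (swap (4 ^ w) S₂))
    (≤-trans (m≤m+n (3 * 4 ^ w * S₂) C) (volume-denseBoxes n size 1≤n 1≤size w wΓ)))
    where
    swap : ∀ p s → p * (3 * s) ≡ 3 * p * s
    swap = solve-∀
  combine : ∀ C s t → 0 < C → 4 * s ≤ C → 3 * t ≤ C → s + t < C
  combine C s t 0<C 4s≤C 3t≤C = *-cancelˡ-< 12 (s + t) C (begin-strict
    12 * (s + t)                ≡⟨ split s t ⟩
    3 * (4 * s) + 4 * (3 * t)   ≤⟨ +-mono-≤ (*-monoʳ-≤ 3 4s≤C) (*-monoʳ-≤ 4 3t≤C) ⟩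
    3 * C + 4 * C               <⟨ m<m+n (3 * C + 4 * C) (*-mono-≤ {1} {5} (s≤s z≤n) 0<C) ⟩
    3 * C + 4 * C + 5 * C       ≡⟨ merge C ⟩
    12 * C                      ∎)
    where
    open ≤-Reasoning
    split : ∀ s t → 12 * (s + t) ≡ 3 * (4 * s) + 4 * (3 * t)
    split = solve-∀
    merge : ∀ C → 3 * C + 4 * C + 5 * C ≡ 12 * C
    merge = solve-∀
  small : ∑ (L₁ ++ L₂) volume < length (slots n size 6) ^ n
  small = subst₂ _<_ (sym (∑-++ L₁ L₂ volume)) (cong (_^ n) (sym (length-slots n size 6)))
    (combine C S₁ S₂ (0<M^n n size 6 1≤n) (volume-lackingBoxes n q e 3 6 s s 1≤q 6≤8 qs es) S₂-bound)

-- The algorithm and its executions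

∧-true : ∀ {a b} → a ∧ b ≡ true → a ≡ true × b ≡ true
∧-true {true} {true} h = refl , refl

not-true : ∀ {b} → not b ≡ true → b ≡ false
not-true {false} _ = refl

∧-intro : ∀ {a b} → a ≡ true → b ≡ true → a ∧ b ≡ true
∧-intro refl refl = refl

does-true : {P : Set} (d : Dec P) → P → does d ≡ true
does-true (yes _) p = refl
does-true (no ¬p) p = contradiction p ¬p

does-true⁻ : {P : Set} (d : Dec P) → does d ≡ true → P
does-true⁻ (yes p) _ = p

card-zero : (p : Fin n → Bool) → (∀ i → p i ≡ false) → card p ≡ 0
card-zero {n} p h = trans (∑-cong (allFin n) (λ i → cong bit (h i))) (trans (∑Fin-const n 0) (*-zeroʳ n))

card-point : (i : Fin n) → card (λ j → does (i ≟ᶠ j)) ≤ 1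
card-point {suc n} zero    = ≤-reflexive (trans (card-suc {n} (λ j → does (zero ≟ᶠ j)))
  (cong suc (card-zero {n} (λ j → false) (λ _ → refl))))
card-point {suc n} (suc i) = ≤-trans (≤-reflexive (card-suc {n} (λ j → does (suc i ≟ᶠ j)))) (card-point i)

linked : Fin n → Vec (Vec (Fin n) g) θ → Bool
linked j []      = false
linked j (b ∷ v) = hits (λ i → does (i ≟ᶠ j)) b ∨ linked j v

card-hits : (b : Vec (Fin n) g) → card (λ j → hits (λ i → does (i ≟ᶠ j)) b) ≤ g
card-hits {n} []  = ≤-reflexive (card-zero {n} (λ j → false) (λ _ → refl))
card-hits (x ∷ b) = ≤-trans (card-∪ {q = λ j → does (x ≟ᶠ j)} (λ j → ∨-true))
  (+-mono-≤ (card-point x) (card-hits b))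

card-linked : (v : Vec (Vec (Fin n) g) θ) → card (λ j → linked j v) ≤ θ * g
card-linked {n} [] = ≤-reflexive (card-zero {n} (λ j → false) (λ _ → refl))
card-linked (b ∷ v) = ≤-trans (card-∪ {q = λ j → hits (λ i → does (i ≟ᶠ j)) b} (λ j → ∨-true))
  (+-mono-≤ (card-hits b) (card-linked v))

∨-introˡ : ∀ {a} b → a ≡ true → a ∨ b ≡ true
∨-introˡ b refl = refl

∨-introʳ : ∀ a {b} → b ≡ true → a ∨ b ≡ true
∨-introʳ a refl = ∨-zeroʳ a

hits-mono : {p q : Fin n → Bool} (b : Vec (Fin n) g) →
  (∀ j → hits (λ i → does (i ≟ᶠ j)) b ≡ true → p j ≡ true → q j ≡ true) →
  hits p b ≡ true → hits q b ≡ true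
hits-mono {p = p} {q} (x ∷ b) h hit with p x in px
... | true  = ∨-introˡ (hits q b) (h x (∨-introˡ _ (does-true (x ≟ᶠ x) refl)) px)
... | false = ∨-introʳ (q x) (hits-mono b (λ j j∈ → h j (∨-introʳ (does (x ≟ᶠ j)) j∈)) hit)

-- The implication is asked for only at nodes that occur in the slots, because in a probing round
-- nothing is heard from the others.
enough-mono : {p q : Fin n → Bool} (v : Vec (Vec (Fin n) g) θ) →
  (∀ j → linked j v ≡ true → p j ≡ true → q j ≡ true) → enough p v ≡ true → enough q v ≡ true
enough-mono []      h _  = refl
enough-mono (b ∷ v) h en = let hit , rest = ∧-true en in
  ∧-intro (hits-mono b (λ j j∈ → h j (∨-introˡ (linked j v) j∈)) hit)
          (enough-mono v (λ j j∈ → h j (∨-introʳ (hits (λ i → does (i ≟ᶠ j)) b) j∈)) rest)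

hits-witness : {p : Fin n → Bool} (b : Vec (Fin n) g) → hits p b ≡ true →
  ∃ λ j → hits (λ i → does (i ≟ᶠ j)) b ≡ true × p j ≡ true
hits-witness {p = p} (x ∷ b) hit with p x in px
... | true  = x , ∨-introˡ _ (does-true (x ≟ᶠ x) refl) , px
... | false = let j , j∈ , pj = hits-witness b hit in j , ∨-introʳ (does (x ≟ᶠ j)) j∈ , pj

enough-witness : {p : Fin n → Bool} (v : Vec (Vec (Fin n) g) (suc θ)) → enough p v ≡ true →
  ∃ λ j → linked j v ≡ true × p j ≡ true
enough-witness (b ∷ v) en = let j , j∈ , pj = hits-witness b (proj₁ (∧-true en)) in
  j , ∨-introˡ (linked j v) j∈ , pj

_says_ : Maybe Bool → Bool → Bool
nothing says b = false
just a  says b = does (a ≟ᵇ b)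

says-just : ∀ {x b} → x ≡ just b → (x says b) ≡ true
says-just {b = b} refl = does-true (b ≟ᵇ b) refl

says-just⁻ : ∀ x {b} → (x says b) ≡ true → x ≡ just b
says-just⁻ (just a) {b} h = cong just (does-true⁻ (a ≟ᵇ b) h)

someIn : (A → Bool) → List A → Bool
someIn p []       = false
someIn p (x ∷ xs) = p x ∨ someIn p xs

someIn-∈ : (p : A → Bool) {xs : List A} {x : A} → x ∈ xs → p x ≡ true → someIn p xs ≡ true
someIn-∈ p {x ∷ xs} (here refl) px = ∨-introˡ (someIn p xs) px
someIn-∈ p {y ∷ xs} (there x∈)  px = ∨-introʳ (p y) (someIn-∈ p x∈ px)

someIn-witness : (p : A → Bool) (xs : List A) → someIn p xs ≡ true → ∃ λ x → p x ≡ true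
someIn-witness p (x ∷ xs) h with p x in px
... | true  = x , px
... | false = someIn-witness p xs h

heard : Bool → (Fin n → Maybe Bool) → Bool
heard {n} b inbox = someIn (λ j → inbox j says b) (allFin n)

heard-from : ∀ b (inbox : Fin n → Maybe Bool) j → inbox j ≡ just b → heard b inbox ≡ true
heard-from b inbox j h = someIn-∈ (λ j → inbox j says b) (∈-allFin j) (says-just h)

heard-witness : ∀ b (inbox : Fin n → Maybe Bool) → heard b inbox ≡ true → ∃ λ j → inbox j ≡ just b
heard-witness {n} b inbox h = let j , p = someIn-witness _ (allFin n) h in j , says-just⁻ (inbox j) p

-- Round schedule and protocol

data Kind : Set where
  flooding probing replying : Kind
  asking                    : ℕ → Kind

inquire : ℕ → ℕ → Kind
inquire k zero          = asking k
inquire k (suc zero)    = replying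
inquire k (suc (suc r)) = inquire (suc k) r

schedule : ℕ → ℕ → ℕ → Kind
schedule (suc f) γ       zero    = flooding
schedule (suc f) γ       (suc r) = schedule f γ r
schedule zero    (suc γ) zero    = probing
schedule zero    (suc γ) (suc r) = schedule zero γ r
schedule zero    zero    r       = inquire 0 r

schedule-flooding : ∀ f γ r → r < f → schedule f γ r ≡ flooding
schedule-flooding (suc f) γ zero    _         = refl
schedule-flooding (suc f) γ (suc r) (s≤s r<f) = schedule-flooding f γ r r<f

schedule-skip : ∀ f γ r → schedule f γ (f + r) ≡ schedule 0 γ r
schedule-skip zero    γ r = refl
schedule-skip (suc f) γ r = schedule-skip f γ r

schedule-probing : ∀ f γ k → k < γ → schedule f γ (k + f) ≡ probing
schedule-probing f γ k k<γ rewrite +-comm k f = trans (schedule-skip f γ k) (probing-phase γ k k<γ)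
  where
  probing-phase : ∀ γ k → k < γ → schedule 0 γ k ≡ probing
  probing-phase (suc γ) zero    _         = refl
  probing-phase (suc γ) (suc k) (s≤s k<γ) = probing-phase γ k k<γ

schedule-inquire : ∀ f γ r → schedule f γ (r + (γ + f)) ≡ inquire 0 r
schedule-inquire f γ r = trans (cong (schedule f γ) (reorder r γ f))
  (trans (schedule-skip f γ (γ + r)) (skip-probing γ))
  where
  reorder : ∀ r γ f → r + (γ + f) ≡ f + (γ + r)
  reorder = solve-∀
  skip-probing : ∀ γ → schedule 0 γ (γ + r) ≡ inquire 0 r
  skip-probing zero    = refl
  skip-probing (suc γ) = skip-probing γ

inquire-even : ∀ j k → inquire j (k * 2) ≡ asking (j + k)
inquire-even j zero    = cong asking (sym (+-identityʳ j))
inquire-even j (suc k) = trans (inquire-even (suc j) k) (cong asking (sym (+-suc j k)))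

inquire-odd : ∀ j k → inquire j (suc (k * 2)) ≡ replying
inquire-odd j zero    = refl
inquire-odd j (suc k) = inquire-odd (suc j) k

-- In the probing rounds node i listens to the nodes in its slots probe i (depth blocks of width slots);
-- flood and inquiry k are the edges, from sender to receiver, of a flooding round and of query phase k.
record Protocol (n : ℕ) : Set where
  field
    {width depth} : ℕ
    flood         : Fin n → Fin n → Bool
    probe         : Wiring n width depth
    inquiry       : ℕ → Fin n → Fin n → Bool
    γ κ           : ℕ

-- During flooding, `fresh` marks a node that knows of a one and has yet to forward it; `asked`
-- remembers who queried in the preceding round. `name` is stored because `send` and `step` are not
-- told whose state they act on.
record NodeState (n : ℕ) : Set where
  field
    name    : Fin n
    clock   : ℕ
    opinion : Maybe Bool
    fresh   : Bool
    asked   : Fin n → Bool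

module Behaviour {n : ℕ} (P : Protocol n) where
  open Protocol P
  open NodeState

  duration : ℕ
  duration = κ * 2 + (γ + n)

  kindOf : ℕ → Kind
  kindOf = schedule n γ

  emission : Kind → NodeState n → Fin n → Maybe Bool
  emission flooding   s j = if fresh s ∧ flood (name s) j then opinion s else nothing
  emission probing    s j = if linked (name s) (probe j) then opinion s else nothing
  -- The bit of a query carries no information: the round identifies it as a query, and the
  -- recipient records only its arrival.
  emission (asking k) s j = if is-nothing (opinion s) ∧ inquiry k (name s) j then just true else nothing
  emission replying   s j = if asked s j then opinion s else nothing

  confirmed : Fin n → Maybe Bool → (Fin n → Maybe Bool) → Maybe Bool
  confirmed i nothing  inbox = nothing
  confirmed i (just b) inbox =
    -- A node may occur in its own slots, yet no message is ever sent to oneself, so its own opinion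
    -- is counted explicitly.
    if enough (λ j → does (j ≟ᶠ i) ∨ (inbox j says b)) (probe i) then just b else nothing

  adopted : Maybe Bool → (Fin n → Maybe Bool) → Maybe Bool
  adopted (just b) inbox = just b
  adopted nothing  inbox =
    if heard true inbox then just true else (if heard false inbox then just false else nothing)

  nextOpinion : Kind → NodeState n → (Fin n → Maybe Bool) → Maybe Bool
  nextOpinion flooding   s inbox = if heard true inbox then just true else opinion s
  nextOpinion probing    s inbox = confirmed (name s) (opinion s) inbox
  nextOpinion (asking k) s inbox = opinion s
  nextOpinion replying   s inbox = adopted (opinion s) inbox

  nextFresh : Kind → NodeState n → (Fin n → Maybe Bool) → Bool
  nextFresh flooding s inbox = heard true inbox ∧ not (opinion s says true)
  nextFresh _        s inbox = false

  nextAsked : Kind → (Fin n → Maybe Bool) → Fin n → Bool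
  nextAsked (asking k) inbox j = is-just (inbox j)
  nextAsked _          inbox j = false

  algorithm : Algorithm n
  algorithm = record
    { State    = NodeState n
    ; init     = λ i b → record { name = i ; clock = 0 ; opinion = just b ; fresh = b ; asked = λ _ → false }
    ; send     = λ s → emission (kindOf (clock s)) s
    ; step     = λ s inbox → record
        { name    = name s
        ; clock   = suc (clock s)
        ; opinion = nextOpinion (kindOf (clock s)) s inbox
        ; fresh   = nextFresh (kindOf (clock s)) s inbox
        ; asked   = nextAsked (kindOf (clock s)) inbox
        }
    -- Opinions stay provisional up to `duration`. A node that crashes earlier never decides, so
    -- agreement, which also covers crashed nodes, reduces to the nodes alive at `duration`.
    ; decision = λ s → if duration ≤ᵇ clock s then opinion s else nothing
    ; halted   = λ s → duration ≤ᵇ clock s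
    }

≤ᵇ-false : ∀ {m n} → n < m → (m ≤ᵇ n) ≡ false
≤ᵇ-false {m} {n} h with m ≤ᵇ n in eq
... | false = refl
... | true  = contradiction (≤ᵇ-true⁻ {m} {n} eq) (<⇒≱ h)

≡ᵇ-false : ∀ c r → r < c → (c ≡ᵇ r) ≡ false
≡ᵇ-false (suc c) zero    _         = refl
≡ᵇ-false (suc c) (suc r) (s≤s r<c) = ≡ᵇ-false c r r<c

survives : Maybe ℕ → ℕ → Bool
survives nothing  r = true
survives (just c) r = r ≤ᵇ c

module Run {n : ℕ} (P : Protocol n) (input : Fin n → Bool) (adv : Adversary n) where
  open Protocol P
  open NodeState
  open Behaviour P
  open Algorithm algorithm using (send; step; halted)
  open Execution algorithm input adv

  -- At `r` this means that the node takes part in round r, possibly crashing during it; at `suc r`,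
  -- that it gets through round r, so that all its messages of that round go out and its state is
  -- updated.
  alive : Fin n → ℕ → Bool
  alive i r = survives (crash adv i) r

  alive-mono : ∀ {i r r′} → r ≤ r′ → alive i r′ ≡ true → alive i r ≡ true
  alive-mono {i} r≤r′ h with crash adv i
  ... | nothing = refl
  ... | just c  = ≤ᵇ-true (≤-trans r≤r′ (≤ᵇ-true⁻ h))

  alive-pred : ∀ {i r} → alive i (suc r) ≡ true → alive i r ≡ true
  alive-pred {i} {r} = alive-mono {i} (n≤1+n r)

  crashedBy-alive : ∀ i r → crashedBy adv i r ≡ not (alive i (suc r))
  crashedBy-alive i r with crash adv i
  ... | nothing = refl
  ... | just c  = cases c r
    where
    cases : ∀ c r → (c <ᵇ r) ∨ (c ≡ᵇ r) ≡ not (r <ᵇ c)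
    cases zero    zero    = refl
    cases zero    (suc r) = refl
    cases (suc c) zero    = refl
    cases (suc c) (suc r) = cases c r

  config-step : ∀ {r i} → halted (config r i) ≡ false → alive i (suc r) ≡ true →
    config (suc r) i ≡ step (config r i) (λ j → sent r j i)
  config-step {r} {i} running a rewrite running | crashedBy-alive i r | a = refl

  config-halted : ∀ {r i} → halted (config r i) ≡ true → config (suc r) i ≡ config r i
  config-halted {r} {i} h rewrite h = refl

  config-dead : ∀ {r i} → alive i (suc r) ≡ false → config (suc r) i ≡ config r i
  config-dead {r} {i} d rewrite crashedBy-alive i r | d | ∨-zeroʳ (halted (config r i)) = refl

  name-config : ∀ r i → name (config r i) ≡ i
  name-config zero    i = refl
  name-config (suc r) i with halted (config r i) ∨ crashedBy adv i r
  ... | true  = name-config r i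
  ... | false = name-config r i

  mutual
    clock-alive : ∀ {r i} → r ≤ duration → alive i r ≡ true → clock (config r i) ≡ r
    clock-alive {zero}      _   _ = refl
    clock-alive {suc r} {i} r<R a = trans (cong clock (config-step (running r<R (alive-pred {i} a)) a))
      (cong suc (clock-alive (<⇒≤ r<R) (alive-pred {i} a)))

    running : ∀ {r i} → r < duration → alive i r ≡ true → halted (config r i) ≡ false
    running {r} {i} r<R a rewrite clock-alive {r} {i} (<⇒≤ r<R) a = ≤ᵇ-false r<R

  -- The clock of a crashed node has stopped, so it never reaches `duration`; `decided` rests on
  -- this.
  clock-dead : ∀ r i → alive i r ≡ false → r ≤ duration → clock (config r i) < r
  clock-dead zero i d _ with crash adv i
  clock-dead zero i () _ | nothing
  clock-dead zero i () _ | just c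
  clock-dead (suc r) i d r<R with alive i r in a
  ... | true  = s≤s (≤-reflexive (trans (cong clock (config-dead {r} {i} d)) (clock-alive {r} {i} (<⇒≤ r<R) a)))
  ... | false = subst (λ s → clock s < suc r) (sym (config-dead {r} {i} d)) (m≤n⇒m≤1+n (clock-dead r i a (<⇒≤ r<R)))

  halted-end : ∀ {i} → alive i duration ≡ true → halted (config duration i) ≡ true
  halted-end {i} a rewrite clock-alive {duration} {i} ≤-refl a = ≤ᵇ-true {duration} ≤-refl

  config-final : ∀ k i → config (k + duration) i ≡ config duration i
  config-final zero    i = refl
  config-final (suc k) i with alive i duration in a
  ... | true  = trans (config-halted (trans (cong halted (config-final k i)) (halted-end {i} a))) (config-final k i)
  ... | false with alive i (suc (k + duration)) in a′
  ...   | false = trans (config-dead a′) (config-final k i)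
  ...   | true with trans (sym a) (alive-mono {i} {duration} (m≤n⇒m≤1+n (m≤n+m duration k)) a′)
  ...     | ()

  config-after : ∀ r i → duration ≤ r → config r i ≡ config duration i
  config-after r i R≤r = trans (cong (λ r → config r i) (sym (m∸n+n≡m R≤r))) (config-final (r ∸ duration) i)

  sent-delivered : ∀ {r j i} → r < duration → alive j (suc r) ≡ true → j ≢ i →
    sent r j i ≡ emission (kindOf r) (config r j) i
  sent-delivered {r} {j} {i} r<R a j≢i = trans delivered
    (cong (λ c → emission (kindOf c) (config r j) i) (clock-alive {r} {j} (<⇒≤ r<R) (alive-pred {j} a)))
    where
    delivered : sent r j i ≡ send (config r j) i
    delivered with j ≟ᶠ i | running {r} {j} r<R (alive-pred {j} a)
    ... | yes j≡i | _   = contradiction j≡i j≢i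
    ... | no _    | run rewrite run with crash adv j
    ...   | nothing = refl
    ...   | just c rewrite a | ≡ᵇ-false c r (≤ᵇ-true⁻ {suc r} {c} a) = refl

  sent-send : ∀ {r j i b} → sent r j i ≡ just b →
    j ≢ i × halted (config r j) ≡ false × alive j r ≡ true × send (config r j) i ≡ just b
  sent-send {r} {j} {i} h with j ≟ᶠ i
  sent-send {r} {j} {i} () | yes _
  ... | no j≢i with halted (config r j)
  sent-send {r} {j} {i} () | no j≢i | true
  ...   | false with crash adv j
  ...     | nothing = j≢i , refl , refl , h
  ...     | just c with c ≡ᵇ r in c≡r | partial adv j i
  ...       | true  | true  = j≢i , refl , ≤ᵇ-true (≤-reflexive (sym (≡ᵇ⇒≡ c r (subst T (sym c≡r) _)))) , h
  sent-send {r} {j} {i} () | no j≢i | false | just c | true | false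
  ...       | false | _ with r <ᵇ c in r<c
  ...         | true  = j≢i , refl , ≤ᵇ-true (<⇒≤ (≤ᵇ-true⁻ {suc r} {c} r<c)) , h
  sent-send {r} {j} {i} () | no j≢i | false | just c | false | _ | false

  -- Unlike `sent-delivered`, this covers a sender that crashes within the round, and so yields only
  -- `alive j r`. The bound on `r` holds because a live node has halted by `duration`.
  sent-emission : ∀ {r j i b} → sent r j i ≡ just b →
    j ≢ i × r < duration × alive j r ≡ true × emission (kindOf r) (config r j) i ≡ just b
  sent-emission {r} {j} {i} h with sent-send {r} {j} {i} h
  ... | j≢i , run , a , em with duration ≤? r
  ...   | no R≰r = j≢i , ≰⇒> R≰r , a ,
    subst (λ c → emission (kindOf c) (config r j) i ≡ _) (clock-alive {r} {j} (<⇒≤ (≰⇒> R≰r)) a) em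
  ...   | yes R≤r with trans (sym run) (trans (cong halted (config-after r j R≤r)) (halted-end {j} (alive-mono {j} R≤r a)))
  ...     | ()

-- Flooding and probing

true≢false : ∀ {b} → b ≡ true → b ≡ false → ⊥
true≢false refl ()

if-just : ∀ {b} {x : Maybe Bool} {v} → (if b then x else nothing) ≡ just v → b ≡ true × x ≡ just v
if-just {true} h = refl , h

module Dynamics {n : ℕ} (P : Protocol n) (input : Fin n → Bool) (adv : Adversary n) where
  open Protocol P
  open NodeState
  open Behaviour P
  open Execution algorithm input adv
  open Run P input adv

  op : ℕ → Fin n → Maybe Bool
  op r i = opinion (config r i)

  inbox : ℕ → Fin n → Fin n → Maybe Bool
  inbox r i j = sent r j i

  module _ {r i} (r<R : r < duration) (a : alive i (suc r) ≡ true) where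

    private
      stepped = config-step {r} {i} (running {r} {i} r<R (alive-pred {i} a)) a
      on-time = clock-alive {r} {i} (<⇒≤ r<R) (alive-pred {i} a)

    op-step : op (suc r) i ≡ nextOpinion (kindOf r) (config r i) (inbox r i)
    op-step = trans (cong opinion stepped)
      (cong (λ c → nextOpinion (kindOf c) (config r i) (inbox r i)) on-time)

    fresh-step : fresh (config (suc r) i) ≡ nextFresh (kindOf r) (config r i) (inbox r i)
    fresh-step = trans (cong fresh stepped)
      (cong (λ c → nextFresh (kindOf c) (config r i) (inbox r i)) on-time)

    asked-step : ∀ j → asked (config (suc r) i) j ≡ nextAsked (kindOf r) (inbox r i) j
    asked-step j = trans (cong (λ s → asked s j) stepped)
      (cong (λ c → nextAsked (kindOf c) (inbox r i) j) on-time)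

  op-dead : ∀ {r i} → alive i (suc r) ≡ false → op (suc r) i ≡ op r i
  op-dead d = cong opinion (config-dead d)

  emission-opinion : ∀ k s {j b} → (∀ l → k ≢ asking l) → emission k s j ≡ just b → opinion s ≡ just b
  emission-opinion flooding   s _ h = proj₂ (if-just h)
  emission-opinion probing    s _ h = proj₂ (if-just h)
  emission-opinion replying   s _ h = proj₂ (if-just h)
  emission-opinion (asking l) s ¬asking h = contradiction refl (¬asking l)

  sent-opinion : ∀ {r j i b} → (∀ l → kindOf r ≢ asking l) → sent r j i ≡ just b →
    alive j r ≡ true × op r j ≡ just b
  sent-opinion {r} {j} {i} ¬asking h = let _ , _ , a , em = sent-emission {r} {j} {i} h in
    a , emission-opinion (kindOf r) (config r j) ¬asking em

  Source : ℕ → Bool → Set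
  Source r b = ∃ λ j → alive j r ≡ true × op r j ≡ just b

  confirmed-just : ∀ i x ib {b} → confirmed i x ib ≡ just b →
    x ≡ just b × enough (λ j → does (j ≟ᶠ i) ∨ (ib j says b)) (probe i) ≡ true
  confirmed-just i (just a) ib h with if-just {x = just a} h
  ... | en , refl = refl , en

  -- No round creates an opinion: it is kept from before or taken from a message, and outside the
  -- asking rounds messages carry opinions of live nodes. Validity and the persistence of unanimity
  -- both follow by induction.
  opinion-source : ∀ {r i b} → r < duration → alive i (suc r) ≡ true → op (suc r) i ≡ just b → Source r b
  opinion-source {r} {i} {b} r<R a h = cases (kindOf r) refl (trans (sym (op-step {r} {i} r<R a)) h)
    where
    self : op r i ≡ just b → Source r b
    self h = i , alive-pred {i} a , h
    heard-source : ∀ k → kindOf r ≡ k → (∀ l → k ≢ asking l) → ∀ b′ → heard b′ (inbox r i) ≡ true → Source r b′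
    heard-source k eq ¬asking b′ hr = let j , s = heard-witness b′ (inbox r i) hr in
      j , sent-opinion {r} {j} {i} (λ l e → ¬asking l (trans (sym eq) e)) s
    adopted-source : ∀ x → op r i ≡ x → kindOf r ≡ replying → adopted x (inbox r i) ≡ just b → Source r b
    adopted-source (just _) eq _ h = self (trans eq h)
    adopted-source nothing  _ k≡ h with heard true (inbox r i) in ht | heard false (inbox r i) in hf
    adopted-source nothing  _ k≡ refl | true  | _    = heard-source replying k≡ (λ l ()) true ht
    adopted-source nothing  _ k≡ refl | false | true = heard-source replying k≡ (λ l ()) false hf
    cases : ∀ k → kindOf r ≡ k → nextOpinion k (config r i) (inbox r i) ≡ just b → Source r b
    cases flooding k≡ h with heard true (inbox r i) in ht
    cases flooding k≡ refl | true = heard-source flooding k≡ (λ l ()) true ht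
    ... | false = self h
    cases probing    k≡ h = self (proj₁ (confirmed-just (name (config r i)) (op r i) (inbox r i) h))
    cases (asking l) k≡ h = self h
    cases replying   k≡ h = adopted-source (op r i) refl k≡ h

  valid : ∀ r i b → op r i ≡ just b → ∃ λ j → input j ≡ b
  valid zero    i b h = i , just-injective h
  valid (suc r) i b h with duration ≤? r
  ... | yes R≤r = valid r i b (trans (cong opinion (trans (config-after r i R≤r) (sym (config-after (suc r) i (m≤n⇒m≤1+n R≤r))))) h)
  ... | no  R≰r with alive i (suc r) in a
  ...   | true  = let j , _ , h′ = opinion-source {r} {i} (≰⇒> R≰r) a h in valid r j b h′
  ...   | false = valid r i b (trans (sym (op-dead {r} {i} a)) h)

  unanimity-step : ∀ {r v} → r < duration → (∀ i b → alive i r ≡ true → op r i ≡ just b → b ≡ v) →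
    ∀ i b → alive i (suc r) ≡ true → op (suc r) i ≡ just b → b ≡ v
  unanimity-step {r} r<R same i b a h =
    let j , aj , hj = opinion-source {r} {i} r<R a h in same j b aj hj

  n≤duration : n ≤ duration
  n≤duration = ≤-trans (m≤n+m n γ) (m≤n+m (γ + n) (κ * 2))

  module _ {r} (r<n : r < n) where

    private
      r<R : r < duration
      r<R = <-≤-trans r<n n≤duration
      k≡ : kindOf r ≡ flooding
      k≡ = schedule-flooding n γ r r<n

    flood-op : ∀ {i} → alive i (suc r) ≡ true →
      op (suc r) i ≡ (if heard true (inbox r i) then just true else op r i)
    flood-op {i} a = trans (op-step {r} {i} r<R a) (cong (λ k → nextOpinion k (config r i) (inbox r i)) k≡)

    flood-fresh : ∀ {i} → alive i (suc r) ≡ true →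
      fresh (config (suc r) i) ≡ heard true (inbox r i) ∧ not (op r i says true)
    flood-fresh {i} a = trans (fresh-step {r} {i} r<R a) (cong (λ k → nextFresh k (config r i) (inbox r i)) k≡)

    flood-sent : ∀ {j i} → alive j (suc r) ≡ true → j ≢ i → fresh (config r j) ≡ true → flood j i ≡ true →
      sent r j i ≡ op r j
    flood-sent {j} {i} a j≢i fr fl = trans (sent-delivered {r} {j} {i} r<R a j≢i)
      (trans (cong (λ k → emission k (config r j) i) k≡) emits)
      where
      emits : emission flooding (config r j) i ≡ op r j
      emits rewrite name-config r j | fr | fl = refl

    flood-sender : ∀ {j i b} → sent r j i ≡ just b →
      alive j r ≡ true × fresh (config r j) ≡ true × flood j i ≡ true
    flood-sender {j} {i} h = a , fr , subst (λ x → flood x i ≡ true) (name-config r j) fl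
      where
      em = sent-emission {r} {j} {i} h
      a = proj₁ (proj₂ (proj₂ em))
      both = ∧-true (proj₁ (if-just (trans (cong (λ k → emission k (config r j) i) (sym k≡)) (proj₂ (proj₂ (proj₂ em))))))
      fr = proj₁ both
      fl = proj₂ both

    flood-heard : ∀ {i} → alive i (suc r) ≡ true → heard true (inbox r i) ≡ true → op (suc r) i ≡ just true
    flood-heard {i} a h rewrite flood-op {i} a | h = refl

    flood-keeps : ∀ i → op r i ≡ just true → op (suc r) i ≡ just true
    flood-keeps i h with alive i (suc r) in a
    ... | false = trans (op-dead {r} {i} a) h
    ... | true rewrite flood-op {i} a with heard true (inbox r i)
    ...   | true  = refl
    ...   | false = h

  flood-defined : ∀ r i → r ≤ n → op r i ≢ nothing
  flood-defined zero    i _   ()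
  flood-defined (suc r) i r<n h with alive i (suc r) in a
  ... | false = flood-defined r i (<⇒≤ r<n) (trans (sym (op-dead {r} {i} a)) h)
  ... | true with trans (sym (flood-op r<n {i} a)) h
  ...   | h′ with heard true (inbox r i)
  flood-defined (suc r) i r<n h | true | () | true
  ...     | false = flood-defined r i (<⇒≤ r<n) h′

  fresh-knows : ∀ r i → r ≤ n → fresh (config r i) ≡ true → op r i ≡ just true
  fresh-knows zero    i _   h = cong just h
  fresh-knows (suc r) i r<n h with alive i (suc r) in a
  ... | false = trans (op-dead {r} {i} a) (fresh-knows r i (<⇒≤ r<n) (trans (sym (cong fresh (config-dead {r} {i} a))) h))
  ... | true  = flood-heard r<n {i} a (proj₁ (∧-true (trans (sym (flood-fresh r<n {i} a)) h)))

  fresh-was-ignorant : ∀ {r i} → r < n → alive i (suc r) ≡ true → fresh (config (suc r) i) ≡ true →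
    heard true (inbox r i) ≡ true × (op r i says true) ≡ false
  fresh-was-ignorant {r} {i} r<n a h =
    let hr , ignorant = ∧-true (trans (sym (flood-fresh r<n {i} a)) h) in hr , not-true ignorant

  knows : ℕ → Fin n → Bool
  knows r i = op r i says true

  -- A chain of fresh nodes, one per round, all distinct.
  fresh-growth : ∀ r i → r ≤ n → alive i r ≡ true → fresh (config r i) ≡ true → suc r ≤ card (knows r)
  fresh-growth zero    i _   a h = card-pos (knows 0) i (says-just (fresh-knows 0 i z≤n h))
  fresh-growth (suc r) i r<n a h =
    let hr , ignorant = fresh-was-ignorant {r} {i} r<n a h
        j , s = heard-witness true (inbox r i) hr
        aj , fj , _ = flood-sender r<n {j} {i} s
    in ≤-<-trans (fresh-growth r j (<⇒≤ r<n) aj fj)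
         (card-strict (λ k kn → says-just (flood-keeps r<n k (says-just⁻ (op r k) kn))) i
           (says-just (fresh-knows (suc r) i r<n h)) ignorant)

  -- A knower that is not fresh either was one a round earlier, where induction applies, or was
  -- fresh then and, having survived the round, has sent to all its neighbours. At round 0 every
  -- knower is fresh.
  flood-closed : ∀ r i j → r ≤ n → alive i r ≡ true → alive j r ≡ true → op r i ≡ just true →
    fresh (config r i) ≡ false → flood i j ≡ true → op r j ≡ just true
  flood-closed zero i j _ ai aj opi fr fl = contradiction fr (λ e → true≢false (just-injective opi) e)
  flood-closed (suc r) i j r<n ai aj opi fr fl with op r i says true in known
  ... | false = ⊥-elim (unheard (heard true (inbox r i)) refl)
    where
    unheard : ∀ b → heard true (inbox r i) ≡ b → ⊥
    unheard true  hr = true≢false (∧-intro hr (cong not known)) (trans (sym (flood-fresh r<n {i} ai)) fr)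
    unheard false hr = true≢false
      (says-just (trans (sym (trans (flood-op r<n {i} ai) (cong (λ b → if b then just true else op r i) hr))) opi)) known
  ... | true with fresh (config r i) in fr₀
  ...   | false = flood-keeps r<n j (flood-closed r i j (<⇒≤ r<n) (alive-pred {i} ai) (alive-pred {j} aj)
                    (says-just⁻ (op r i) known) fr₀ fl)
  ...   | true with i ≟ᶠ j
  ...     | yes refl = opi
  ...     | no  i≢j  = flood-heard r<n {j} aj (heard-from true (inbox r j) i
                         (trans (flood-sent r<n {i} {j} ai i≢j fr₀ fl) (says-just⁻ (op r i) known)))

  -- A node still fresh after `n` rounds would, by `fresh-growth`, make n + 1 knowers.
  flood-quiescent : ∀ i j → alive i n ≡ true → alive j n ≡ true → op n i ≡ just true → flood i j ≡ true →
    op n j ≡ just true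
  flood-quiescent i j ai aj opi fl with fresh (config n i) in fr
  ... | false = flood-closed n i j ≤-refl ai aj opi fr fl
  ... | true  = contradiction (fresh-growth n i ≤-refl ai fr) (≤⇒≯ (card-≤ (knows n)))

  holds : ℕ → Bool → Fin n → Bool
  holds r b i = alive i r ∧ (op r i says b)

  -- If both opinions had `w` live holders, an edge would lead from a knower to a live holder of the
  -- opinion `false`, against `flood-quiescent`.
  minority : ∀ w → (∀ X Y → w ≤ card X → w ≤ card Y → ∃ λ i → ∃ λ j → X i ≡ true × Y j ≡ true × flood i j ≡ true) →
    ∃ λ v → card (holds n (not v)) < w
  minority w spread with w ≤? card (holds n true) | w ≤? card (holds n false)
  ... | no  few | _       = false , ≰⇒> few
  ... | yes _   | no few  = true , ≰⇒> few
  ... | yes K   | yes Z   =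
    let i , j , Ki , Zj , fl = spread _ _ K Z
        ai , ki = ∧-true Ki
        aj , zj = ∧-true Zj
        k = flood-quiescent i j ai aj (says-just⁻ (op n i) ki) fl
    in contradiction (trans (sym k) (says-just⁻ (op n j) zj)) λ ()

  γ+n≤duration : γ + n ≤ duration
  γ+n≤duration = m≤n+m (γ + n) (κ * 2)

  module _ {k} (k<γ : k < γ) where

    private
      r = k + n
      r<R : r < duration
      r<R = <-≤-trans (+-monoˡ-< n k<γ) γ+n≤duration
      k≡ : kindOf r ≡ probing
      k≡ = schedule-probing n γ k k<γ

    probe-op : ∀ {i} → alive i (suc r) ≡ true → op (suc r) i ≡ confirmed i (op r i) (inbox r i)
    probe-op {i} a = trans (op-step {r} {i} r<R a)
      (trans (cong (λ k → nextOpinion k (config r i) (inbox r i)) k≡)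
        (cong (λ m → confirmed m (op r i) (inbox r i)) (name-config r i)))

    -- These are the hypotheses of `Contracts` for the holders of `b` after and before the round. A
    -- supporter may crash in mid-round, but it was alive at the start, which is all that
    -- `holds r b` asks.
    probe-holds : ∀ b i → holds (suc r) b i ≡ true → holds r b i ≡ true × enough (holds r b) (probe i) ≡ true
    probe-holds b i h = keep , enough-mono (probe i) senders (proj₂ conf)
      where
      a = proj₁ (∧-true h)
      conf = confirmed-just i (op r i) (inbox r i)
        (trans (sym (probe-op {i} a)) (says-just⁻ (op (suc r) i) (proj₂ (∧-true {alive i (suc r)} h))))
      keep : holds r b i ≡ true
      keep = ∧-intro (alive-pred {i} a) (says-just (proj₁ conf))
      senders : ∀ j → linked j (probe i) ≡ true → does (j ≟ᶠ i) ∨ (inbox r i j says b) ≡ true → holds r b j ≡ true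
      senders j _ s with ∨-true {does (j ≟ᶠ i)} s
      ... | inj₁ j≡i = subst (λ m → holds r b m ≡ true) (sym (does-true⁻ (j ≟ᶠ i) j≡i)) keep
      ... | inj₂ s′  = let aj , oj = sent-opinion {r} {j} {i} (λ l e → contradiction (trans (sym k≡) e) λ ())
                                       (says-just⁻ (inbox r i j) s′)
                       in ∧-intro aj (says-just oj)

    probe-sent : ∀ {j i b} → alive j (suc r) ≡ true → j ≢ i → linked j (probe i) ≡ true → op r j ≡ just b →
      sent r j i ≡ just b
    probe-sent {j} {i} a j≢i l h = trans (sent-delivered {r} {j} {i} r<R a j≢i)
      (trans (cong (λ k → emission k (config r j) i) k≡) (trans emits h))
      where
      emits : emission probing (config r j) i ≡ op r j
      emits rewrite name-config r j | l = refl

    -- Members of `C` outlive the whole run, so each hears every linked member and finds its support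
    -- within `C`.
    probe-core : ∀ v (C : Fin n → Bool) → (∀ i → C i ≡ true → alive i duration ≡ true) →
      (∀ i → C i ≡ true → enough C (probe i) ≡ true) →
      (∀ i → C i ≡ true → op r i ≡ just v) → ∀ i → C i ≡ true → op (suc r) i ≡ just v
    probe-core v C C-alive C-enough C-op i Ci = trans (probe-op {i} (live i Ci))
      (trans (cong (λ x → confirmed i x (inbox r i)) (C-op i Ci)) keeps)
      where
      live : ∀ j → C j ≡ true → alive j (suc r) ≡ true
      live j Cj = alive-mono {j} r<R (C-alive j Cj)
      receives : ∀ j → linked j (probe i) ≡ true → C j ≡ true → does (j ≟ᶠ i) ∨ (inbox r i j says v) ≡ true
      receives j l Cj = by-identity (j ≟ᶠ i)
        where
        by-identity : Dec (j ≡ i) → does (j ≟ᶠ i) ∨ (inbox r i j says v) ≡ true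
        by-identity (yes j≡i) = ∨-introˡ _ (does-true (j ≟ᶠ i) j≡i)
        by-identity (no  j≢i) = ∨-introʳ (does (j ≟ᶠ i))
          (says-just (probe-sent {j} {i} (live j Cj) j≢i l (C-op j Cj)))
      keeps : confirmed i (just v) (inbox r i) ≡ just v
      keeps rewrite enough-mono {q = λ j → does (j ≟ᶠ i) ∨ (inbox r i j says v)} (probe i) receives (C-enough i Ci) = refl

  minority-shrinks : ∀ {w} b → Contracts w probe → card (holds n b) < w → ∀ k → k ≤ γ →
    2 ^ k * card (holds (k + n) b) ≤ card (holds n b)
  minority-shrinks {w} b contracts small zero    _   = ≤-reflexive (+-identityʳ _)
  minority-shrinks {w} b contracts small (suc k) k<γ = begin
    2 * 2 ^ k * card (holds (suc k + n) b)     ≡⟨ cong (_* card (holds (suc k + n) b)) (*-comm 2 (2 ^ k)) ⟩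
    2 ^ k * 2 * card (holds (suc k + n) b)     ≡⟨ *-assoc (2 ^ k) 2 _ ⟩
    2 ^ k * (2 * card (holds (suc k + n) b))   ≤⟨ *-monoʳ-≤ (2 ^ k) (contracts _ _
                                                    (λ i h → proj₁ (probe-holds k<γ b i h)) bounded
                                                    (λ i h → proj₂ (probe-holds k<γ b i h))) ⟩
    2 ^ k * card (holds (k + n) b)             ≤⟨ previous ⟩
    card (holds n b)                           ∎
    where
    open ≤-Reasoning
    previous = minority-shrinks b contracts small k (<⇒≤ k<γ)
    bounded : card (holds (k + n) b) < w
    bounded = ≤-<-trans (m≤n*m (card (holds (k + n) b)) (2 ^ k) {{m^n≢0 2 k}}) (≤-<-trans previous small)

  -- After γ halvings a single remaining holder would require at least 2^γ holders at the start, but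
  -- there are fewer than w ≤ 2^γ.
  minority-vanishes : ∀ {w} b → Contracts w probe → card (holds n b) < w → w ≤ 2 ^ γ →
    ∀ i → alive i (γ + n) ≡ true → op (γ + n) i ≢ just b
  minority-vanishes {w} b contracts small w≤ i a h = <-irrefl refl (begin-strict
    2 ^ γ                              ≡⟨ *-identityʳ (2 ^ γ) ⟨
    2 ^ γ * 1                          ≤⟨ *-monoʳ-≤ (2 ^ γ) (card-pos (holds (γ + n) b) i (∧-intro a (says-just h))) ⟩
    2 ^ γ * card (holds (γ + n) b)     ≤⟨ minority-shrinks b contracts small γ ≤-refl ⟩
    card (holds n b)                   <⟨ small ⟩
    w                                  ≤⟨ w≤ ⟩
    2 ^ γ                              ∎)
    where open ≤-Reasoning

  core-probes : ∀ v (C : Fin n → Bool) → (∀ i → C i ≡ true → alive i duration ≡ true) →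
    (∀ i → C i ≡ true → enough C (probe i) ≡ true) → (∀ i → C i ≡ true → op n i ≡ just v) →
    ∀ k → k ≤ γ → ∀ i → C i ≡ true → op (k + n) i ≡ just v
  core-probes v C C-alive C-enough C-op zero    _   = C-op
  core-probes v C C-alive C-enough C-op (suc k) k<γ =
    probe-core k<γ v C C-alive C-enough (core-probes v C C-alive C-enough C-op k (<⇒≤ k<γ))

-- Inquiries and agreement

-- All that correctness and the message count need from the graphs; the sparse and the complete
-- protocol both supply it. The minority has fewer than `w` members, a set of `b₀` nodes is large
-- enough to have a core, and `s` is the guaranteed size of the core.
record Resilient {n : ℕ} (t : ℕ) (P : Protocol n) : Set where
  open Protocol P
  field
    w b₀ s dF dP D   : ℕ
    flood-spreads    : ∀ X Y → w ≤ card X → w ≤ card Y →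
                       ∃ λ i → ∃ λ j → X i ≡ true × Y j ≡ true × flood i j ≡ true
    probe-contracts  : Contracts w probe
    probe-cores      : ∀ B → b₀ ≤ card B → Σ (Fin n → Bool) λ C →
                       C ⊆ B × s ≤ card C × (∀ i → C i ≡ true → enough C (probe i) ≡ true)
    inquiry-spreads  : ∀ k X Y → n < 2 ^ suc k * card X → s ≤ card Y →
                       ∃ λ i → ∃ λ j → X i ≡ true × Y j ≡ true × inquiry k i j ≡ true
    w≤2^γ            : w ≤ 2 ^ γ
    n<2^κ            : n < 2 ^ κ
    -- The `suc` is gained because the minority has at most w - 1 members among the n - t survivors.
    enough-survivors : b₀ + w ≤ suc (n ∸ t)
    flood-degree     : ∀ i → card (flood i) ≤ dF
    probe-degree     : ∀ i → card (λ j → linked j (probe i)) ≤ dP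
    inquiry-degree   : ∀ k i → card (inquiry k i) ≤ D * 2 ^ k

  cost : ℕ
  -- The factor 2 stands for queries and replies, at most `D * n` of each per phase.
  cost = n * dF + γ * (n * dP) + κ * (2 * (D * n))

is-just-true : ∀ {x : Maybe Bool} → is-just x ≡ true → ∃ λ b → x ≡ just b
is-just-true {just b} _ = b , refl

is-nothing-true : ∀ {x : Maybe Bool} → is-nothing x ≡ true → x ≡ nothing
is-nothing-true {nothing} _ = refl

module Inquiries {n : ℕ} (P : Protocol n) (input : Fin n → Bool) (adv : Adversary n) where
  open Protocol P
  open NodeState
  open Behaviour P
  open Execution algorithm input adv
  open Run P input adv
  open Dynamics P input adv

  phase : ℕ → ℕ
  phase k = k * 2 + (γ + n)

  undecided : ℕ → Fin n → Bool
  undecided k i = alive i (phase k) ∧ is-nothing (op (phase k) i)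

  module _ {k} (k<κ : k < κ) where

    private
      r = phase k

    phase≤ : suc (suc r) ≤ duration
    phase≤ = +-monoˡ-≤ (γ + n) (*-monoˡ-≤ 2 k<κ)

    r<R : r < duration
    r<R = <-trans (n<1+n r) phase≤

    asks : kindOf r ≡ asking k
    asks = trans (schedule-inquire n γ (k * 2)) (inquire-even 0 k)

    replies : kindOf (suc r) ≡ replying
    replies = trans (schedule-inquire n γ (suc (k * 2))) (inquire-odd 0 k)

    ask-op : ∀ {i} → alive i (suc r) ≡ true → op (suc r) i ≡ op r i
    ask-op {i} a = trans (op-step {r} {i} r<R a) (cong (λ k → nextOpinion k (config r i) (inbox r i)) asks)

    reply-op : ∀ {i} → alive i (suc (suc r)) ≡ true → op (suc (suc r)) i ≡ adopted (op (suc r) i) (inbox (suc r) i)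
    reply-op {i} a = trans (op-step {suc r} {i} phase≤ a)
      (cong (λ k → nextOpinion k (config (suc r) i) (inbox (suc r) i)) replies)

    phase-keeps : ∀ {i b} → alive i (suc (suc r)) ≡ true → op r i ≡ just b → op (suc (suc r)) i ≡ just b
    phase-keeps {i} a h = trans (reply-op {i} a)
      (cong (λ x → adopted x (inbox (suc r) i)) (trans (ask-op {i} (alive-pred {i} a)) h))

    undecided-before : ∀ i → undecided (suc k) i ≡ true → op r i ≡ nothing
    undecided-before i u with op r i in o
    ... | nothing = refl
    ... | just b with trans (sym (phase-keeps {i} (proj₁ (∧-true u)) o))
                            (is-nothing-true (proj₂ (∧-true {alive i (suc (suc r))} u)))
    ...   | ()

    ask-sent : ∀ {i j} → alive i (suc r) ≡ true → i ≢ j → op r i ≡ nothing → inquiry k i j ≡ true →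
      sent r i j ≡ just true
    ask-sent {i} {j} a i≢j o q = trans (sent-delivered {r} {i} {j} r<R a i≢j)
      (trans (cong (λ k → emission k (config r i) j) asks) emits)
      where
      emits : emission (asking k) (config r i) j ≡ just true
      emits rewrite name-config r i | o | q = refl

    answered : ∀ i j b → alive i (suc (suc r)) ≡ true → alive j (suc (suc r)) ≡ true →
      op r i ≡ nothing → op r j ≡ just b → inquiry k i j ≡ true → heard b (inbox (suc r) i) ≡ true
    answered i j b ai aj oi oj q = heard-from b (inbox (suc r) i) j
      (trans (sent-delivered {suc r} {j} {i} phase≤ aj (λ j≡i → i≢j (sym j≡i)))
        (trans (cong (λ k → emission k (config (suc r) j) i) replies) emits))
      where
      i≢j : i ≢ j
      i≢j refl with trans (sym oi) oj
      ... | ()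
      aj′ = alive-pred {j} aj
      asked-by-i : asked (config (suc r) j) i ≡ true
      asked-by-i = trans (asked-step {r} {j} r<R aj′ i)
        (trans (cong (λ k → nextAsked k (inbox r j) i) asks)
          (cong is-just (ask-sent {i} {j} (alive-pred {i} ai) i≢j oi q)))
      emits : emission replying (config (suc r) j) i ≡ just b
      emits rewrite asked-by-i = trans (ask-op {j} aj′) oj

    adopted-heard : ∀ b ib → heard b ib ≡ true → adopted nothing ib ≢ nothing
    adopted-heard true  ib h rewrite h = λ ()
    adopted-heard false ib h with heard true ib
    ... | true  = λ ()
    ... | false rewrite h = λ ()

    -- An edge to a live node with an opinion would have brought an answer, and `adopted` would have
    -- taken some opinion from it.
    no-edge : ∀ i j b → undecided (suc k) i ≡ true → alive j duration ≡ true → op r j ≡ just b →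
      inquiry k i j ≡ false
    no-edge i j b u aj oj with inquiry k i j in q
    ... | false = refl
    ... | true  = contradiction still-nothing (adopted-heard b (inbox (suc r) i)
                    (answered i j b ai (alive-mono {j} phase≤ aj) oi oj q))
      where
      ai = proj₁ (∧-true {alive i (suc (suc r))} u)
      oi = undecided-before i u
      still-nothing : adopted nothing (inbox (suc r) i) ≡ nothing
      still-nothing = trans (cong (λ x → adopted x (inbox (suc r) i)) (sym (trans (ask-op {i} (alive-pred {i} ai)) oi)))
        (trans (sym (reply-op {i} ai)) (is-nothing-true (proj₂ (∧-true {alive i (suc (suc r))} u))))

  module _ {t} (res : Resilient t P) where
    open Resilient res

    module _ (v : Bool) (C : Fin n → Bool) (s≤C : s ≤ card C)
             (C-alive : ∀ i → C i ≡ true → alive i duration ≡ true)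
             (C-op : ∀ i → C i ≡ true → op (γ + n) i ≡ just v) where

      core-inquires : ∀ k → k ≤ κ → ∀ i → C i ≡ true → op (phase k) i ≡ just v
      core-inquires zero    _   i Ci = C-op i Ci
      core-inquires (suc k) k<κ i Ci = phase-keeps k<κ {i} (alive-mono {i} (phase≤ k<κ) (C-alive i Ci))
        (core-inquires k (<⇒≤ k<κ) i Ci)

      undecided-few : ∀ k → k ≤ κ → 2 ^ k * card (undecided k) ≤ n
      undecided-few zero    _   = ≤-trans (≤-reflexive (+-identityʳ _)) (card-≤ (undecided 0))
      undecided-few (suc k) k<κ with 2 ^ suc k * card (undecided (suc k)) ≤? n
      ... | yes few = few
      ... | no many = let i , j , ui , Cj , q = inquiry-spreads k _ C (≰⇒> many) s≤C in
        ⊥-elim (true≢false q (no-edge k<κ i j v ui (C-alive j Cj) (core-inquires k (<⇒≤ k<κ) j Cj)))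

      all-decide : ∀ i → alive i duration ≡ true → op duration i ≢ nothing
      all-decide i a o = <-irrefl refl (begin-strict
        n                                ≡⟨ *-identityʳ n ⟨
        n * 1                            <⟨ *-monoˡ-< 1 n<2^κ ⟩
        2 ^ κ * 1                        ≤⟨ *-monoʳ-≤ (2 ^ κ) (card-pos (undecided κ) i (∧-intro a (cong is-nothing o))) ⟩
        2 ^ κ * card (undecided κ)       ≤⟨ undecided-few κ ≤-refl ⟩
        n                                ∎)
        where open ≤-Reasoning

    unanimous : ∀ {v} → (∀ i b → alive i (γ + n) ≡ true → op (γ + n) i ≡ just b → b ≡ v) →
      ∀ i b → alive i duration ≡ true → op duration i ≡ just b → b ≡ v
    unanimous {v} start = later (κ * 2) ≤-refl
      where
      later : ∀ k → k ≤ κ * 2 → ∀ i b → alive i (k + (γ + n)) ≡ true → op (k + (γ + n)) i ≡ just b → b ≡ v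
      later zero    _ = start
      later (suc k) h = unanimity-step {k + (γ + n)} (+-monoˡ-< (γ + n) h) (later k (<⇒≤ h))

    survivors : faulty adv ≤ t → n ∸ t ≤ card (λ i → alive i duration)
    survivors few = m≤n+o⇒m∸n≤o n t (begin
      n                                                    ≡⟨ card-full {n} (λ _ → true) (λ _ → refl) ⟨
      card {n} (λ _ → true)                                ≤⟨ card-∪ {p = λ _ → true} {q = λ i → is-just (crash adv i)} classify ⟩
      faulty adv + card (λ i → alive i duration)           ≤⟨ +-monoˡ-≤ _ few ⟩
      t + card (λ i → alive i duration)                    ∎)
      where
      open ≤-Reasoning
      classify : ∀ i → true ≡ true → is-just (crash adv i) ≡ true ⊎ alive i duration ≡ true
      classify i _ with crash adv i
      ... | nothing = inj₂ refl
      ... | just c  = inj₁ refl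

    -- `few` is kept beside the agreement because the message count needs it too: it limits how many
    -- nodes send queries.
    record Outcome : Set where
      field
        value     : Bool
        few       : ∀ k → k ≤ κ → 2 ^ k * card (undecided k) ≤ n
        agreement : ∀ i → alive i duration ≡ true → op duration i ≡ just value

    outcome : faulty adv ≤ t → Outcome
    outcome few-faulty = record
      { value     = v
      ; few       = undecided-few v C s≤C C-alive C-op
      ; agreement = λ i a → conclude i a (op duration i) refl
      }
      where
      open ≤-Reasoning
      split = minority w flood-spreads
      v = proj₁ split
      majority : Fin n → Bool
      majority i = alive i duration ∧ (op n i says v)
      classify : ∀ i → alive i duration ≡ true → majority i ≡ true ⊎ holds n (not v) i ≡ true
      classify i a with op n i in o
      ... | nothing = contradiction o (flood-defined n i ≤-refl)
      ... | just b with b ≟ᵇ v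
      ...   | yes _   rewrite a = inj₁ refl
      ...   | no  b≢v rewrite alive-mono {i} n≤duration a | ¬-not b≢v = inj₂ (does-true (not v ≟ᵇ not v) refl)
      many : b₀ ≤ card majority
      many = +-cancelʳ-≤ w b₀ (card majority) (begin
        b₀ + w                                          ≤⟨ enough-survivors ⟩
        suc (n ∸ t)                                     ≤⟨ s≤s (survivors few-faulty) ⟩
        suc (card (λ i → alive i duration))             ≤⟨ s≤s (card-∪ {q = majority} classify) ⟩
        suc (card majority + card (holds n (not v)))    ≡⟨ +-suc _ _ ⟨
        card majority + suc (card (holds n (not v)))    ≤⟨ +-monoʳ-≤ (card majority) (proj₂ split) ⟩
        card majority + w                               ∎)
      core = probe-cores majority many
      C = proj₁ core
      C⊆ = proj₁ (proj₂ core)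
      s≤C = proj₁ (proj₂ (proj₂ core))
      C-alive : ∀ i → C i ≡ true → alive i duration ≡ true
      C-alive i Ci = proj₁ (∧-true (C⊆ i Ci))
      C-op : ∀ i → C i ≡ true → op (γ + n) i ≡ just v
      C-op = core-probes v C C-alive (proj₂ (proj₂ (proj₂ core)))
        (λ i Ci → says-just⁻ (op n i) (proj₂ (∧-true {alive i duration} (C⊆ i Ci)))) γ ≤-refl
      only-v : ∀ i b → alive i (γ + n) ≡ true → op (γ + n) i ≡ just b → b ≡ v
      only-v i b a o with b ≟ᵇ v
      ... | yes b≡v = b≡v
      ... | no  b≢v = ⊥-elim (minority-vanishes (not v) probe-contracts (proj₂ split) w≤2^γ i a
                        (trans o (cong just (¬-not b≢v))))
      conclude : ∀ i → alive i duration ≡ true → ∀ x → op duration i ≡ x → op duration i ≡ just v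
      conclude i a nothing  o = ⊥-elim (all-decide v C s≤C C-alive C-op i a o)
      conclude i a (just b) o = trans o (cong just (unanimous only-v i b a o))

-- Message count

module Messages {n : ℕ} (P : Protocol n) (input : Fin n → Bool) (adv : Adversary n)
                {t} (res : Resilient t P) where
  open Protocol P
  open NodeState
  open Behaviour P
  open Execution algorithm input adv
  open Run P input adv
  open Dynamics P input adv
  open Inquiries P input adv
  open Resilient res

  out : ℕ → Fin n → ℕ
  out r i = card (λ j → is-just (sent r i j))

  flood-out : ∀ r i → r < n → out r i ≤ dF
  flood-out r i r<n = ≤-trans
    (card-mono (λ j s → proj₂ (proj₂ (flood-sender r<n {i} {j} (proj₂ (is-just-true s)))))) (flood-degree i)

  -- Potential of the amortised count: a node that may still have to forward the flood holds `dF`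
  -- messages in reserve.
  unsent : ℕ → Fin n → Bool
  unsent r i = alive i r ∧ (not (op r i says true) ∨ fresh (config r i))

  -- A fresh live node spends its reserve: afterwards it has crashed, or it knows and is no longer
  -- fresh. Any other node is silent and regains nothing. Hence flooding costs `n * dF` in total and
  -- not per round.
  flood-potential : ∀ r i → r < n → out r i + dF * bit (unsent (suc r) i) ≤ dF * bit (unsent r i)
  flood-potential r i r<n = cases (alive i r) (fresh (config r i)) refl refl
    where
    unsent-pred : unsent (suc r) i ≡ true → unsent r i ≡ true
    unsent-pred u with ∧-true {alive i (suc r)} u
    ... | a , p with op r i says true in kn
    ...   | false = ∧-intro (alive-pred {i} a) refl
    ...   | true with ∨-true {not (op (suc r) i says true)} p
    ...     | inj₁ ignorant = contradiction (cong not (says-just (flood-keeps r<n i (says-just⁻ (op r i) kn))))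
                                (λ e → true≢false ignorant e)
    ...     | inj₂ fr = ⊥-elim (true≢false kn (proj₂ (fresh-was-ignorant {r} {i} r<n a fr)))
    silent : (alive i r ≡ true → fresh (config r i) ≡ true → ⊥) → out r i ≡ 0
    silent idle = card-zero _ none
      where
      none : ∀ j → is-just (sent r i j) ≡ false
      none j with sent r i j in s
      ... | nothing = refl
      ... | just b  = let a , fr , _ = flood-sender r<n {i} {j} s in ⊥-elim (idle a fr)
    idle-case : (alive i r ≡ true → fresh (config r i) ≡ true → ⊥) →
      out r i + dF * bit (unsent (suc r) i) ≤ dF * bit (unsent r i)
    idle-case idle rewrite silent idle = *-monoʳ-≤ dF (bit-mono unsent-pred)
    cases : ∀ a f → alive i r ≡ a → fresh (config r i) ≡ f →
      out r i + dF * bit (unsent (suc r) i) ≤ dF * bit (unsent r i)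
    cases false f     a≡ f≡ = idle-case (λ a _ → true≢false a a≡)
    cases true  false a≡ f≡ = idle-case (λ _ f → true≢false f f≡)
    cases true  true  a≡ f≡ = begin
      out r i + dF * bit (unsent (suc r) i)   ≡⟨ cong (λ b → out r i + dF * bit b) spent ⟩
      out r i + dF * 0                        ≡⟨ cong (out r i +_) (*-zeroʳ dF) ⟩
      out r i + 0                             ≡⟨ +-identityʳ (out r i) ⟩
      out r i                                 ≤⟨ flood-out r i r<n ⟩
      dF                                      ≡⟨ *-identityʳ dF ⟨
      dF * 1                                  ≡⟨ cong (λ b → dF * bit b) before ⟨
      dF * bit (unsent r i)                   ∎
      where
      open ≤-Reasoning
      before : unsent r i ≡ true
      before = ∧-intro a≡ (∨-introʳ (not (op r i says true)) f≡)
      known = fresh-knows r i (<⇒≤ r<n) f≡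
      spent : unsent (suc r) i ≡ false
      spent with alive i (suc r) in a
      ... | false = refl
      ... | true rewrite flood-keeps r<n i known | flood-fresh r<n {i} a | known = ∧-false (heard true (inbox r i))
        where
        ∧-false : ∀ b → b ∧ false ≡ false
        ∧-false true  = refl
        ∧-false false = refl

  flood-total : ∀ r → r ≤ n → messagesUpTo r + dF * card (unsent r) ≤ n * dF
  flood-total zero    _   = ≤-trans (*-monoʳ-≤ dF (card-≤ (unsent 0))) (≤-reflexive (*-comm dF n))
  flood-total (suc r) r<n = begin
    messagesUpTo r + messagesIn r + dF * card (unsent (suc r))
      ≡⟨ +-assoc (messagesUpTo r) (messagesIn r) _ ⟩
    messagesUpTo r + (messagesIn r + dF * card (unsent (suc r)))
      ≡⟨ cong (λ x → messagesUpTo r + (messagesIn r + x)) (∑-*ˡ (allFin n) dF (bit ∘ unsent (suc r))) ⟨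
    messagesUpTo r + (messagesIn r + ∑ (allFin n) (λ i → dF * bit (unsent (suc r) i)))
      ≡⟨ cong (messagesUpTo r +_) (∑-+ (allFin n) (out r) (λ i → dF * bit (unsent (suc r) i))) ⟨
    messagesUpTo r + ∑ (allFin n) (λ i → out r i + dF * bit (unsent (suc r) i))
      ≤⟨ +-monoʳ-≤ (messagesUpTo r) (∑-mono (allFin n) (λ i → flood-potential r i r<n)) ⟩
    messagesUpTo r + ∑ (allFin n) (λ i → dF * bit (unsent r i))
      ≡⟨ cong (messagesUpTo r +_) (∑-*ˡ (allFin n) dF (bit ∘ unsent r)) ⟩
    messagesUpTo r + dF * card (unsent r)
      ≤⟨ flood-total r (<⇒≤ r<n) ⟩
    n * dF ∎
    where open ≤-Reasoning

  messagesIn-swap : ∀ r → messagesIn r ≡ ∑ (allFin n) (λ j → card (λ i → is-just (sent r i j)))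
  messagesIn-swap r = ∑-swap (allFin n) (allFin n) (λ i j → bit (is-just (sent r i j)))

  -- Counted at the receivers: the slots of a node limit how many others it listens to, while one
  -- node may occur in the slots of many.
  probe-messages : ∀ k → k < γ → messagesIn (k + n) ≤ n * dP
  probe-messages k k<γ = begin
    messagesIn r                                                        ≡⟨ messagesIn-swap r ⟩
    ∑ (allFin n) (λ j → card (λ i → is-just (sent r i j)))              ≤⟨ ∑-mono (allFin n) (λ j →
                                                                             ≤-trans (card-mono (along j)) (probe-degree j)) ⟩
    ∑ (allFin n) (λ _ → dP)                                             ≡⟨ ∑Fin-const n dP ⟩
    n * dP                                                              ∎
    where
    open ≤-Reasoning
    r = k + n
    along : ∀ j i → is-just (sent r i j) ≡ true → linked i (probe j) ≡ true
    along j i s = let _ , _ , _ , em = sent-emission {r} {i} {j} (proj₂ (is-just-true s)) in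
      subst (λ x → linked x (probe j) ≡ true) (name-config r i)
        (proj₁ (if-just (trans (cong (λ k → emission k (config r i) j) (sym (schedule-probing n γ k k<γ))) em)))

  -- The growth of the query degree cancels against the shrinking set of askers: at most n / 2^k
  -- nodes send at most D · 2^k queries each.
  ask-messages : ∀ k → k < κ → 2 ^ k * card (undecided k) ≤ n → messagesIn (phase k) ≤ D * n
  ask-messages k k<κ few = begin
    messagesIn r                                                    ≤⟨ ∑-mono (allFin n) from-undecided ⟩
    ∑ (allFin n) (λ i → bit (undecided k i) * (D * 2 ^ k))          ≡⟨ ∑-*ʳ (allFin n) (bit ∘ undecided k) (D * 2 ^ k) ⟩
    card (undecided k) * (D * 2 ^ k)                                ≡⟨ rotate (card (undecided k)) D (2 ^ k) ⟩
    D * (2 ^ k * card (undecided k))                                ≤⟨ *-monoʳ-≤ D few ⟩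
    D * n                                                           ∎
    where
    open ≤-Reasoning
    r = phase k
    rotate : ∀ a b c → a * (b * c) ≡ b * (c * a)
    rotate = solve-∀
    sender : ∀ i j b → sent r i j ≡ just b → undecided k i ≡ true × inquiry k i j ≡ true
    sender i j b s = ∧-intro a (proj₁ both) , subst (λ x → inquiry k x j ≡ true) (name-config r i) (proj₂ both)
      where
      em = sent-emission {r} {i} {j} s
      a = proj₁ (proj₂ (proj₂ em))
      both = ∧-true (proj₁ (if-just (trans (cong (λ k → emission k (config r i) j) (sym (asks k<κ))) (proj₂ (proj₂ (proj₂ em))))))
    from-undecided : ∀ i → out r i ≤ bit (undecided k i) * (D * 2 ^ k)
    from-undecided i with undecided k i in u
    ... | true  = ≤-trans (card-mono (λ j s → proj₂ (sender i j _ (proj₂ (is-just-true s)))))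
                    (≤-trans (inquiry-degree k i) (≤-reflexive (sym (*-identityˡ _))))
    ... | false = ≤-reflexive (card-zero _ none)
      where
      none : ∀ j → is-just (sent r i j) ≡ false
      none j with sent r i j in s
      ... | nothing = refl
      ... | just b  = ⊥-elim (true≢false (proj₁ (sender i j b s)) u)

  -- Each reply reverses an edge along which a query was delivered, so the comparison is made after
  -- exchanging the two sums.
  reply-messages : ∀ k → k < κ → messagesIn (suc (phase k)) ≤ messagesIn (phase k)
  reply-messages k k<κ = ≤-trans (∑-mono (allFin n) (λ j → card-mono (asked-first j)))
    (≤-reflexive (sym (messagesIn-swap r)))
    where
    r = phase k
    asked-first : ∀ j i → is-just (sent (suc r) j i) ≡ true → is-just (sent r i j) ≡ true
    asked-first j i s = trans (sym asked≡) (proj₁ (if-just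
        (trans (cong (λ k → emission k (config (suc r) j) i) (sym (replies k<κ))) (proj₂ (proj₂ (proj₂ em))))))
      where
      em = sent-emission {suc r} {j} {i} (proj₂ (is-just-true s))
      asked≡ : asked (config (suc r) j) i ≡ is-just (sent r i j)
      asked≡ = trans (asked-step {r} {j} (r<R k<κ) (proj₁ (proj₂ (proj₂ em))) i)
        (cong (λ k → nextAsked k (inbox r j) i) (asks k<κ))

  total-after-probing : ∀ k → k ≤ γ → messagesUpTo (k + n) ≤ n * dF + k * (n * dP)
  total-after-probing zero    _   = ≤-trans (≤-trans (m≤m+n (messagesUpTo n) _) (flood-total n ≤-refl)) (m≤m+n (n * dF) 0)
  total-after-probing (suc k) k<γ = ≤-trans (+-mono-≤ (total-after-probing k (<⇒≤ k<γ)) (probe-messages k k<γ))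
    (≤-reflexive (collect (n * dF) (k * (n * dP)) (n * dP)))
    where
    collect : ∀ a b c → a + b + c ≡ a + (c + b)
    collect = solve-∀

  module _ (few : ∀ k → k ≤ κ → 2 ^ k * card (undecided k) ≤ n) where

    total-after-phases : ∀ k → k ≤ κ →
      messagesUpTo (phase k) ≤ n * dF + γ * (n * dP) + k * (2 * (D * n))
    total-after-phases zero    _   = ≤-trans (total-after-probing γ ≤-refl) (m≤m+n _ 0)
    total-after-phases (suc k) k<κ = ≤-trans
      (+-mono-≤ (+-mono-≤ (total-after-phases k (<⇒≤ k<κ)) asked≤) (≤-trans (reply-messages k k<κ) asked≤))
      (≤-reflexive (collect (n * dF + γ * (n * dP)) k (D * n)))
      where
      asked≤ = ask-messages k k<κ (few k (<⇒≤ k<κ))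
      collect : ∀ a k d → a + k * (2 * d) + d + d ≡ a + suc k * (2 * d)
      collect = solve-∀

    silence : ∀ r → duration ≤ r → messagesIn r ≡ 0
    silence r R≤r = trans (∑-cong (allFin n) (λ i → card-zero _ (none i))) (trans (∑Fin-const n 0) (*-zeroʳ n))
      where
      none : ∀ i j → is-just (sent r i j) ≡ false
      none i j with sent r i j in s
      ... | nothing = refl
      ... | just b  = contradiction R≤r (<⇒≱ (proj₁ (proj₂ (sent-emission {r} {i} {j} s))))

    messagesUpTo-mono : ∀ {r r′} → r ≤′ r′ → messagesUpTo r ≤ messagesUpTo r′
    messagesUpTo-mono ≤′-refl        = ≤-refl
    messagesUpTo-mono (≤′-step r≤r′) = ≤-trans (messagesUpTo-mono r≤r′) (m≤m+n _ _)

    total-messages : ∀ r → messagesUpTo r ≤ cost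
    total-messages zero = z≤n
    total-messages (suc r) with duration ≤? r
    ... | yes R≤r rewrite silence r R≤r | +-identityʳ (messagesUpTo r) = total-messages r
    ... | no  R≰r = ≤-trans (messagesUpTo-mono (≤⇒≤′ (≰⇒> R≰r))) (total-after-phases κ ≤-refl)

-- From final opinions to decisions

module Verdicts {n : ℕ} (P : Protocol n) (input : Fin n → Bool) (adv : Adversary n) where
  open Behaviour P
  open Execution algorithm input adv
  open Algorithm algorithm using (halted; decision)
  open Run P input adv
  open Dynamics P input adv

  -- A decision shows a clock of at least `duration`, which only nodes alive at `duration` reach,
  -- and configurations are frozen from then on.
  decided : ∀ {r i b} → decision (config r i) ≡ just b →
    duration ≤ r × alive i duration ≡ true × op duration i ≡ just b
  decided {r} {i} {b} d = late-enough (duration ≤? r)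
    where
    reached : duration ≤ NodeState.clock (config r i) × op r i ≡ just b
    reached = let late , o = if-just d in ≤ᵇ-true⁻ {duration} {NodeState.clock (config r i)} late , o
    early : ∀ a → alive i r ≡ a → r < duration → NodeState.clock (config r i) ≤ r
    early true  a r<R = ≤-reflexive (clock-alive {r} {i} (<⇒≤ r<R) a)
    early false a r<R = <⇒≤ (clock-dead r i a (<⇒≤ r<R))
    living : duration ≤ r → ∀ a → alive i duration ≡ a → alive i duration ≡ true
    living R≤r true  a = a
    living R≤r false a = contradiction
      (≤-trans (proj₁ reached) (≤-reflexive (cong NodeState.clock (config-after r i R≤r))))
      (<⇒≱ (clock-dead duration i a ≤-refl))
    late-enough : Dec (duration ≤ r) → duration ≤ r × alive i duration ≡ true × op duration i ≡ just b
    late-enough (no R≰r)  = contradiction (≤-trans (proj₁ reached) (early (alive i r) refl (≰⇒> R≰r))) R≰r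
    late-enough (yes R≤r) = R≤r , living R≤r (alive i duration) refl
      , trans (cong NodeState.opinion (sym (config-after r i R≤r))) (proj₂ reached)

  decision-persists : ∀ r i b → decision (config r i) ≡ just b → decision (config (suc r) i) ≡ just b
  decision-persists r i b d = let R≤r = proj₁ (decided {r} {i} d) in
    trans (cong decision (trans (config-after (suc r) i (m≤n⇒m≤1+n R≤r)) (sym (config-after r i R≤r)))) d

  alive-correct : ∀ i → (∀ c → crash adv i ≡ just c → duration ≤ c) → alive i duration ≡ true
  alive-correct i h with crash adv i
  ... | nothing = refl
  ... | just c  = ≤ᵇ-true (h c refl)

  decision-end : ∀ {i} → alive i duration ≡ true → decision (config duration i) ≡ op duration i
  decision-end {i} a = cong (λ h → if h then op duration i else nothing) (halted-end {i} a)

solves : ∀ {n t} (P : Protocol n) (res : Resilient t P) →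
  RoundBound n (Behaviour.duration P) → (∀ M → M ≤ Resilient.cost res → MessageBound n t M) →
  SolvesConsensusWithin n t (Behaviour.algorithm P)
solves {n} {t} P res rounds messages input adv few-faulty =
    (λ r i b d → valid duration i b (proj₂ (proj₂ (decided {r} {i} d))))
  , (λ r r′ i j b b′ d d′ → just-injective (trans (sym (decided-value r i b d)) (decided-value r′ j b′ d′)))
  , decision-persists
  , (duration , rounds , λ i correct → correct-halts i (alive-correct i correct))
  , within-budget
  where
  open Behaviour P
  open Execution algorithm input adv
  open Algorithm algorithm using (halted; decision)
  open Run P input adv
  open Dynamics P input adv
  open Verdicts P input adv
  open Inquiries P input adv
  open Outcome (outcome res few-faulty)

  decided-value : ∀ r i b → decision (config r i) ≡ just b → just value ≡ just b
  decided-value r i b d = let _ , a , o = decided {r} {i} d in trans (sym (agreement i a)) o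

  correct-halts : ∀ i → alive i duration ≡ true →
    halted (config duration i) ≡ true × ¬ (decision (config duration i) ≡ nothing)
  correct-halts i a = halted-end {i} a ,
    λ d → contradiction (trans (sym d) (trans (decision-end {i} a) (agreement i a))) λ ()

  within-budget : ∀ K → MessageBound n t (messagesUpTo K)
  within-budget K = messages (messagesUpTo K) (Messages.total-messages P input adv res few K)

-- Choice of the parameters

floor-log : ∀ n → 1 ≤ n → ∃ λ L → 2 ^ L ≤ n × n < 2 ^ suc L
floor-log (suc zero)    _ = 0 , ≤-refl , s≤s (s≤s z≤n)
floor-log (suc (suc n)) _ with floor-log (suc n) (s≤s z≤n)
... | L , lower , upper with suc (suc n) <? 2 ^ suc L
...   | yes below = L , m≤n⇒m≤1+n lower , below
...   | no  above = suc L , ≮⇒≥ above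
        , ≤-<-trans upper (^-monoʳ-< 2 (s≤s (s≤s z≤n)) (n<1+n (suc L)))

module Core (G : Wiring n g θ) (s : ℕ) (spreads : Spreads s s G) (B : Fin n → Bool) (2s≤B : s + s ≤ card B) where

  Closed : Set
  Closed = Σ (Fin n → Bool) λ C → C ⊆ B × s ≤ card C × (∀ i → C i ≡ true → enough C (G i) ≡ true)

  -- Everything removed so far lacks links to what remains, so fewer than s nodes are ever removed.
  removed-few : ∀ C → s ≤ card C → (∀ i → B i ≡ true → C i ≡ false → enough C (G i) ≡ false) →
    card (λ i → B i ∧ not (C i)) < s
  removed-few C s≤C lacking with s ≤? card (λ i → B i ∧ not (C i))
  ... | no  few  = ≰⇒> few
  ... | yes many = let i , out , en = spreads _ C many s≤C
                       Bi , ¬Ci = ∧-true {B i} out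
                   in ⊥-elim (true≢false en (lacking i Bi (not-true ¬Ci)))

  -- Nodes without support in the current set are removed one at a time, `fuel` bounding what is
  -- left. The invariant `s ≤ card C` lets `removed-few` apply `Spreads` to the removed nodes
  -- against `C`.
  peel : ∀ fuel C → card C ≤ fuel → C ⊆ B → s ≤ card C →
    (∀ i → B i ≡ true → C i ≡ false → enough C (G i) ≡ false) → Closed
  peel fuel C C≤fuel C⊆B s≤C lacking with any? (λ i → (C i ∧ not (enough C (G i))) ≟ᵇ true)
  ... | no  all-enough = C , C⊆B , s≤C , λ i Ci → closed i Ci (enough C (G i)) refl
    where
    closed : ∀ i → C i ≡ true → ∀ b → enough C (G i) ≡ b → enough C (G i) ≡ true
    closed i Ci true  en = en
    closed i Ci false en = ⊥-elim (all-enough (i , ∧-intro Ci (cong not en)))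
  ... | yes (x , bad) = recurse fuel C≤fuel
    where
    open ≤-Reasoning
    Cx = proj₁ (∧-true {C x} bad)
    C′ : Fin n → Bool
    C′ i = C i ∧ not (does (x ≟ᶠ i))
    C′⊆C : C′ ⊆ C
    C′⊆C i C′i = proj₁ (∧-true C′i)
    C′x : C′ x ≡ false
    C′x rewrite does-true (x ≟ᶠ x) refl | Cx = refl
    C≤1+C′ : card C ≤ card C′ + 1
    C≤1+C′ = ≤-trans (card-∪ {q = C′} {r = λ i → does (x ≟ᶠ i)} classify) (+-monoʳ-≤ (card C′) (card-point x))
      where
      classify : ∀ i → C i ≡ true → C′ i ≡ true ⊎ does (x ≟ᶠ i) ≡ true
      classify i Ci with does (x ≟ᶠ i)
      ... | true  = inj₂ refl
      ... | false = inj₁ (∧-intro Ci refl)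
    -- Of at least 2s nodes fewer than s have been removed, so more than s remain and one more may
    -- go.
    s<C : s < card C
    s<C = +-cancelʳ-< s s (card C) (begin-strict
      s + s                                                               ≤⟨ 2s≤B ⟩
      card B                                                              ≡⟨ card-split B C ⟩
      card (λ i → B i ∧ C i) + card (λ i → B i ∧ not (C i))               <⟨ +-mono-≤-< (card-mono (λ i → proj₂ ∘ ∧-true {B i}))
                                                                               (removed-few C s≤C lacking) ⟩
      card C + s                                                          ∎)
    s≤C′ : s ≤ card C′
    s≤C′ = +-cancelʳ-≤ 1 s (card C′) (≤-trans (≤-reflexive (+-comm s 1)) (≤-trans s<C C≤1+C′))
    still-lacking : ∀ i → enough C (G i) ≡ false → enough C′ (G i) ≡ false
    still-lacking i lacks with enough C′ (G i) in en
    ... | false = refl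
    ... | true  = ⊥-elim (true≢false (enough-mono (G i) (λ j _ → C′⊆C j) en) lacks)
    lacking′ : ∀ i → B i ≡ true → C′ i ≡ false → enough C′ (G i) ≡ false
    lacking′ i Bi C′i with C i in Ci
    ... | false = still-lacking i (lacking i Bi Ci)
    ... | true with x ≟ᶠ i
    ...   | yes refl = still-lacking x (not-true (proj₂ (∧-true {C x} bad)))
    lacking′ i Bi () | true | no _
    recurse : ∀ fuel → card C ≤ fuel → Closed
    recurse zero       C≤ = contradiction (≤-trans (card-pos C x Cx) C≤) λ ()
    recurse (suc fuel) C≤ = peel fuel C′ (s≤s⁻¹ (≤-trans (card-strict C′⊆C x Cx C′x) C≤))
      (λ i C′i → C⊆B i (C′⊆C i C′i)) s≤C′ lacking′

  core : Closed
  core = peel (card B) B ≤-refl (λ _ Bi → Bi) (≤-trans (m≤m+n s s) 2s≤B)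
    (λ i Bi ¬Bi → ⊥-elim (true≢false Bi ¬Bi))

-- At depth 0 `enough` holds vacuously and probing sends nothing. Complete flooding already leaves
-- no live holder of the minority opinion (`w` is 1), so there is nothing to contract; `γ` stays
-- `suc L` to give the duration of the sparse case.
completeProtocol : (n L : ℕ) → Protocol n
completeProtocol n L = record
  { flood = λ _ _ → true ; width = 0 ; depth = 0 ; probe = λ _ → [] ; inquiry = λ _ _ _ → true ; γ = suc L ; κ = suc L }

complete-resilient : ∀ {n} t L → t < n → n < 2 ^ suc L → Resilient t (completeProtocol n L)
complete-resilient {n} t L t<n n< = record
  { w = 1 ; b₀ = 1 ; s = 1 ; dF = n ; dP = 0 ; D = n
  ; flood-spreads = meet
  ; probe-contracts = λ X Y X⊆Y Y<1 _ → ≤-trans (*-monoʳ-≤ 2 (≤-trans (card-mono X⊆Y) (s≤s⁻¹ Y<1))) z≤n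
  ; probe-cores = λ B 1≤B → B , (λ _ Bi → Bi) , 1≤B , λ _ _ → refl
  ; inquiry-spreads = λ k X Y many → meet X Y (nonempty (2 ^ suc k) (card X) many)
  ; w≤2^γ = m^n>0 2 (suc L)
  ; n<2^κ = n<
  ; enough-survivors = s≤s (m<n⇒0<n∸m t<n)
  ; flood-degree = λ _ → card-≤ {n} (λ _ → true)
  ; probe-degree = λ _ → ≤-reflexive (card-zero {n} (λ _ → false) (λ _ → refl))
  ; inquiry-degree = λ k _ → ≤-trans (card-≤ {n} (λ _ → true)) (m≤m*n n (2 ^ k) {{m^n≢0 2 k}})
  }
  where
  meet : ∀ X Y → 1 ≤ card X → 1 ≤ card Y → ∃ λ i → ∃ λ j → X i ≡ true × Y j ≡ true × true ≡ true
  meet X Y 1≤X 1≤Y = let i , Xi = card-inhabited X 1≤X ; j , Yj = card-inhabited Y 1≤Y in i , j , Xi , Yj , refl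
  nonempty : ∀ p c → n < p * c → 1 ≤ c
  nonempty p zero    h = contradiction (subst (n <_) (*-zeroʳ p) h) λ ()
  nonempty p (suc c) _ = s≤s z≤n

n<suc[n/m]*m : ∀ n m .{{_ : NonZero m}} → n < suc (n / m) * m
n<suc[n/m]*m n m = begin-strict
  n                        ≡⟨ m≡m%n+[m/n]*n n m ⟩
  n % m + n / m * m        <⟨ +-monoˡ-< (n / m * m) (m%n<n n m) ⟩
  suc (n / m) * m          ∎
  where open ≤-Reasoning

links : ∀ {n d} → Wiring n d 1 → Fin n → Fin n → Bool
links G i j = linked j (G i)

spreads-links : ∀ {n d a b} (G : Wiring n d 1) → Spreads a b G → ∀ X Y → a ≤ card X → b ≤ card Y →
  ∃ λ i → ∃ λ j → X i ≡ true × Y j ≡ true × links G i j ≡ true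
spreads-links G spreads X Y a≤X b≤Y =
  let i , Xi , en = spreads X Y a≤X b≤Y
      j , l , Yj  = enough-witness (G i) en
  in i , j , Xi , Yj , l

module Sparse (n t L ratio : ℕ) (t<n : t < n) (n<2^[1+L] : n < 2 ^ suc L)
              (1≤ratio : 1 ≤ ratio) (n<ratio*m : n < ratio * (n ∸ t)) where

  private
    m = n ∸ t
    instance
      ratio≢0 : NonZero ratio
      ratio≢0 = >-nonZero 1≤ratio

  -- The core size `s` will satisfy n < 4 · ratio · s, which gives `q`; 9 · ratio is the `e` of
  -- `expanding`, covering twice that bound, and 3 is its `τ`. `Γ` is the factor that contraction
  -- demands between `w` and `n`.
  q width′ Γ : ℕ
  q      = 4 * ratio
  width′ = q * (9 * ratio + 3)
  Γ      = 16 * (width′ * width′)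

  1≤q : 1 ≤ q
  1≤q = *-mono-≤ {1} {4} (s≤s z≤n) 1≤ratio

  1≤width : 1 ≤ width′
  1≤width = *-mono-≤ 1≤q (≤-trans (s≤s z≤n) (m≤n+m 3 (9 * ratio)))

  ratio*16≤Γ : ratio * 16 ≤ Γ
  ratio*16≤Γ = begin
    ratio * 16                      ≡⟨ *-comm ratio 16 ⟩
    16 * ratio                      ≤⟨ *-monoʳ-≤ 16 ratio≤width² ⟩
    16 * (width′ * width′)          ∎
    where
    open ≤-Reasoning
    ratio≤width² : ratio ≤ width′ * width′
    ratio≤width² = begin
      ratio                         ≤⟨ m≤n*m ratio 4 ⟩
      q                             ≤⟨ m≤m*n q (9 * ratio + 3) {{>-nonZero (≤-trans (s≤s z≤n) (m≤n+m 3 (9 * ratio)))}} ⟩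
      width′                        ≤⟨ m≤m*n width′ width′ {{>-nonZero 1≤width}} ⟩
      width′ * width′               ∎

  1≤Γ : 1 ≤ Γ
  1≤Γ = ≤-trans (*-mono-≤ 1≤ratio (s≤s z≤n)) ratio*16≤Γ

  -- The assumption makes `w` positive and, through Γ ≥ 16 · ratio, forces n - t > 16, so that the
  -- rounding in `s` is harmless.
  module _ (Γ≤n : Γ ≤ n) where

    private
      instance
        Γ≢0 : NonZero Γ
        Γ≢0 = >-nonZero 1≤Γ

    -- The n - t survivors are split into thirds: two for the set to be peeled, one to cover the
    -- minority, as `w ≤ s`. `w` is the largest size with w · Γ ≤ n.
    s w : ℕ
    s = m / 3
    w = n / Γ

    open ≤-Reasoning

    1≤n : 1 ≤ n
    1≤n = ≤-trans (s≤s z≤n) t<n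

    m≤4s : m ≤ 4 * s
    m≤4s = begin
      m                     ≡⟨ m≡m%n+[m/n]*n m 3 ⟩
      m % 3 + s * 3         ≤⟨ +-monoˡ-≤ (s * 3) (s≤s⁻¹ (m%n<n m 3)) ⟩
      2 + s * 3             ≤⟨ +-monoˡ-≤ (s * 3) 2≤s ⟩
      s + s * 3             ≡⟨ collect s ⟩
      4 * s                 ∎
      where
      collect : ∀ s → s + s * 3 ≡ 4 * s
      collect = solve-∀
      16<m : 16 < m
      16<m = *-cancelˡ-< ratio 16 m (≤-<-trans (≤-trans ratio*16≤Γ Γ≤n) n<ratio*m)
      2≤s : 2 ≤ s
      2≤s = s≤s⁻¹ (*-cancelʳ-< 3 2 (suc s) (≤-<-trans (≤-trans (s≤s (s≤s (s≤s (s≤s (s≤s (s≤s z≤n)))))) (<⇒≤ 16<m)) (n<suc[n/m]*m m 3)))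

    n<4rs : n < q * s
    n<4rs = begin-strict
      n                     <⟨ n<ratio*m ⟩
      ratio * m             ≤⟨ *-monoʳ-≤ ratio m≤4s ⟩
      ratio * (4 * s)       ≡⟨ swap ratio s ⟩
      q * s                 ∎
      where
      swap : ∀ r s → r * (4 * s) ≡ 4 * r * s
      swap = solve-∀

    double-suc : ∀ {x} → n < x → 2 * n + 2 ≤ 2 * x
    double-suc {x} n<x = ≤-trans (≤-reflexive (expand n)) (*-monoʳ-≤ 2 n<x)
      where
      expand : ∀ n → 2 * n + 2 ≡ 2 * suc n
      expand = solve-∀

    2n+2≤9rs : 2 * n + 2 ≤ 9 * ratio * s
    2n+2≤9rs = begin
      2 * n + 2                           ≤⟨ double-suc n<4rs ⟩
      2 * (q * s)                         ≤⟨ m≤m+n _ (ratio * s) ⟩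
      2 * (q * s) + ratio * s             ≡⟨ collect ratio s ⟩
      9 * ratio * s                       ∎
      where
      collect : ∀ r s → 2 * (4 * r * s) + r * s ≡ 9 * r * s
      collect = solve-∀

    wΓ≤n : w * Γ ≤ n
    wΓ≤n = m/n*n≤m n Γ

    w≤s : w ≤ s
    w≤s = <⇒≤ (*-cancelʳ-< q w s (begin-strict
      w * q                 ≤⟨ *-monoʳ-≤ w (≤-trans (≤-reflexive (*-comm 4 ratio))
                                 (≤-trans (*-monoʳ-≤ ratio {4} {16} (s≤s (s≤s (s≤s (s≤s z≤n))))) ratio*16≤Γ)) ⟩
      w * Γ                 ≤⟨ wΓ≤n ⟩
      n                     <⟨ n<4rs ⟩
      q * s                 ≡⟨ *-comm q s ⟩
      s * q                 ∎))

    -- Rounding n/Γ down costs at most a factor 2, because the quotient is at least 1.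
    n<2Γw : n < 2 * Γ * w
    n<2Γw = begin-strict
      n                     <⟨ n<suc[n/m]*m n Γ ⟩
      Γ + w * Γ             ≤⟨ +-monoˡ-≤ (w * Γ) (m≤n*m Γ w {{>-nonZero 1≤w}}) ⟩
      w * Γ + w * Γ         ≡⟨ collect w Γ ⟩
      2 * Γ * w             ∎
      where
      collect : ∀ w G → w * G + w * G ≡ 2 * G * w
      collect = solve-∀
      1≤w : 1 ≤ w
      1≤w = s≤s⁻¹ (*-cancelʳ-< Γ 1 (suc w) (≤-<-trans (≤-trans (≤-reflexive (*-identityˡ Γ)) Γ≤n) (n<suc[n/m]*m n Γ)))

    -- Sets of `w` nodes have density above 1/(2Γ), whence `q` = 2Γ and `e` = 4Γ. The degree 8Γ² is
    -- the source of r^8.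
    floodWiring : Σ (Wiring n (2 * Γ * (4 * Γ)) 1) (Spreads w w)
    floodWiring = spreading n (2 * Γ) (4 * Γ) w w 1≤n 1≤2Γ (<⇒≤ n<2Γw)
      (≤-trans (double-suc n<2Γw) (≤-reflexive (regroup Γ w)))
      where
      1≤2Γ : 1 ≤ 2 * Γ
      1≤2Γ = ≤-trans 1≤Γ (m≤n*m Γ 2)
      regroup : ∀ G w → 2 * (2 * G * w) ≡ 4 * G * w
      regroup = solve-∀

    probeWiring : Σ (Wiring n width′ 6) λ G → Spreads s s G × Contracts w G
    probeWiring = expanding n q (9 * ratio) s w 1≤n 1≤q (<⇒≤ n<4rs) 2n+2≤9rs wΓ≤n

    -- The least c with n < 2^(k+1) · c. Then 2n + 2 ≤ 2^(k+2) · c, which fixes the `e` of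
    -- `inquiryWiring`.
    inquiryThreshold : ℕ → ℕ
    inquiryThreshold k = suc (n / 2 ^ suc k)
      where instance
        2^≢0 : NonZero (2 ^ suc k)
        2^≢0 = m^n≢0 2 (suc k)

    inquiryWiring : ∀ k → Σ (Wiring n (q * 2 ^ suc (suc k)) 1) (Spreads (inquiryThreshold k) s)
    inquiryWiring k = spreading n q (2 ^ suc (suc k)) (inquiryThreshold k) s 1≤n 1≤q (<⇒≤ n<4rs)
      (≤-trans (double-suc (subst (n <_) (*-comm (inquiryThreshold k) (2 ^ suc k)) (n<suc[n/m]*m n (2 ^ suc k))))
        (≤-reflexive (sym (*-assoc 2 (2 ^ suc k) (inquiryThreshold k)))))
      where instance
        2^≢0 : NonZero (2 ^ suc k)
        2^≢0 = m^n≢0 2 (suc k)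

    protocol : Protocol n
    protocol = record
      { flood   = links (proj₁ floodWiring)
      ; probe   = proj₁ probeWiring
      ; inquiry = λ k → links (proj₁ (inquiryWiring k))
      ; γ = suc L ; κ = suc L
      }

    resilient : Resilient t protocol
    resilient = record
      { w = w ; b₀ = s + s ; s = s
      ; dF = 1 * (2 * Γ * (4 * Γ)) ; dP = 6 * width′ ; D = 16 * ratio
      ; flood-spreads   = spreads-links (proj₁ floodWiring) (proj₂ floodWiring)
      ; probe-contracts = proj₂ (proj₂ probeWiring)
      ; probe-cores     = Core.core (proj₁ probeWiring) s (proj₁ (proj₂ probeWiring))
      ; inquiry-spreads = λ k X Y many → spreads-links (proj₁ (inquiryWiring k)) (proj₂ (inquiryWiring k)) X Y (enough-askers k (card X) many)
      ; w≤2^γ = ≤-trans (m/n≤m n Γ) (<⇒≤ n<2^[1+L])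
      ; n<2^κ = n<2^[1+L]
      ; enough-survivors = ≤-trans (+-monoʳ-≤ (s + s) w≤s) (≤-trans (≤-reflexive (triple s)) (m≤n⇒m≤1+n (m/n*n≤m m 3)))
      ; flood-degree   = λ i → card-linked (proj₁ floodWiring i)
      ; probe-degree   = λ i → card-linked (proj₁ probeWiring i)
      ; inquiry-degree = λ k i → ≤-trans (card-linked (proj₁ (inquiryWiring k) i)) (≤-reflexive (regroup ratio (2 ^ k)))
      }
      where
      triple : ∀ s → s + s + s ≡ s * 3
      triple = solve-∀
      regroup : ∀ r p → 1 * (4 * r * (2 * (2 * p))) ≡ 16 * r * p
      regroup = solve-∀
      enough-askers : ∀ k c → n < 2 ^ suc k * c → inquiryThreshold k ≤ c
      enough-askers k c many = *-cancelʳ-< (2 ^ suc k) (n / 2 ^ suc k) c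
        (≤-<-trans (m/n*n≤m n (2 ^ suc k)) (subst (n <_) (*-comm (2 ^ suc k) c) many))
        where instance
          2^≢0 : NonZero (2 ^ suc k)
          2^≢0 = m^n≢0 2 (suc k)

-- The 320 is 288 = 6 · 48 for probing plus 2 · 16 for queries and replies. Flooding contributes `A`
-- without the factor `l`.
cost-bound : ∀ n l R A {dF dP D} → dF ≤ A * R → dP ≤ 288 * R → D ≤ 16 * R →
  n * dF + l * (n * dP) + l * (2 * (D * n)) ≤ n * R * (A + 320 * l)
cost-bound n l R A {dF} {dP} {D} F≤ P≤ D≤ = begin
  n * dF + l * (n * dP) + l * (2 * (D * n))
    ≤⟨ +-mono-≤ (+-mono-≤ (*-monoʳ-≤ n F≤) (*-monoʳ-≤ l (*-monoʳ-≤ n P≤)))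
         (*-monoʳ-≤ l (*-monoʳ-≤ 2 (*-monoˡ-≤ n D≤))) ⟩
  n * (A * R) + l * (n * (288 * R)) + l * (2 * (16 * R * n))
    ≡⟨ collect n l R A ⟩
  n * R * (A + 320 * l) ∎
  where
  open ≤-Reasoning
  collect : ∀ n l R A → n * (A * R) + l * (n * (288 * R)) + l * (2 * (16 * R * n)) ≡ n * R * (A + 320 * l)
  collect = solve-∀

-- `A` is not multiplied by the logarithm, so a large `l` absorbs it; only `p * b` has to stay below
-- `c`.
log-dominates : ∀ p A b l c → p * A + p * b ≤ l → suc (p * b) ≤ c → p * (A + b * suc l) ≤ l * c
log-dominates p A b l c large small = begin
  p * (A + b * suc l)             ≡⟨ expand p A b l ⟩
  p * A + p * b + p * b * l       ≤⟨ +-monoˡ-≤ (p * b * l) large ⟩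
  l + p * b * l                   ≤⟨ *-monoˡ-≤ l small ⟩
  c * l                           ≡⟨ *-comm c l ⟩
  l * c                           ∎
  where
  open ≤-Reasoning
  expand : ∀ p A b l → p * (A + b * suc l) ≡ p * A + p * b + p * b * l
  expand = solve-∀

-- The 2^8 is the price of rounding n / (n - t) up to an integer `r` with r · m ≤ 2n. `L`, at most
-- lg n, replaces the real logarithm.
message-bound : ∀ n m r L c X M → r * m ≤ 2 * n → 2 ^ L ≤ n → 2 ^ 8 * X ≤ L * c → M ≤ n * r ^ 8 * X →
  2 ^ (M * m ^ 8) ≤ n ^ (c * n ^ 9)
message-bound n m r L c X M rm≤2n 2^L≤n X≤ M≤ = begin
  2 ^ (M * m ^ 8)             ≤⟨ ^-monoʳ-≤ 2 exponent ⟩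
  2 ^ (L * (c * n ^ 9))       ≡⟨ ^-*-assoc 2 L (c * n ^ 9) ⟨
  (2 ^ L) ^ (c * n ^ 9)       ≤⟨ ^-monoˡ-≤ (c * n ^ 9) 2^L≤n ⟩
  n ^ (c * n ^ 9)             ∎
  where
  open ≤-Reasoning
  gather : ∀ n ρ X μ → n * ρ * X * μ ≡ n * X * (ρ * μ)
  gather = solve-∀
  spread : ∀ n X p ν → n * X * (p * ν) ≡ p * X * (n * ν)
  spread = solve-∀
  exponent : M * m ^ 8 ≤ L * (c * n ^ 9)
  exponent = begin
    M * m ^ 8                     ≤⟨ *-monoˡ-≤ (m ^ 8) M≤ ⟩
    n * r ^ 8 * X * m ^ 8         ≡⟨ gather n (r ^ 8) X (m ^ 8) ⟩
    n * X * (r ^ 8 * m ^ 8)       ≡⟨ cong (n * X *_) (^-distribʳ-* r m 8) ⟨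
    n * X * (r * m) ^ 8           ≤⟨ *-monoʳ-≤ (n * X) (^-monoˡ-≤ 8 rm≤2n) ⟩
    n * X * (2 * n) ^ 8           ≡⟨ cong (n * X *_) (^-distribʳ-* 2 n 8) ⟩
    n * X * (2 ^ 8 * n ^ 8)       ≡⟨ spread n X (2 ^ 8) (n ^ 8) ⟩
    2 ^ 8 * X * n ^ 9             ≤⟨ *-monoˡ-≤ (n ^ 9) X≤ ⟩
    L * c * n ^ 9                 ≡⟨ *-assoc L c (n ^ 9) ⟩
    L * (c * n ^ 9)               ∎

-- The duration is n + 3(L + 1), so the truncated subtraction leaves exactly 3L.
round-bound : ∀ n L → 2 ^ L ≤ n → RoundBound n (suc L * 2 + (suc L + n))
round-bound n L 2^L≤n = begin
  2 ^ (suc L * 2 + (suc L + n) ∸ (n + 3))   ≡⟨ cong (λ x → 2 ^ (x ∸ (n + 3))) (collect n L) ⟩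
  2 ^ (n + 3 + L * 3 ∸ (n + 3))             ≡⟨ cong (2 ^_) (m+n∸m≡n (n + 3) (L * 3)) ⟩
  2 ^ (L * 3)                               ≡⟨ ^-*-assoc 2 L 3 ⟨
  (2 ^ L) ^ 3                               ≤⟨ ^-monoˡ-≤ 3 2^L≤n ⟩
  n ^ 3                                     ∎
  where
  open ≤-Reasoning
  collect : ∀ n L → suc L * 2 + (suc L + n) ≡ n + 3 + L * 3
  collect = solve-∀

-- `K` and `g` are abstract and tied to their values by equations, which keeps large numerals opaque
-- in the estimates; `Assembly` does the same.
module Magnitude (K r g : ℕ) (1≤r : 1 ≤ r) (K≡ : 16 * (48 * 48) ≡ K) (g≡ : g ≡ 4 * r * (9 * r + 3)) where

  open ≤-Reasoning

  private
    instance
      r≢0 : NonZero r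
      r≢0 = >-nonZero 1≤r
    ρ = r * r * (r * r)

  r^8 : ρ * ρ ≡ r ^ 8
  r^8 = regroup r
    where
    regroup : ∀ r → r * r * (r * r) * (r * r * (r * r)) ≡ r * (r * (r * (r * (r * (r * (r * (r * 1)))))))
    regroup = solve-∀

  r²≤r^8 : r * r ≤ r ^ 8
  r²≤r^8 = subst (r * r ≤_) r^8 (≤-trans (m≤m*n (r * r) (r * r)) (m≤m*n ρ ρ))
    where instance
      r²≢0 : NonZero (r * r)
      r²≢0 = m*n≢0 r r
      ρ≢0 : NonZero ρ
      ρ≢0 = m*n≢0 (r * r) (r * r)

  r≤r^8 : r ≤ r ^ 8
  r≤r^8 = ≤-trans (m≤m*n r r) r²≤r^8

  g≤48r² : g ≤ 48 * (r * r)
  g≤48r² = begin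
    g                               ≡⟨ g≡ ⟩
    4 * r * (9 * r + 3)             ≤⟨ *-monoʳ-≤ (4 * r) (+-monoʳ-≤ (9 * r) (m≤m*n 3 r)) ⟩
    4 * r * (9 * r + 3 * r)         ≡⟨ collect r ⟩
    48 * (r * r)                    ∎
    where
    collect : ∀ r → 4 * r * (9 * r + 3 * r) ≡ 48 * (r * r)
    collect = solve-∀

  6g≤288r^8 : 6 * g ≤ 288 * r ^ 8
  6g≤288r^8 = begin
    6 * g                   ≤⟨ *-monoʳ-≤ 6 g≤48r² ⟩
    6 * (48 * (r * r))      ≡⟨ *-assoc 6 48 (r * r) ⟨
    288 * (r * r)           ≤⟨ *-monoʳ-≤ 288 r²≤r^8 ⟩
    288 * r ^ 8             ∎

  Γ≤Kρ : 16 * (g * g) ≤ K * ρ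
  Γ≤Kρ = begin
    16 * (g * g)                                   ≤⟨ *-monoʳ-≤ 16 (*-mono-≤ g≤48r² g≤48r²) ⟩
    16 * (48 * (r * r) * (48 * (r * r)))           ≡⟨ regroup 16 48 (r * r) ⟩
    16 * (48 * 48) * ρ                             ≡⟨ cong (_* ρ) K≡ ⟩
    K * ρ                                          ∎
    where
    regroup : ∀ a b x → a * (b * x * (b * x)) ≡ a * (b * b) * (x * x)
    regroup = solve-∀

  square : ∀ x → x ≤ 16 * (g * g) → x * x ≤ K * K * r ^ 8
  square x x≤ = begin
    x * x                   ≤⟨ *-mono-≤ (≤-trans x≤ Γ≤Kρ) (≤-trans x≤ Γ≤Kρ) ⟩
    K * ρ * (K * ρ)         ≡⟨ regroup K ρ ⟩
    K * K * (ρ * ρ)         ≡⟨ cong (K * K *_) r^8 ⟩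
    K * K * r ^ 8           ∎
    where
    regroup : ∀ k x → k * x * (k * x) ≡ k * k * (x * x)
    regroup = solve-∀

  flood-degree-bound : ∀ Γ → Γ ≤ 16 * (g * g) → 1 * (2 * Γ * (4 * Γ)) ≤ 8 * (K * K) * r ^ 8
  flood-degree-bound Γ Γ≤ = begin
    1 * (2 * Γ * (4 * Γ))     ≡⟨ regroup Γ ⟩
    8 * (Γ * Γ)               ≤⟨ *-monoʳ-≤ 8 (square Γ Γ≤) ⟩
    8 * (K * K * r ^ 8)       ≡⟨ *-assoc 8 (K * K) (r ^ 8) ⟨
    8 * (K * K) * r ^ 8       ∎
    where
    regroup : ∀ G → 1 * (2 * G * (4 * G)) ≡ 8 * (G * G)
    regroup = solve-∀

n<2^n : ∀ n → n < 2 ^ n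
n<2^n zero    = s≤s z≤n
n<2^n (suc n) = ≤-<-trans (n<2^n n) (^-monoʳ-< 2 (s≤s (s≤s z≤n)) (n<1+n n))

module Assembly (K A c L₀ : ℕ) (K≡ : 16 * (48 * 48) ≡ K) (1≤K : 1 ≤ K) (A≡ : 8 * (K * K) ≡ A)
                (L₀≡ : 2 ^ 8 * A + 2 ^ 8 * 320 ≡ L₀) (c-large : suc (2 ^ 8 * 320) ≤ c) where

  Solved : ℕ → ℕ → Set
  Solved n t = Σ (Protocol n) λ P → Σ (Resilient t P) λ res →
    RoundBound n (Behaviour.duration P) × (∀ M → M ≤ Resilient.cost res → 2 ^ (M * (n ∸ t) ^ 8) ≤ n ^ (c * n ^ 9))

  K²≤L₀ : K * K ≤ L₀
  K²≤L₀ = begin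
    K * K                           ≤⟨ m≤n*m (K * K) 8 ⟩
    8 * (K * K)                     ≡⟨ A≡ ⟩
    A                               ≤⟨ m≤n*m A (2 ^ 8) ⟩
    2 ^ 8 * A                       ≤⟨ m≤m+n (2 ^ 8 * A) (2 ^ 8 * 320) ⟩
    2 ^ 8 * A + 2 ^ 8 * 320         ≡⟨ L₀≡ ⟩
    L₀                              ∎
    where open ≤-Reasoning

  1≤K² : 1 ≤ K * K
  1≤K² = *-mono-≤ 1≤K 1≤K

  1≤A : 1 ≤ A
  1≤A = ≤-trans 1≤K² (≤-trans (m≤n*m (K * K) 8) (≤-reflexive A≡))

  module _ (n t L r : ℕ) (K²≤n : K * K ≤ n) (L₀≤L : L₀ ≤ L) (2^L≤n : 2 ^ L ≤ n) (n<2^[1+L] : n < 2 ^ suc L)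
           (t<n : t < n) (1≤r : 1 ≤ r) (n<rm : n < r * (n ∸ t)) (rm≤2n : r * (n ∸ t) ≤ 2 * n) where

    open Sparse n t L r t<n n<2^[1+L] 1≤r n<rm using (width′; Γ; protocol; resilient)
    open Magnitude K r width′ 1≤r K≡ refl

    budget : ∀ dF dP D → dF ≤ A * r ^ 8 → dP ≤ 288 * r ^ 8 → D ≤ 16 * r ^ 8 → ∀ M →
      M ≤ n * dF + suc L * (n * dP) + suc L * (2 * (D * n)) → 2 ^ (M * (n ∸ t) ^ 8) ≤ n ^ (c * n ^ 9)
    budget dF dP D F≤ P≤ D≤ M M≤ = message-bound n (n ∸ t) r L c (A + 320 * suc L) M rm≤2n 2^L≤n
      (log-dominates (2 ^ 8) A 320 L c (≤-trans (≤-reflexive L₀≡) L₀≤L) c-large)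
      (≤-trans M≤ (cost-bound n (suc L) (r ^ 8) A F≤ P≤ D≤))

    sparse : Γ ≤ n → Solved n t
    sparse Γ≤n = protocol Γ≤n , resilient Γ≤n , round-bound n L 2^L≤n ,
      budget (1 * (2 * Γ * (4 * Γ))) (6 * width′) (16 * r)
        (subst (λ a → 1 * (2 * Γ * (4 * Γ)) ≤ a * r ^ 8) A≡ (flood-degree-bound Γ ≤-refl))
        6g≤288r^8 (*-monoʳ-≤ 16 r≤r^8)

    dense : n < Γ → Solved n t
    dense n<Γ = completeProtocol n L , complete-resilient t L t<n n<2^[1+L] , round-bound n L 2^L≤n ,
      budget n 0 n (≤-trans n≤r^8 (m≤n*m (r ^ 8) A {{>-nonZero 1≤A}})) z≤n (≤-trans n≤r^8 (m≤n*m (r ^ 8) 16))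
      where
      -- n < Γ ≤ K r^4 gives n² ≤ K² r^8, and K² ≤ n cancels the constant.
      n≤r^8 : n ≤ r ^ 8
      n≤r^8 = *-cancelˡ-≤ (K * K) {{>-nonZero 1≤K²}} (≤-trans (*-monoˡ-≤ n K²≤n) (square n (<⇒≤ n<Γ)))

    either : Solved n t
    either with Γ ≤? n
    ... | yes Γ≤n = sparse Γ≤n
    ... | no  Γ≰n = dense (≰⇒> Γ≰n)

  solution : ∀ n t → 2 ^ L₀ ≤ n → t < n → Solved n t
  solution n t large t<n =
    let L , 2^L≤n , n<2^[1+L] = floor-log n (≤-trans (s≤s z≤n) t<n) in
    either n t L (suc (n / m)) (≤-trans K²≤L₀ (≤-trans (<⇒≤ (n<2^n L₀)) large))
      (L₀≤ L n<2^[1+L]) 2^L≤n n<2^[1+L] t<n (s≤s z≤n) (n<suc[n/m]*m n m) rm≤2n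
    where
    m = n ∸ t
    instance
      m≢0 : NonZero m
      m≢0 = >-nonZero (m<n⇒0<n∸m t<n)
    L₀≤ : ∀ L → n < 2 ^ suc L → L₀ ≤ L
    L₀≤ L n< with L₀ ≤? L
    ... | yes h = h
    ... | no ¬h = contradiction (≤-trans (^-monoʳ-≤ 2 (≰⇒> ¬h)) large) (<⇒≱ n<)
    rm≤2n : suc (n / m) * m ≤ 2 * n
    rm≤2n = begin
      m + n / m * m     ≤⟨ +-mono-≤ (m∸n≤m n t) (m/n*n≤m n m) ⟩
      n + n             ≡⟨ cong (n +_) (+-identityʳ n) ⟨
      2 * n             ∎
      where open ≤-Reasoning

  -- `MessageBound` has the numeral 5^8 built in. While `c` is abstract it is reached through
  -- `bound`, which becomes the identity at c = 5^8.
  module _ (bound : ∀ n t M → 2 ^ (M * (n ∸ t) ^ 8) ≤ n ^ (c * n ^ 9) → MessageBound n t M) where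

    pick : ∀ n t → Dec (2 ^ L₀ ≤ n) → Dec (t < n) → Algorithm n
    pick n t (yes large) (yes t<n) = Behaviour.algorithm (proj₁ (solution n t large t<n))
    pick n t _           _         = Behaviour.algorithm (completeProtocol n 0)

    -- Generalised over both decisions, because the algorithm is built from whichever proofs `_≤?_`
    -- and `_<?_` return.
    pick-solves : ∀ n t → 2 ^ L₀ ≤ n → t < n → (d : Dec (2 ^ L₀ ≤ n)) (e : Dec (t < n)) →
      SolvesConsensusWithin n t (pick n t d e)
    pick-solves n t large t<n (yes p) (yes q) =
      let P , res , rounds , messages = solution n t p q in
      solves P res rounds (λ M M≤ → bound n t M (messages M M≤))
    pick-solves n t large t<n (yes _)     (no t≮n) = contradiction t<n t≮n
    pick-solves n t large t<n (no ¬large) _        = contradiction large ¬large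

    consensus : Σ ((n t : ℕ) → Algorithm n) λ A →
      Σ ℕ λ N → (n t : ℕ) → N ≤ n → t < n → SolvesConsensusWithin n t (A n t)
    consensus = (λ n t → pick n t (2 ^ L₀ ≤? n) (t <? n)) , 2 ^ L₀ ,
      λ n t large t<n → pick-solves n t large t<n (2 ^ L₀ ≤? n) (t <? n)

theorem8 : Σ ((n t : ℕ) → Algorithm n) λ A →
    Σ ℕ λ N → (n t : ℕ) → N ≤ n → t < n → SolvesConsensusWithin n t (A n t)
-- The decisive comparison is 2^8 · 320 = 81920 < 5^8 = 390625, settled by evaluating the Boolean
-- test.
theorem8 = Assembly.consensus K₀ A₀ (5 ^ 8) (2 ^ 8 * A₀ + 2 ^ 8 * 320)
  refl (s≤s z≤n) refl refl (≤ᵇ⇒≤ (suc (2 ^ 8 * 320)) (5 ^ 8) _) (λ n t M h → h)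
  where
  K₀ A₀ : ℕ
  K₀ = 16 * (48 * 48)
  A₀ = 8 * (K₀ * K₀)
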